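{- Let $R$ be a closed SMLL net (no occurrence of $\bot$ in its conclusions). Then the normal form of $R$ for $\to$ contains no cut links, no boxes, and no sync links; i.e. it is a plain MLL net.
   Context: SMLL formulas: $A ::= 1 \mid \bot \mid X \mid X^\bot \mid A\otimes A \mid A ⅋ A$ (⅋ is "par"), involutive negation with $1^\bot=\bot$, $(A\otimes B)^\bot=A^\bot ⅋ B^\bot$. Positive formulas $P ::= 1 \mid P\otimes P$; negative $N ::= \bot \mid N ⅋ N$. SMLL nets are built from axiom, cut, $\otimes$, ⅋, one (conclusion $1$) and bot (conclusion $\bot$) links, each bot link with a box of conclusions $\bot,\Gamma$ containing a net of conclusions $\Gamma$ (boxes nested or disjoint), and $n$-ary sync links whose $i$-th premiss and $i$-th conclusion share a positive or negative type (in-edges: positive premisses and negative conclusions; out-edges: positive conclusions and negative premisses). Correctness: no cyclic switching path (undirected simple path using at most one premiss of each ⅋ and at most one out-edge of each sync link) in the 0-graph (boxes replaced by single nodes, depth 0 only), and correct box contents. Reduction $\to$, at depth 0 only: axiom/cut; $\otimes$/⅋ cut replaced by two cuts; pushing a sync link above a $\otimes$ or ⅋ link; moving a sync from the positive conclusion $P$ of an axiom to its other conclusion $P^\bot$; moving a sync from premiss $P^\bot$ of a cut to the other premiss $P$; erasing a sync all of whose premisses are conclusions of one links; opening a box whose lock is cut against a one link. The reduction is strongly normalizing and confluent, so normal forms exist and are unique. -}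

module Defs where

open import Data.Nat using (ℕ; zero; suc; _<?_; _≡ᵇ_; s≤s)
open import Data.Bool using (if_then_else_)
open import Data.Product using (_×_; _,_; proj₁; proj₂)
open import Data.Sum using (_⊎_)
open import Data.Unit using (⊤)
open import Data.Empty using (⊥)
open import Data.Fin using (Fin; toℕ; fromℕ<)
open import Data.List using (List; []; _∷_; _++_; map; concatMap; length; lookup)
open import Data.List.Membership.Propositional using (_∈_; _∉_)
open import Data.List.Relation.Unary.All using (All)
open import Data.List.Relation.Unary.Unique.Propositional using (Unique)
open import Data.List.Relation.Binary.Permutation.Propositional using (_↭_)
open import Relation.Binary.PropositionalEquality using (_≡_)
open import Relation.Nullary using (¬_; yes; no)
open import Relation.Binary.Construct.Closure.ReflexiveTransitive using (Star)

infixr 6 _⊗_ _⅋_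

data Formula : Set where
  𝟏    : Formula
  ⊥ᶠ   : Formula
  at   : ℕ → Formula
  coat : ℕ → Formula
  _⊗_  : Formula → Formula → Formula
  _⅋_  : Formula → Formula → Formula

_ᗮ : Formula → Formula
𝟏 ᗮ = ⊥ᶠ
⊥ᶠ ᗮ = 𝟏
at x ᗮ = coat x
coat x ᗮ = at x
(A ⊗ B) ᗮ = (A ᗮ) ⅋ (B ᗮ)
(A ⅋ B) ᗮ = (A ᗮ) ⊗ (B ᗮ)

data Positive : Formula → Set where
  pos-1 : Positive 𝟏
  pos-⊗ : ∀ {A B} → Positive A → Positive B → Positive (A ⊗ B)

data Negative : Formula → Set where
  neg-⊥ : Negative ⊥ᶠ
  neg-⅋ : ∀ {A B} → Negative A → Negative B → Negative (A ⅋ B)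

data ⊥Free : Formula → Set where
  bf-1    : ⊥Free 𝟏
  bf-at   : ∀ x → ⊥Free (at x)
  bf-coat : ∀ x → ⊥Free (coat x)
  bf-⊗    : ∀ {A B} → ⊥Free A → ⊥Free B → ⊥Free (A ⊗ B)
  bf-⅋    : ∀ {A B} → ⊥Free A → ⊥Free B → ⊥Free (A ⅋ B)

-- Edges: a name (identifier) together with its type.

Edge : Set
Edge = ℕ × Formula

ty : Edge → Formula
ty = proj₂

-- Links.  A net is a list of links (its depth-0 links).  A box is
-- attached to its bot link: botL l Γ C has lock conclusion l (type ⊥),
-- the other box conclusions Γ, and content C (a net of conclusions Γ).
-- The edges Γ are shared by name between the box and its content.
-- A sync link is given by the list of pairs (i-th premiss, i-th conclusion).

data Link : Set where
  axL   : Edge → Edge → Link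
  cutL  : Edge → Edge → Link
  tensL : Edge → Edge → Edge → Link          -- premisses a, b; conclusion c
  parL  : Edge → Edge → Edge → Link          -- premisses a, b; conclusion c
  oneL  : Edge → Link
  botL  : Edge → List Edge → List Link → Link
  syncL : List (Edge × Edge) → Link

-- premisses / conclusions of a link as a node of the 0-graph
-- (a box, i.e. a bot link with its box, has no premisses and
-- conclusions ⊥,Γ)
prem0 : Link → List Edge
prem0 (axL a b) = []
prem0 (cutL a b) = a ∷ b ∷ []
prem0 (tensL a b c) = a ∷ b ∷ []
prem0 (parL a b c) = a ∷ b ∷ []
prem0 (oneL a) = []
prem0 (botL l Γ C) = []
prem0 (syncL ps) = map proj₁ ps

concl0 : Link → List Edge
concl0 (axL a b) = a ∷ b ∷ []
concl0 (cutL a b) = []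
concl0 (tensL a b c) = c ∷ []
concl0 (parL a b c) = c ∷ []
concl0 (oneL a) = a ∷ []
concl0 (botL l Γ C) = l ∷ Γ
concl0 (syncL ps) = map proj₂ ps

premsL0 : List Link → List Edge
premsL0 = concatMap prem0

conclsL0 : List Link → List Edge
conclsL0 = concatMap concl0

IsConclusion : List Link → Edge → Set
IsConclusion ls e = e ∈ conclsL0 ls × e ∉ premsL0 ls

-- producers / consumers at all depths (a box itself produces only its lock;
-- the edges Γ are produced inside the box)
mutual
  prods : Link → List Edge
  prods (botL l Γ C) = l ∷ prodsL C
  prods k = concl0 k

  prodsL : List Link → List Edge
  prodsL [] = []
  prodsL (k ∷ ks) = prods k ++ prodsL ks

mutual
  cons : Link → List Edge
  cons (botL l Γ C) = consL C
  cons k = prem0 k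

  consL : List Link → List Edge
  consL [] = []
  consL (k ∷ ks) = cons k ++ consL ks

edgesL : List Link → List Edge
edgesL ls = prodsL ls ++ consL ls

mutual
  LevelOK : List Link → Set
  LevelOK ls = (∀ e → e ∈ premsL0 ls → e ∈ conclsL0 ls) × AllLinkOK ls

  AllLinkOK : List Link → Set
  AllLinkOK [] = ⊤
  AllLinkOK (k ∷ ks) = LinkOK k × AllLinkOK ks

  LinkOK : Link → Set
  LinkOK (botL l Γ C) =
    LevelOK C × Unique Γ × (∀ e → e ∈ Γ → IsConclusion C e)
              × (∀ e → IsConclusion C e → e ∈ Γ)
  LinkOK _ = ⊤

WellFormed : List Link → Set
WellFormed ls = Unique (map proj₁ (prodsL ls)) × Unique (consL ls) × LevelOK ls

SyncPairOK : Edge × Edge → Set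
SyncPairOK (p , d) = ty p ≡ ty d × (Positive (ty p) ⊎ Negative (ty p))

mutual
  Typed : Link → Set
  Typed (axL a b) = ty b ≡ ty a ᗮ
  Typed (cutL a b) = ty b ≡ ty a ᗮ
  Typed (tensL a b c) = ty c ≡ ty a ⊗ ty b
  Typed (parL a b c) = ty c ≡ ty a ⅋ ty b
  Typed (oneL a) = ty a ≡ 𝟏
  Typed (botL l Γ C) = ty l ≡ ⊥ᶠ × TypedL C
  Typed (syncL []) = ⊥                        -- sync links have arity ≥ 1
  Typed (syncL (q ∷ qs)) = All SyncPairOK (q ∷ qs)

  TypedL : List Link → Set
  TypedL [] = ⊤
  TypedL (k ∷ ks) = Typed k × TypedL ks

next : ∀ {m} → Fin (suc m) → Fin (suc m)
next {m} i with toℕ i <? m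
... | yes p = fromℕ< (s≤s p)
... | no _ = Fin.zero

Adj : (ls : List Link) → Edge → Fin (length ls) → Fin (length ls) → Set
Adj ls x u w = (x ∈ concl0 (lookup ls u) × x ∈ prem0 (lookup ls w))
             ⊎ (x ∈ prem0 (lookup ls u) × x ∈ concl0 (lookup ls w))

ParPrem : Link → Edge → Set
ParPrem (parL a b c) x = (x ≡ a) ⊎ (x ≡ b)
ParPrem _ x = ⊥

SyncOut : Link → Edge → Set
SyncOut (syncL ps) x = (x ∈ map proj₂ ps × Positive (ty x))
                     ⊎ (x ∈ map proj₁ ps × Negative (ty x))
SyncOut _ x = ⊥

record SwitchingCycle (ls : List Link) : Set where
  field
    m      : ℕ
    v      : Fin (suc m) → Fin (length ls)
    e      : Fin (suc m) → Edge
    v-inj  : ∀ i j → v i ≡ v j → i ≡ j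
    e-inj  : ∀ i j → e i ≡ e j → i ≡ j
    adj    : ∀ i → Adj ls (e i) (v i) (v (next i))
    par-ok : ∀ k i j → ParPrem (lookup ls k) (e i) → ParPrem (lookup ls k) (e j) → i ≡ j
    sync-ok : ∀ k i j → SyncOut (lookup ls k) (e i) → SyncOut (lookup ls k) (e j) → i ≡ j

mutual
  Correct : List Link → Set
  Correct ls = ¬ SwitchingCycle ls × AllBoxesCorrect ls

  AllBoxesCorrect : List Link → Set
  AllBoxesCorrect [] = ⊤
  AllBoxesCorrect (k ∷ ks) = BoxCorrect k × AllBoxesCorrect ks

  BoxCorrect : Link → Set
  BoxCorrect (botL l Γ C) = Correct C
  BoxCorrect _ = ⊤

SMLLNet : List Link → Set
SMLLNet ls = WellFormed ls × TypedL ls × Correct ls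

Closed : List Link → Set
Closed ls = ∀ e → IsConclusion ls e → ⊥Free (ty e)

-- Reduction (at depth 0 only)

-- renaming the edge a into c (edges are identified by their names)
renE : Edge → Edge → Edge → Edge
renE a c x = if proj₁ x ≡ᵇ proj₁ a then c else x

mutual
  renLink : Edge → Edge → Link → Link
  renLink a c (axL x y) = axL (renE a c x) (renE a c y)
  renLink a c (cutL x y) = cutL (renE a c x) (renE a c y)
  renLink a c (tensL x y z) = tensL (renE a c x) (renE a c y) (renE a c z)
  renLink a c (parL x y z) = parL (renE a c x) (renE a c y) (renE a c z)
  renLink a c (oneL x) = oneL (renE a c x)
  renLink a c (botL l Γ C) = botL (renE a c l) (map (renE a c) Γ) (renLinks a c C)
  renLink a c (syncL ps) = syncL (map (λ q → renE a c (proj₁ q) , renE a c (proj₂ q)) ps)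

  renLinks : Edge → Edge → List Link → List Link
  renLinks a c [] = []
  renLinks a c (k ∷ ks) = renLink a c k ∷ renLinks a c ks

AxOf : Edge → Edge → Link → Set
AxOf a b k = (k ≡ axL a b) ⊎ (k ≡ axL b a)

CutOf : Edge → Edge → Link → Set
CutOf a b k = (k ≡ cutL a b) ⊎ (k ≡ cutL b a)

data BinLink : (Edge → Edge → Edge → Link) → Set where
  isTens : BinLink tensL
  isPar  : BinLink parL

Fresh : List Link → ℕ → Set
Fresh ls i = i ∉ map proj₁ (edgesL ls)

infix 4 _⟶_

data _⟶_ : List Link → List Link → Set where
  ax-cut : ∀ {ls rest k₁ k₂ a b c} →
    ls ↭ (k₁ ∷ k₂ ∷ rest) → AxOf a b k₁ → CutOf b c k₂ →
    ls ⟶ renLinks a c rest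
  tens-par : ∀ {ls rest k a b c a' b' c'} →
    ls ↭ (tensL a b c ∷ parL a' b' c' ∷ k ∷ rest) → CutOf c c' k →
    ls ⟶ cutL a a' ∷ cutL b b' ∷ rest
  sync-push : ∀ {ls rest K a b c d ps qs i j} → BinLink K →
    ls ↭ (K a b c ∷ syncL ps ∷ rest) → ps ↭ ((c , d) ∷ qs) →
    Fresh ls i → Fresh ls j → ¬ (i ≡ j) →
    ls ⟶ syncL ((a , (i , ty a)) ∷ (b , (j , ty b)) ∷ qs)
           ∷ K (i , ty a) (j , ty b) d ∷ rest
  sync-ax : ∀ {ls rest k a b d ps qs i} →
    ls ↭ (k ∷ syncL ps ∷ rest) → AxOf a b k → Positive (ty a) →
    ps ↭ ((a , d) ∷ qs) → Fresh ls i →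
    ls ⟶ axL d (i , ty b) ∷ syncL (((i , ty b) , b) ∷ qs) ∷ rest
  sync-cut : ∀ {ls rest k p x y ps qs i} →
    ls ↭ (syncL ps ∷ k ∷ rest) → ps ↭ ((p , y) ∷ qs) → CutOf x y k →
    Negative (ty y) → Fresh ls i →
    ls ⟶ syncL ((x , (i , ty x)) ∷ qs) ∷ cutL (i , ty x) p ∷ rest
  sync-one : ∀ {ls rest ps} →
    ls ↭ (syncL ps ∷ map (λ q → oneL (proj₁ q)) ps ++ rest) →
    ls ⟶ map (λ q → oneL (proj₂ q)) ps ++ rest
  box-open : ∀ {ls rest l Γ C x k} →
    ls ↭ (botL l Γ C ∷ oneL x ∷ k ∷ rest) → CutOf l x k →
    ls ⟶ C ++ rest

_⟶*_ : List Link → List Link → Set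
_⟶*_ = Star _⟶_

Normal : List Link → Set
Normal ls = ∀ ls' → ¬ (ls ⟶ ls')

data PlainLink : Link → Set where
  p-ax   : ∀ {a b} → PlainLink (axL a b)
  p-tens : ∀ {a b c} → PlainLink (tensL a b c)
  p-par  : ∀ {a b c} → PlainLink (parL a b c)
  p-one  : ∀ {a} → PlainLink (oneL a)

{-# OPTIONS --safe #-}
module Submission where

-- Every reduction preserves well-formedness, typing, closedness and the absence of
-- switching cycles: a simple cycle of the reduct either avoids the rewritten links, or
-- has a segment outside them that old links close into a cycle.
--
-- Suppose a normal closed net contains a box, a sync link or a cut.  From the lock of a
-- box (or a negative conclusion of a sync link) follow the edge downwards: it carries ⊥,
-- so it is not a conclusion of the net and reaches a cut.  As no rule applies, the other
-- premiss of this cut comes from a box, or from a positive conclusion of a sync link.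
-- In the first case continue from the lock of that box.  In the second case some premiss
-- of the sync link does not come from a one link, and it gives a way to continue.  This
-- walk never stops, and it enters sync links only through out-edges and leaves them only
-- through in-edges; so at its first repetition it closes into a switching cycle.

-- Equality of links is not decided, so one cannot ask outright whether a cycle visits a given link.
-- Such case distinctions take place inside refutations: refuting all cycles through a link proves
-- that the cycle at hand avoids it. For the same reason the next step of the walk exists only up to
-- double negation.
--
-- Paths record the direction of travel along each edge, so that a port of a link is a state. A
-- simple cycle then only needs distinct links; linearity recovers the distinct edges that
-- `SwitchingCycle` demands. The passage from `Cycle` to `SwitchingCycle` is enough, because
-- correctness enters as a negation.
--
-- The three rules that move a sync link share one argument: out-edges of the old sync link are
-- replaced by out-edges of the new one and in-edges by in-edges, so an exclusive port stays
-- exclusive.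

open import Defs
open import Data.Bool using (true; false; T)
open import Data.Nat using (ℕ; zero; suc; _+_; _≤_; _<_; _<?_; _⊔_; _≡ᵇ_; _≟_; s≤s)
import Data.Nat.Properties as ℕₚ
open import Data.Product using (_×_; _,_; proj₁; proj₂; ∃)
open import Data.Sum using (_⊎_; inj₁; inj₂; [_,_])
open import Data.Unit using (tt; ⊤)
open import Data.Empty using (⊥; ⊥-elim)
open import Data.Fin using (Fin; toℕ; fromℕ<)
import Data.Fin.Properties as Finₚ
open import Data.List using (List; []; _∷_; _++_; map; concatMap; length; lookup; reverse)
import Data.List.Properties as Listₚ
open import Data.List.Membership.Propositional using (_∈_; _∉_)
open import Data.List.Membership.Propositional.Properties using (∈-++⁻; ∈-++⁺ˡ; ∈-++⁺ʳ; ∈-map⁺; ∈-map⁻; ∈-∃++; ∈-lookup)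
open import Data.List.Membership.DecPropositional _≟_ using (_∈?_)
open import Data.List.Relation.Unary.Any as Any using (here; there)
import Data.List.Relation.Unary.Any.Properties as Anyₚ
open import Data.List.Relation.Unary.All as All using (All; []; _∷_)
import Data.List.Relation.Unary.All.Properties as Allₚ
open import Data.List.Relation.Unary.AllPairs using ([]; _∷_)
open import Data.List.Relation.Unary.Unique.Propositional using (Unique)
import Data.List.Relation.Unary.Unique.Propositional.Properties as Uniqueₚ
open import Data.List.Relation.Binary.Permutation.Propositional using (_↭_; ↭-sym; ↭-trans; ↭-refl; ↭-reflexive; prep; swap)
import Data.List.Relation.Binary.Permutation.Propositional.Properties as Permₚ
open import Relation.Binary.PropositionalEquality using (_≡_; _≢_; refl; sym; trans; cong; cong₂; subst; subst₂)
open import Relation.Nullary using (¬_; yes; no)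
open import Relation.Binary.Construct.Closure.ReflexiveTransitive using (ε; _◅_)

-- Lists without repetition

Unique-++⁻ : ∀ {A : Set} (xs : List A) {ys} → Unique (xs ++ ys) →
             Unique xs × Unique ys × (∀ {x} → x ∈ xs → x ∉ ys)
Unique-++⁻ [] u = [] , u , λ ()
Unique-++⁻ (x ∷ xs) (px ∷ u) with Unique-++⁻ xs u | Allₚ.++⁻ xs px
... | u₁ , u₂ , dis | p₁ , p₂ = (p₁ ∷ u₁) , u₂ , λ
  { (here refl) x∈ → All.lookup p₂ x∈ refl
  ; (there m) x∈ → dis m x∈ }

Unique-++⁺ : ∀ {A : Set} {xs ys : List A} → Unique xs → Unique ys →
             (∀ {x} → x ∈ xs → x ∉ ys) → Unique (xs ++ ys)
Unique-++⁺ u₁ u₂ dis = Uniqueₚ.++⁺ u₁ u₂ (λ (p , q) → dis p q)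

∉⇒All≢ : ∀ {A : Set} {x : A} {xs} → x ∉ xs → All (x ≢_) xs
∉⇒All≢ x∉ = All.tabulate λ y∈ → λ { refl → x∉ y∈ }

All≢⇒∉ : ∀ {A : Set} {x : A} {xs} → All (x ≢_) xs → x ∉ xs
All≢⇒∉ ps x∈ = All.lookup ps x∈ refl

Unique-∷ : ∀ {A : Set} {x : A} {xs} → x ∉ xs → Unique xs → Unique (x ∷ xs)
Unique-∷ x∉ u = ∉⇒All≢ x∉ ∷ u

Unique-resp-↭ : ∀ {A : Set} {xs ys : List A} → xs ↭ ys → Unique xs → Unique ys
Unique-resp-↭ _↭_.refl u = u
Unique-resp-↭ (prep x p) (px ∷ u) = Permₚ.All-resp-↭ p px ∷ Unique-resp-↭ p u
Unique-resp-↭ (swap x y p) ((x≢y ∷ px) ∷ py ∷ u) =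
  ((λ eq → x≢y (sym eq)) ∷ Permₚ.All-resp-↭ p py) ∷ Permₚ.All-resp-↭ p px ∷ Unique-resp-↭ p u
Unique-resp-↭ (_↭_.trans p q) u = Unique-resp-↭ q (Unique-resp-↭ p u)

Unique-swap-++ : ∀ {A : Set} (xs : List A) {ys} → Unique (xs ++ ys) → Unique (ys ++ xs)
Unique-swap-++ xs {ys} = Unique-resp-↭ (Permₚ.++-comm xs ys)

Unique-map-injective : ∀ {A B : Set} (f : A → B) {xs x y} → Unique (map f xs) →
                       x ∈ xs → y ∈ xs → f x ≡ f y → x ≡ y
Unique-map-injective f (p ∷ u) (here refl) (here refl) eq = refl
Unique-map-injective f {x ∷ xs} (p ∷ u) (here refl) (there m) eq =
  ⊥-elim (All≢⇒∉ p (subst (_∈ map f xs) (sym eq) (∈-map⁺ f m)))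
Unique-map-injective f {x ∷ xs} (p ∷ u) (there m) (here refl) eq =
  ⊥-elim (All≢⇒∉ p (subst (_∈ map f xs) eq (∈-map⁺ f m)))
Unique-map-injective f (p ∷ u) (there m) (there m') eq = Unique-map-injective f u m m' eq

concatMap-↭ : ∀ {A B : Set} (f : A → List B) {xs ys} → xs ↭ ys → concatMap f xs ↭ concatMap f ys
concatMap-↭ f _↭_.refl = ↭-refl
concatMap-↭ f (prep x p) = Permₚ.++⁺ˡ (f x) (concatMap-↭ f p)
concatMap-↭ f (swap x y p) =
  ↭-trans (Permₚ.shifts (f x) (f y)) (Permₚ.++⁺ˡ (f y) (Permₚ.++⁺ˡ (f x) (concatMap-↭ f p)))
concatMap-↭ f (_↭_.trans p q) = ↭-trans (concatMap-↭ f p) (concatMap-↭ f q)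

∈-concatMap⁺ : ∀ {A B : Set} (f : A → List B) {k xs y} → k ∈ xs → y ∈ f k → y ∈ concatMap f xs
∈-concatMap⁺ f (here refl) y∈ = ∈-++⁺ˡ y∈
∈-concatMap⁺ f {xs = x ∷ _} (there k∈) y∈ = ∈-++⁺ʳ (f x) (∈-concatMap⁺ f k∈ y∈)

∈-concatMap⁻ : ∀ {A B : Set} (f : A → List B) xs {y} → y ∈ concatMap f xs → ∃ λ k → k ∈ xs × y ∈ f k
∈-concatMap⁻ f (x ∷ xs) y∈ with ∈-++⁻ (f x) y∈
... | inj₁ p = x , here refl , p
... | inj₂ p with ∈-concatMap⁻ f xs p
...   | k , k∈ , q = k , there k∈ , q

-- Stated for positions, because the vertices of a `SwitchingCycle` are positions in the list of
-- links.
owner-unique : ∀ {A B : Set} (f : A → List B) xs → Unique (concatMap f xs) → ∀ {y} (i j : Fin (length xs)) →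
               y ∈ f (lookup xs i) → y ∈ f (lookup xs j) → i ≡ j
owner-unique f (x ∷ xs) u i j p q with Unique-++⁻ (f x) u
owner-unique f (x ∷ xs) u Fin.zero Fin.zero p q | _ = refl
owner-unique f (x ∷ xs) u Fin.zero (Fin.suc j) p q | _ , _ , dis =
  ⊥-elim (dis p (∈-concatMap⁺ f (∈-lookup {xs = xs} j) q))
owner-unique f (x ∷ xs) u (Fin.suc i) Fin.zero p q | _ , _ , dis =
  ⊥-elim (dis q (∈-concatMap⁺ f (∈-lookup {xs = xs} i) p))
owner-unique f (x ∷ xs) u (Fin.suc i) (Fin.suc j) p q | _ , u' , _ =
  cong Fin.suc (owner-unique f xs u' i j p q)

owner-unique∈ : ∀ {A B : Set} (f : A → List B) xs → Unique (concatMap f xs) → ∀ {y k k'} → k ∈ xs → k' ∈ xs →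
                y ∈ f k → y ∈ f k' → k ≡ k'
owner-unique∈ f xs u {y} k∈ k'∈ p q =
  trans (Anyₚ.lookup-index k∈)
    (trans (cong (lookup xs)
             (owner-unique f xs u (Any.index k∈) (Any.index k'∈)
               (subst (λ k → y ∈ f k) (Anyₚ.lookup-index k∈) p)
               (subst (λ k → y ∈ f k) (Anyₚ.lookup-index k'∈) q)))
           (sym (Anyₚ.lookup-index k'∈)))

extract : ∀ {A : Set} {x : A} {xs} → x ∈ xs → ∃ λ ys → xs ↭ x ∷ ys
extract x∈ with ∈-∃++ x∈
... | ys , zs , refl = ys ++ zs , Permₚ.shift _ ys zs

-- The rules ask for a permutation that puts the links of the redex first, whereas a search for a
-- redex yields memberships. Each link found uses up one occurrence, hence the requirement that they
-- be distinct.
extract-all : ∀ {A : Set} {ks ls : List A} → Unique ks → All (_∈ ls) ks → ∃ λ rest → ls ↭ ks ++ rest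
extract-all {ls = ls} [] [] = ls , ↭-refl
extract-all {ks = k ∷ ks} (k∉ ∷ u) (k∈ ∷ ks∈) with extract k∈
... | ls' , p with extract-all u (All.zipWith move (k∉ , ks∈))
  where
    move : ∀ {k'} → (k ≢ k') × (k' ∈ _) → k' ∈ ls'
    move (k≢ , m) with Permₚ.∈-resp-↭ p m
    ... | here refl = ⊥-elim (k≢ refl)
    ... | there m' = m'
...   | rest , q = rest , ↭-trans p (prep k q)

-- Switching paths.  A state is an edge with a direction of travel: dn e
-- goes from the producer of e to its consumer, up e the other way.

data State : Set where
  dn up : Edge → State

rev : State → State
rev (dn e) = up e
rev (up e) = dn e

edge : State → Edge
edge (dn e) = e
edge (up e) = e

rev-rev : ∀ s → rev (rev s) ≡ s
rev-rev (dn e) = refl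
rev-rev (up e) = refl

-- k can be entered by travelling along s (and left along rev s)
Ent : Link → State → Set
Ent k (dn e) = e ∈ prem0 k
Ent k (up e) = e ∈ concl0 k

-- the ports of which a switching keeps at most one
Excl : Link → State → Set
Excl (parL _ _ _) (dn e) = ⊤
Excl (syncL _) (dn e) = Negative (ty e)
Excl (syncL _) (up e) = Positive (ty e)
Excl _ _ = ⊥

-- The port by which `t` leaves `k` is `rev t`. `differ` compares ports and not edges: a link that
-- consumes its own conclusion can be entered and left along one edge, which gives a cycle of one
-- link.
record Pass (k : Link) (s t : State) : Set where
  constructor pass
  field
    enter  : Ent k s
    leave  : Ent k (rev t)
    differ : s ≢ rev t
    switch : Excl k s → ¬ Excl k (rev t)
open Pass

infixr 5 _∷_
data Path : State → List Link → State → Set where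
  []  : ∀ {s} → Path s [] s
  _∷_ : ∀ {s t u k ks} → Pass k s t → Path t ks u → Path s (k ∷ ks) u

-- Starting and ending in the same state makes the path close correctly: the last link is left, and
-- the first one entered, along `start`. Distinctness is asked of links only.
record Cycle (ls : List Link) : Set where
  constructor cycle
  field
    {start} : State
    {node}  : Link
    {nodes} : List Link
    path    : Path start (node ∷ nodes) start
    simple  : Unique (node ∷ nodes)
    inside  : All (_∈ ls) (node ∷ nodes)

Pass-rev : ∀ {k s t} → Pass k s t → Pass k (rev t) (rev s)
Pass-rev {k} {s} {t} (pass p q d x) =
  pass q (subst (Ent k) (sym (rev-rev s)) p)
    (λ eq → d (trans (sym (rev-rev s)) (sym eq)))
    (λ xt xs → x (subst (Excl k) (rev-rev s) xs) xt)

Path-++ : ∀ {s t u ks ks'} → Path s ks t → Path t ks' u → Path s (ks ++ ks') u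
Path-++ [] q = q
Path-++ (x ∷ p) q = x ∷ Path-++ p q

Path-++⁻ : ∀ ks {ks' s u} → Path s (ks ++ ks') u → ∃ λ t → Path s ks t × Path t ks' u
Path-++⁻ [] p = _ , [] , p
Path-++⁻ (k ∷ ks) (x ∷ p) with Path-++⁻ ks p
... | t , p₁ , p₂ = t , x ∷ p₁ , p₂

Path-rev : ∀ {s t ks} → Path s ks t → Path (rev t) (reverse ks) (rev s)
Path-rev [] = []
Path-rev {ks = k ∷ ks} (x ∷ p) =
  subst (λ l → Path _ l _) (sym (Listₚ.unfold-reverse k ks))
    (Path-++ (Path-rev p) (Pass-rev x ∷ []))

Path-first : ∀ {s t k ks} → Path s (k ∷ ks) t → Ent k s
Path-first (x ∷ _) = enter x

Path-last : ∀ {s t k ks} → Path s (k ∷ ks) t → ∃ λ k' → k' ∈ k ∷ ks × Ent k' (rev t)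
Path-last (x ∷ []) = _ , here refl , leave x
Path-last (x ∷ p@(_ ∷ _)) with Path-last p
... | k' , k'∈ , e = k' , there k'∈ , e

record CycleThrough (k : Link) (ls : List Link) : Set where
  constructor through
  field
    {from to} : State
    {nodes}   : List Link
    at-node   : Pass k from to
    around    : Path to nodes from
    avoids    : k ∉ nodes
    simple    : Unique nodes
    inside    : All (_∈ ls) nodes

rotate : ∀ {s ks ls k} → Path s ks s → Unique ks → All (_∈ ls) ks → k ∈ ks → CycleThrough k ls
rotate {ks = ks} p u a k∈ with ∈-∃++ k∈
... | ys , zs , refl with Path-++⁻ ys p | Unique-swap-++ ys u | Allₚ.++⁻ ys a
...   | t , p₁ , x ∷ p₂ | k∉ ∷ u' | a₁ , _ ∷ a₂ =
  through x (Path-++ p₂ p₁) (All≢⇒∉ k∉) u' (Allₚ.++⁺ a₂ a₁)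

record PathThrough (k : Link) (s : State) (ks : List Link) (t : State) : Set where
  constructor split
  field
    {from to}   : State
    {before after} : List Link
    shape    : ks ≡ before ++ k ∷ after
    to-node  : Path s before from
    at-node  : Pass k from to
    onwards  : Path to after t

Path-split : ∀ {s ks t k} → Path s ks t → k ∈ ks → PathThrough k s ks t
Path-split p k∈ with ∈-∃++ k∈
... | ys , zs , refl with Path-++⁻ ys p
...   | _ , p₁ , x ∷ p₂ = split refl p₁ x p₂

Cycle-mono : ∀ {ls ls'} → (∀ {k} → k ∈ ls → k ∈ ls') → Cycle ls → Cycle ls'
Cycle-mono f (cycle p u a) = cycle p u (All.map f a)

-- From cycles of states to switching cycles

record Linear (ls : List Link) : Set where
  constructor linear
  field
    producer : ∀ {e} (i j : Fin (length ls)) → e ∈ concl0 (lookup ls i) → e ∈ concl0 (lookup ls j) → i ≡ j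
    consumer : ∀ {e} (i j : Fin (length ls)) → e ∈ prem0 (lookup ls i) → e ∈ prem0 (lookup ls j) → i ≡ j

Ent-unique : ∀ {ls} → Linear ls → ∀ s (i j : Fin (length ls)) →
             Ent (lookup ls i) s → Ent (lookup ls j) s → i ≡ j
Ent-unique lin (dn e) = Linear.consumer lin
Ent-unique lin (up e) = Linear.producer lin

entry exit : ∀ {s ks t} → Path s ks t → Fin (length ks) → State
entry {s} (x ∷ p) Fin.zero = s
entry (x ∷ p) (Fin.suc i) = entry p i
exit (_∷_ {t = t} x p) Fin.zero = t
exit (x ∷ p) (Fin.suc i) = exit p i

Path-pass : ∀ {s ks t} (p : Path s ks t) i → Pass (lookup ks i) (entry p i) (exit p i)
Path-pass (x ∷ p) Fin.zero = x
Path-pass (x ∷ p) (Fin.suc i) = Path-pass p i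

exit-entry : ∀ {s ks t} (p : Path s ks t) (i j : Fin (length ks)) → toℕ j ≡ suc (toℕ i) → exit p i ≡ entry p j
exit-entry (x ∷ (y ∷ p)) Fin.zero (Fin.suc Fin.zero) eq = refl
exit-entry (x ∷ p) (Fin.suc i) (Fin.suc j) eq = exit-entry p i j (ℕₚ.suc-injective eq)

exit-last : ∀ {s ks t} (p : Path s ks t) (i : Fin (length ks)) → suc (toℕ i) ≡ length ks → exit p i ≡ t
exit-last (x ∷ []) Fin.zero eq = refl
exit-last (x ∷ p@(_ ∷ _)) (Fin.suc i) eq = exit-last p i (ℕₚ.suc-injective eq)

exit-next : ∀ {s k ks} (p : Path s (k ∷ ks) s) i → exit p i ≡ entry p (next i)
exit-next {ks = ks} p i with toℕ i <? length ks
... | yes q = exit-entry p i (fromℕ< (s≤s q)) (Finₚ.toℕ-fromℕ< (s≤s q))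
exit-next {ks = ks} p@(_ ∷ _) i | no q =
  exit-last p i (cong suc (ℕₚ.≤-antisym (ℕₚ.≤-pred (Finₚ.toℕ<n i)) (ℕₚ.≮⇒≥ q)))

lookup-Unique : ∀ {A : Set} {xs : List A} → Unique xs → ∀ i j → lookup xs i ≡ lookup xs j → i ≡ j
lookup-Unique (p ∷ u) Fin.zero Fin.zero eq = refl
lookup-Unique (p ∷ u) Fin.zero (Fin.suc j) eq = ⊥-elim (All.lookup p (∈-lookup j) eq)
lookup-Unique (p ∷ u) (Fin.suc i) Fin.zero eq = ⊥-elim (All.lookup p (∈-lookup i) (sym eq))
lookup-Unique (p ∷ u) (Fin.suc i) (Fin.suc j) eq = cong Fin.suc (lookup-Unique u i j eq)

-- Vertex `i` is the position of the `i`-th link, and edge `i` the one by which that link is left.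
-- By linearity a state determines the link it enters; injectivity of the edges and the two
-- switching conditions rest on this.
Cycle⇒SwitchingCycle : ∀ {ls} → Linear ls → Cycle ls → SwitchingCycle ls
Cycle⇒SwitchingCycle {ls} lin (cycle {s} {n} {ns} p u ins) = record
  { m = length ns ; v = v ; e = λ i → edge (exit p i)
  ; v-inj = v-inj
  ; e-inj = e-inj
  ; adj = λ i → adj i
  ; par-ok = λ k i j xi xj → clash k i j (dn (edge (exit p i))) (dn (edge (exit p j))) refl refl
      (ParEnt (lookup ls k) xi) (ParEnt (lookup ls k) xj)
      (ParExcl (lookup ls k) xi) (ParExcl (lookup ls k) xj)
  ; sync-ok = λ k i j xi xj → sync-clash k i j (SyncEnt (lookup ls k) xi) (SyncEnt (lookup ls k) xj) }
  where
    I = Fin (suc (length ns))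

    v : I → Fin (length ls)
    v i = Any.index (All.lookup ins (∈-lookup {xs = n ∷ ns} i))

    v-link : ∀ i → lookup (n ∷ ns) i ≡ lookup ls (v i)
    v-link i = Anyₚ.lookup-index (All.lookup ins (∈-lookup {xs = n ∷ ns} i))

    v-inj : ∀ i j → v i ≡ v j → i ≡ j
    v-inj i j eq = lookup-Unique u i j (trans (v-link i) (trans (cong (lookup ls) eq) (sym (v-link j))))

    passes : ∀ i → Pass (lookup ls (v i)) (entry p i) (exit p i)
    passes i = subst (λ k → Pass k (entry p i) (exit p i)) (v-link i) (Path-pass p i)

    enters-next : ∀ i → Ent (lookup ls (v (next i))) (exit p i)
    enters-next i = subst (Ent _) (sym (exit-next p i)) (enter (passes (next i)))

    adj : ∀ i → Adj ls (edge (exit p i)) (v i) (v (next i))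
    adj i with exit p i | leave (passes i) | enters-next i
    ... | dn x | l | r = inj₁ (l , r)
    ... | up x | l | r = inj₂ (l , r)

    same-entry : ∀ i j s → Ent (lookup ls (v i)) s → Ent (lookup ls (v j)) s → i ≡ j
    same-entry i j s p q = v-inj i j (Ent-unique lin s (v i) (v j) p q)

    same-exit : ∀ i j → exit p i ≡ exit p j → i ≡ j
    same-exit i j eq = same-entry i j (rev (exit p i)) (leave (passes i))
      (subst (λ s → Ent _ (rev s)) (sym eq) (leave (passes j)))

    -- An edge travelled in both directions would be entered and left through the same port.
    opposite : ∀ i j → exit p i ≡ rev (exit p j) → ⊥
    opposite i j eq = differ (passes i)
      (trans (sym (trans (exit-next p j) (cong (entry p) (sym i≡)))) (trans (sym (rev-rev _)) (cong rev (sym eq))))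
      where
        i≡ : i ≡ next j
        i≡ = same-entry i (next j) (exit p j)
          (subst (Ent _) (trans (cong rev eq) (rev-rev _)) (leave (passes i))) (enters-next j)

    e-inj : ∀ i j → edge (exit p i) ≡ edge (exit p j) → i ≡ j
    e-inj i j eq with exit p i in ei | exit p j in ej
    e-inj i j refl | dn x | dn .x = same-exit i j (trans ei (sym ej))
    e-inj i j refl | up x | up .x = same-exit i j (trans ei (sym ej))
    e-inj i j refl | dn x | up .x = ⊥-elim (opposite i j (trans ei (cong rev (sym ej))))
    e-inj i j refl | up x | dn .x = ⊥-elim (opposite i j (trans ei (cong rev (sym ej))))

    -- An edge has only two ends, so a port carrying edge `i` is either the one by which `v i` is
    -- left or the one by which `v (next i)` is entered. Two exclusive ports of one link then have
    -- the same index, or one is its entry and the other its exit, against `switch`.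
    meet : ∀ k i a → edge (exit p i) ≡ edge a → Ent (lookup ls k) a →
           (k ≡ v i × rev (exit p i) ≡ a) ⊎ (k ≡ v (next i) × exit p i ≡ a)
    meet k i a eq h with exit p i | leave (passes i) | enters-next i
    meet k i (dn x) refl h | dn .x | l | r = inj₂ (Ent-unique lin (dn x) _ _ h r , refl)
    meet k i (up x) refl h | dn .x | l | r = inj₁ (Ent-unique lin (up x) _ _ h l , refl)
    meet k i (dn x) refl h | up .x | l | r = inj₁ (Ent-unique lin (dn x) _ _ h l , refl)
    meet k i (up x) refl h | up .x | l | r = inj₂ (Ent-unique lin (up x) _ _ h r , refl)

    blocked : ∀ k i j a b → k ≡ v i → rev (exit p i) ≡ a → k ≡ v (next j) → exit p j ≡ b →
              Excl (lookup ls k) a → Excl (lookup ls k) b → ⊥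
    blocked k i j a b refl refl k≡ refl xa xb =
      switch (passes i)
        (subst (Excl _) (trans (exit-next p j) (cong (entry p) (v-inj _ _ (sym k≡)))) xb) xa

    clash : ∀ k i j a b → edge (exit p i) ≡ edge a → edge (exit p j) ≡ edge b →
            Ent (lookup ls k) a → Ent (lookup ls k) b →
            Excl (lookup ls k) a → Excl (lookup ls k) b → i ≡ j
    clash k i j a b ea eb ha hb xa xb with meet k i a ea ha | meet k j b eb hb
    ... | inj₁ (p₁ , _) | inj₁ (q₁ , _) = v-inj i j (trans (sym p₁) q₁)
    ... | inj₁ (p₁ , p₂) | inj₂ (q₁ , q₂) = ⊥-elim (blocked k i j a b p₁ p₂ q₁ q₂ xa xb)
    ... | inj₂ (p₁ , p₂) | inj₁ (q₁ , q₂) = ⊥-elim (blocked k j i b a q₁ q₂ p₁ p₂ xb xa)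
    ... | inj₂ (p₁ , p₂) | inj₂ (q₁ , q₂) = same-exit i j (trans (exit-next p i)
            (trans (cong (entry p) (v-inj _ _ (trans (sym p₁) q₁))) (sym (exit-next p j))))

    ParEnt : ∀ k {x} → ParPrem k x → x ∈ prem0 k
    ParEnt (parL a b c) (inj₁ refl) = here refl
    ParEnt (parL a b c) (inj₂ refl) = there (here refl)

    ParExcl : ∀ k {x} → ParPrem k x → Excl k (dn x)
    ParExcl (parL a b c) _ = tt

    SyncEnt : ∀ k {x} → SyncOut k x → ∃ λ a → x ≡ edge a × Ent k a × Excl k a
    SyncEnt (syncL ps) (inj₁ (m , q)) = up _ , refl , m , q
    SyncEnt (syncL ps) (inj₂ (m , q)) = dn _ , refl , m , q

    sync-clash : ∀ k i j → (∃ λ a → edge (exit p i) ≡ edge a × Ent (lookup ls k) a × Excl (lookup ls k) a) →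
                 (∃ λ a → edge (exit p j) ≡ edge a × Ent (lookup ls k) a × Excl (lookup ls k) a) → i ≡ j
    sync-clash k i j (a , ea , ha , xa) (b , eb , hb , xb) = clash k i j a b ea eb ha hb xa xb

-- Transporting acyclicity along a local replacement of A' by A

Disjoint : List Link → List Link → Set
Disjoint A R = ∀ {k} → k ∈ A → k ∉ R

-- `proper` matters when the segment to be closed is empty: the bridge alone is then the cycle, and
-- a cycle has at least one link.
record Bridge (A : List Link) (s t : State) : Set where
  constructor bridge
  field
    {nodes} : List Link
    path    : Path s nodes t
    proper  : nodes ≢ []
    simple  : Unique nodes
    inside  : All (_∈ A) nodes

close : ∀ {A R s t ks} → Disjoint A R → Bridge A s t → Path t ks s → Unique ks → All (_∈ R) ks →
        Cycle (A ++ R)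
close {A} d (bridge {[]} p ne u a) q v b = ⊥-elim (ne refl)
close {A} d (bridge {k ∷ ks} p ne u a) q v b =
  cycle (Path-++ p q) (Unique-++⁺ u v (λ m n → d (All.lookup a m) (All.lookup b n)))
    (Allₚ.++⁺ (All.map ∈-++⁺ˡ a) (All.map (∈-++⁺ʳ A) b))

Unique-reverse : ∀ {ks : List Link} → Unique ks → Unique (reverse ks)
Unique-reverse {ks} = Unique-resp-↭ (↭-sym (Permₚ.↭-reverse ks))

All-reverse : ∀ {P : Link → Set} {ks} → All P ks → All P (reverse ks)
All-reverse {ks = ks} = Permₚ.All-resp-↭ (↭-sym (Permₚ.↭-reverse ks))

Bridge-rev : ∀ {A s t} → Bridge A s t → Bridge A (rev t) (rev s)
Bridge-rev (bridge {ks} p ne u a) =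
  bridge (Path-rev p) (λ eq → ne (Permₚ.↭-empty-inv (subst (ks ↭_) eq (↭-sym (Permₚ.↭-reverse ks)))))
    (Unique-reverse u) (All-reverse a)

bridge₁ : ∀ {A k s t} → k ∈ A → Pass k s t → Bridge A s t
bridge₁ k∈ x = bridge (x ∷ []) (λ ()) ([] ∷ []) (k∈ ∷ [])

bridge-∷ : ∀ {A k s t u} → Pass k s t → (b : Bridge A t u) → k ∉ Bridge.nodes b → k ∈ A → Bridge A s u
bridge-∷ x (bridge p ne u a) k∉ k∈ = bridge (x ∷ p) (λ ()) (Unique-∷ k∉ u) (k∈ ∷ a)

bridge₂ : ∀ {A k k' s t u} → k ∈ A → k' ∈ A → k ≢ k' → Pass k s t → Pass k' t u → Bridge A s u
bridge₂ k∈ k'∈ ne x y = bridge-∷ x (bridge₁ k'∈ y) (λ { (here eq) → ne eq }) k∈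

avoid : ∀ {k : Link} {ks R} → k ∉ ks → All (_∈ k ∷ R) ks → All (_∈ R) ks
avoid k∉ [] = []
avoid k∉ (here refl ∷ a) = ⊥-elim (k∉ (here refl))
avoid k∉ (there m ∷ a) = m ∷ avoid (λ n → k∉ (there n)) a

-- A case distinction on whether the cycle visits `k`, made without deciding it: refuting all cycles
-- through `k` proves that this one lies in `ls`.
Cycle-avoid : ∀ {k ls} → Cycle (k ∷ ls) → (CycleThrough k (k ∷ ls) → ⊥) → (Cycle ls → ⊥) → ⊥
Cycle-avoid {k} (cycle p u a) visit miss = miss (cycle p u (avoid k∉ a))
  where
    k∉ : k ∉ _
    k∉ k∈ = visit (rotate p u a k∈)

-- Every passage through the new link `k` is simulated by old links. The rest of the cycle avoids
-- `k`, so it lies in `R`, which is disjoint from `A`.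
acyclic-one-node : ∀ {A R} k → Disjoint A R → (∀ {s t} → Pass k s t → Bridge A s t) →
                   ¬ Cycle (A ++ R) → ¬ Cycle (k ∷ R)
acyclic-one-node {A} k d f acyc c = Cycle-avoid c
  (λ (through x p k∉ u a) → acyc (close d (f x) p u (avoid k∉ a)))
  (λ c' → acyc (Cycle-mono (∈-++⁺ʳ A) c'))

acyclic-dead-nodes : ∀ {R} A' → (∀ {k s t} → k ∈ A' → ¬ Pass k s t) → ¬ Cycle R → ¬ Cycle (A' ++ R)
acyclic-dead-nodes [] f acyc c = acyc c
acyclic-dead-nodes (k ∷ A') f acyc c = Cycle-avoid c
  (λ (through x _ _ _ _) → f (here refl) x)
  (acyclic-dead-nodes A' (λ m → f (there m)) acyc)

-- The rules moving a sync link S across a link K.  In the old net, S is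
-- reached from K along β; the ports α of K become ports of the new sync S';
-- the port δ of S becomes a port of the new K', which S' reaches along the
-- fresh edges ι.  The ports θ of S are untouched.
record Slide (S S' K K' : Link) (R : List Link) : Set₁ where
  field
    α θ ι    : State → Set
    β δ      : State
    Internal : State → Set
    S-ports' : ∀ {s} → Ent S' s → α s ⊎ θ s ⊎ ι (rev s)
    K-ports' : ∀ {s} → Ent K' s → ι s ⊎ s ≡ δ
    ι-internal : ∀ {s} → ι s → Internal s × Internal (rev s)
    ι-anti   : ∀ {s} → ι s → ¬ ι (rev s)
    ι-once   : ∀ {u v} → ι u → ι v → Pass S' (rev v) u → ¬ Pass K' u (rev v)
    external : ∀ {k s} → k ∈ K ∷ S ∷ R → Ent k s → ¬ Internal s
    α-pass   : ∀ {s} → α s → Pass K s β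
    αα-pass  : ∀ {s t} → α s → α (rev t) → Pass S' s t → Pass K s t
    β-port   : Ent S β
    δ-port   : Ent S δ
    θ-port   : ∀ {s} → θ s → Ent S s
    β≢δ      : β ≢ δ
    θ≢β      : ∀ {s} → θ s → s ≢ β
    θ≢δ      : ∀ {s} → θ s → s ≢ δ
    βδ-excl  : Excl S β → ¬ Excl S δ
    α-excl   : ∀ {s} → α s → Excl S β → Excl S' s
    ι-excl   : ∀ {s} → ι s → Excl S δ → Excl S' (rev s)
    θ-excl   : ∀ {s} → Excl S s → Excl S' s
    K≢S      : K ≢ S
    disjoint : Disjoint (K ∷ S ∷ []) R

-- The fresh edges join only `S'` and `K'`, so a path through `R` neither begins nor ends on one
-- unless it is empty. Up to direction, a cycle meeting `S'` passes it between ports in `α` and `θ`,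
-- or continues along a fresh edge to `K'` and leaves at `δ`; the links `K` and `S` simulate both.
-- Going through two fresh edges is excluded by `ι-once`, and without `S'` there is no way through
-- `K'`.
acyclic-slide : ∀ {S S' K K' R} → Slide S S' K K' R → ¬ Cycle (K ∷ S ∷ R) → ¬ Cycle (S' ∷ K' ∷ R)
acyclic-slide {S} {S'} {K} {K'} {R} sl acyc c = Cycle-avoid c throughS
  (λ c' → Cycle-avoid c' throughK (λ c'' → acyc (Cycle-mono (λ m → there (there m)) c'')))
  where
    open Slide sl
    Br = Bridge (K ∷ S ∷ [])

    K∈ : K ∈ K ∷ S ∷ []
    K∈ = here refl

    S∈ : S ∈ K ∷ S ∷ []
    S∈ = there (here refl)

    done : ∀ {s t ks} → Br s t → Path t ks s → Unique ks → All (_∈ R) ks → ⊥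
    done b p u a = acyc (close disjoint b p u a)

    externalR : ∀ {k s} → k ∈ R → Ent k s → ¬ Internal s
    externalR m = external (there (there m))

    ι-ι : ∀ {s} → ι s → ¬ α s × ¬ θ s × s ≢ δ
    ι-ι i = (λ x → external (here refl) (Pass.enter (α-pass x)) (proj₁ (ι-internal i)))
          , (λ x → external (there (here refl)) (θ-port x) (proj₁ (ι-internal i)))
          , λ { refl → external (there (here refl)) δ-port (proj₁ (ι-internal i)) }

    stuck-start : ∀ {s t ks} → ι s ⊎ ι (rev s) → Path s ks t → All (_∈ R) ks → s ≡ t
    stuck-start i [] a = refl
    stuck-start (inj₁ i) (x ∷ p) (m ∷ a) = ⊥-elim (externalR m (Pass.enter x) (proj₁ (ι-internal i)))
    stuck-start {s} (inj₂ i) (x ∷ p) (m ∷ a) =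
      ⊥-elim (externalR m (Pass.enter x) (subst Internal (rev-rev s) (proj₂ (ι-internal i))))

    stuck-end : ∀ {s t ks} → ι t ⊎ ι (rev t) → Path s ks t → All (_∈ R) ks → s ≡ t
    stuck-end i [] a = refl
    stuck-end i p@(_ ∷ _) a with Path-last p
    stuck-end (inj₁ i) (_ ∷ _) a | k , m , e = ⊥-elim (externalR (All.lookup a m) e (proj₂ (ι-internal i)))
    stuck-end (inj₂ i) (_ ∷ _) a | k , m , e = ⊥-elim (externalR (All.lookup a m) e (proj₁ (ι-internal i)))

    back : ∀ {k t} → Ent k t → Ent k (rev (rev t))
    back {k} {t} = subst (Ent k) (sym (rev-rev t))

    -- In the old net an entry in `α` lies on `K`, from where `S` is reached along `β`; an entry in
    -- `θ` lies on `S` already.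
    into : ∀ {s t} → α s ⊎ θ s → Ent S (rev t) → rev t ≢ β →
           (α s → Excl S β → ¬ Excl S (rev t)) → (θ s → s ≢ rev t) → (θ s → Excl S s → ¬ Excl S (rev t)) → Br s t
    into (inj₁ x) h ne b d e = bridge₂ K∈ S∈ K≢S (α-pass x) (pass β-port h (λ eq → ne (sym eq)) (b x))
    into (inj₂ x) h ne b d e = bridge₁ S∈ (pass (θ-port x) h (d x) (e x))

    external-pass : ∀ {s t} → α s ⊎ θ s → α (rev t) ⊎ θ (rev t) → Pass S' s t → Br s t
    external-pass (inj₁ x) (inj₁ y) q = bridge₁ K∈ (αα-pass x y q)
    external-pass h (inj₂ y) q = into h (θ-port y) (θ≢β y)
      (λ x b e → Pass.switch q (α-excl x b) (θ-excl e))
      (λ _ → Pass.differ q)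
      (λ _ e f → Pass.switch q (θ-excl e) (θ-excl f))
    external-pass {s} {t} (inj₂ x) h@(inj₁ y) q =
      subst₂ Br (rev-rev s) (rev-rev t) (Bridge-rev
        (into h (back (θ-port x)) (λ eq → θ≢β x (trans (sym (rev-rev s)) eq))
          (λ y b e → Pass.switch q (θ-excl (subst (Excl S) (rev-rev s) e)) (α-excl y b))
          (λ _ eq → Pass.differ q (trans (sym (rev-rev s)) (sym eq)))
          (λ _ e f → Pass.switch q (θ-excl (subst (Excl S) (rev-rev s) f)) (θ-excl e))))

    internal-pass : ∀ {s f g} → α s ⊎ θ s → ι f → rev g ≡ δ → Pass S' s f → Br s g
    internal-pass h i eq q = into h (subst (Ent S) (sym eq) δ-port)
      (λ eq' → β≢δ (trans (sym eq') eq))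
      (λ _ b e → βδ-excl b (subst (Excl S) eq e))
      (λ x eq' → θ≢δ x (trans eq' eq))
      (λ x e f → Pass.switch q (θ-excl e) (ι-excl i (subst (Excl S) eq f)))

    S-no-loop : ∀ {s} → ι s → ¬ Ent S' s
    S-no-loop i h with S-ports' h
    ... | inj₁ x = proj₁ (ι-ι i) x
    ... | inj₂ (inj₁ x) = proj₁ (proj₂ (ι-ι i)) x
    ... | inj₂ (inj₂ x) = ι-anti i x

    K-no-loop : ∀ {s} → ι s → ¬ Ent K' (rev s)
    K-no-loop i h with K-ports' h
    ... | inj₁ x = ι-anti i x
    ... | inj₂ eq = external (there (here refl)) (subst (Ent S) (sym eq) δ-port) (proj₂ (ι-internal i))

    inR : ∀ {s t ks} → Pass S' s t → Path t ks s → Unique ks → All (_∈ R) ks → ⊥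
    inR {s} {t} x p u a with S-ports' (Pass.enter x) | S-ports' (Pass.leave x)
    ... | inj₂ (inj₂ i) | _ with stuck-end (inj₂ i) p a
    ...   | refl = S-no-loop i (Pass.leave x)
    inR {s} {t} x p u a | _ | inj₂ (inj₂ i) with stuck-start (inj₁ (subst ι (rev-rev t) i)) p a
    ...   | refl = S-no-loop (subst ι (rev-rev t) i) (Pass.enter x)
    inR x p u a | inj₁ y | inj₁ z = done (external-pass (inj₁ y) (inj₁ z) x) p u a
    inR x p u a | inj₁ y | inj₂ (inj₁ z) = done (external-pass (inj₁ y) (inj₂ z) x) p u a
    inR x p u a | inj₂ (inj₁ y) | inj₁ z = done (external-pass (inj₂ y) (inj₁ z) x) p u a
    inR x p u a | inj₂ (inj₁ y) | inj₂ (inj₁ z) = done (external-pass (inj₂ y) (inj₂ z) x) p u a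

    forwards : ∀ {s f g ks} → Pass S' s f → ι f → rev g ≡ δ → Path g ks s → Unique ks → All (_∈ R) ks → ⊥
    forwards x i eq p u a with S-ports' (Pass.enter x)
    ... | inj₁ y = done (internal-pass (inj₁ y) i eq x) p u a
    ... | inj₂ (inj₁ y) = done (internal-pass (inj₂ y) i eq x) p u a
    ... | inj₂ (inj₂ j) with stuck-end (inj₂ j) p a
    ...   | refl = proj₂ (proj₂ (ι-ι j)) eq

    viaK : ∀ {s t f g ks ks'} → Pass S' s t → Path t ks f → Pass K' f g → Path g ks' s →
           Unique ks → All (_∈ R) ks → Unique ks' → All (_∈ R) ks' → ⊥
    viaK {s} {t} {f} {g} x p y q u a v b with K-ports' (Pass.enter y) | K-ports' (Pass.leave y)
    ... | inj₂ e | inj₂ e' = Pass.differ y (trans e (sym e'))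
    ... | inj₁ i | inj₂ e with stuck-end (inj₁ i) p a
    ...   | refl = forwards x i e q v b
    viaK {s} {t} {f} {g} x p y q u a v b | inj₁ i | inj₁ j
      with stuck-end (inj₁ i) p a | stuck-start (inj₂ j) q b
    ...   | refl | refl = ι-once i j (subst (λ z → Pass S' z f) (sym (rev-rev g)) x)
                                     (subst (Pass K' f) (sym (rev-rev g)) y)
    viaK {s} {t} {f} {g} x p y q u a v b | inj₂ e | inj₁ j with stuck-start (inj₂ j) q b
    ...   | refl = forwards (Pass-rev x) j (trans (rev-rev f) e) (Path-rev p) (Unique-reverse u) (All-reverse a)

    throughS : CycleThrough S' (S' ∷ K' ∷ R) → ⊥
    throughS (through x p S∉ u a) = inR x p u (avoid K∉ a')
      where
        a' = avoid S∉ a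
        K∉ : K' ∉ _
        K∉ m with Path-split p m
        ... | split {before = bs} {after = as} refl p₁ y p₂ with Unique-++⁻ bs u | Allₚ.++⁻ bs a'
        ...   | u₁ , k∉ ∷ u₂ , dis | a₁ , _ ∷ a₂ =
          viaK x p₁ y p₂ u₁ (avoid (λ m → dis m (here refl)) a₁) u₂ (avoid (All≢⇒∉ k∉) a₂)

    throughK : CycleThrough K' (K' ∷ R) → ⊥
    throughK (through {f} {g} y p K∉ u a) with K-ports' (Pass.enter y) | K-ports' (Pass.leave y)
    ... | inj₂ e | inj₂ e' = Pass.differ y (trans e (sym e'))
    ... | inj₁ i | _ with stuck-end (inj₁ i) p (avoid K∉ a)
    ...   | refl = K-no-loop i (Pass.leave y)
    throughK (through {f} {g} y p K∉ u a) | _ | inj₁ j with stuck-start (inj₂ j) p (avoid K∉ a)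
    ...   | refl = K-no-loop j (back (Pass.enter y))

-- A cycle through one new cut is closed in the old net by par, cut and tensor in a row, using a
-- single premiss of the par. When both new cuts lie on the cycle, the segment from `a` to the
-- second cut suffices.
acyclic-tens-par : ∀ {a b c a' b' c' R} →
  Disjoint (tensL a b c ∷ parL a' b' c' ∷ cutL c c' ∷ []) R → a ≢ b → c ≢ c' →
  ¬ Cycle (tensL a b c ∷ parL a' b' c' ∷ cutL c c' ∷ R) → ¬ Cycle (cutL a a' ∷ cutL b b' ∷ R)
acyclic-tens-par {a} {b} {c} {a'} {b'} {c'} {R} dis a≢b c≢c' acyc cy = Cycle-avoid cy through₁
  (λ cy' → Cycle-avoid cy' through₂ (λ cy'' → acyc (Cycle-mono (λ m → there (there (there m))) cy'')))
  where
    Tᴸ = tensL a b c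
    Pᴸ = parL a' b' c'
    Br = Bridge (Tᴸ ∷ Pᴸ ∷ cutL c c' ∷ [])

    done : ∀ {s t ks} → Br s t → Path t ks s → Unique ks → All (_∈ R) ks → ⊥
    done b p u a = acyc (close dis b p u a)

    across : ∀ {x y} → x ∈ a' ∷ b' ∷ [] → y ∈ a ∷ b ∷ [] → Br (dn x) (up y)
    across x∈ y∈ = bridge-∷ {k = Pᴸ} (pass {t = dn c'} x∈ (here refl) (λ ()) (λ _ ()))
      (bridge₂ (there (there (here refl))) (here refl) (λ ())
        (pass {t = up c} (there (here refl)) (here refl) (λ { refl → c≢c' refl }) (λ ()))
        (pass (here refl) y∈ (λ ()) (λ ())))
      (λ { (here ()) ; (there (here ())) }) (there (here refl))

    within : ∀ {x y} → x ∈ a ∷ b ∷ [] → y ∈ a ∷ b ∷ [] → x ≢ y → Br (dn x) (up y)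
    within x∈ y∈ ne = bridge₁ (here refl) (pass x∈ y∈ (λ { refl → ne refl }) (λ ()))

    fromA : ∀ {ks} → Path (up a) ks (dn a') → Unique ks → All (_∈ cutL b b' ∷ R) ks → ⊥
    fromA {ks} p u al = done (across (here refl) (here refl)) p u (avoid b∉ al)
      where
        b∉ : cutL b b' ∉ ks
        b∉ m with Path-split p m
        ... | split {before = bs} {after = as} refl p₁ y p₂ with Unique-++⁻ bs u | Allₚ.++⁻ bs al
        -- A segment from `a` that arrives at `b` is closed by the tensor alone, both of whose
        -- premisses may be used; one that arrives at `b'` is closed across the old cut.
        b∉ m | split {from = dn _} refl p₁ (pass (here refl) _ _ _) p₂ | u₁ , _ , d | a₁ , _ =
          done (within (there (here refl)) (here refl) (λ eq → a≢b (sym eq))) p₁ u₁ (avoid (λ m → d m (here refl)) a₁)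
        b∉ m | split {from = dn _} refl p₁ (pass (there (here refl)) _ _ _) p₂ | u₁ , _ , d | a₁ , _ =
          done (across (there (here refl)) (here refl)) p₁ u₁ (avoid (λ m → d m (here refl)) a₁)

    through₁ : CycleThrough (cutL a a') (cutL a a' ∷ cutL b b' ∷ R) → ⊥
    through₁ (through {dn _} {up _} (pass (here refl) (here refl) d _) p k∉ u al) = d refl
    through₁ (through {dn _} {up _} (pass (here refl) (there (here refl)) d _) p k∉ u al) =
      fromA (Path-rev p) (Unique-reverse u) (All-reverse (avoid k∉ al))
    through₁ (through {dn _} {up _} (pass (there (here refl)) (here refl) d _) p k∉ u al) = fromA p u (avoid k∉ al)
    through₁ (through {dn _} {up _} (pass (there (here refl)) (there (here refl)) d _) p k∉ u al) = d refl

    through₂ : CycleThrough (cutL b b') (cutL b b' ∷ R) → ⊥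
    through₂ (through {dn _} {up _} (pass (here refl) (here refl) d _) p k∉ u al) = d refl
    through₂ (through {dn _} {up _} (pass (here refl) (there (here refl)) d _) p k∉ u al) =
      done (across (there (here refl)) (there (here refl))) (Path-rev p) (Unique-reverse u) (All-reverse (avoid k∉ al))
    through₂ (through {dn _} {up _} (pass (there (here refl)) (here refl) d _) p k∉ u al) =
      done (across (there (here refl)) (there (here refl))) p u (avoid k∉ al)
    through₂ (through {dn _} {up _} (pass (there (here refl)) (there (here refl)) d _) p k∉ u al) = d refl

-- Cycles and the opening of a box

first-in : ∀ {C R : List Link} {ks} → All (_∈ C ++ R) ks →
           All (_∈ C) ks ⊎ (∃ λ bs → ∃ λ k → ∃ λ as → ks ≡ bs ++ k ∷ as × All (_∈ C) bs × k ∈ R)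
first-in [] = inj₁ []
first-in {C} (m ∷ a) with ∈-++⁻ C m
... | inj₂ r = inj₂ ([] , _ , _ , refl , [] , r)
... | inj₁ c with first-in {C} a
...   | inj₁ cs = inj₁ (c ∷ cs)
...   | inj₂ (bs , k , as , refl , bs∈ , r) = inj₂ (_ ∷ bs , k , as , refl , c ∷ bs∈ , r)

-- A cycle meeting both the opened box content C and the rest R contains a
-- segment of R between two distinct conclusions of the box: the box closes it.
acyclic-open : ∀ {l Γ C R} → botL l Γ C ∉ R →
  (∀ {k k' e} → k ∈ C → k' ∈ R → e ∈ concl0 k → e ∈ prem0 k' → e ∈ Γ) →
  (∀ {k k' e} → k ∈ C → k' ∈ R → e ∈ prem0 k → e ∉ concl0 k') →
  (∀ {k k' e} → k ∈ R → k' ∈ R → e ∈ prem0 k → e ∈ prem0 k' → k ≡ k') →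
  ¬ Cycle C → ¬ Cycle (botL l Γ C ∷ R) → ¬ Cycle (C ++ R)
acyclic-open {l} {Γ} {C} {R} box∉ crossΓ cross∅ consumer acycC acyc (cycle p u a) =
  mixed (first-in {R} {C} (All.map (Permₚ.∈-resp-↭ (Permₚ.++-comm C R)) a))
  where
    close-box : ∀ {e e' k ks} → e ∈ Γ → e' ∈ Γ → Path (dn e) (k ∷ ks) (up e') → Unique (k ∷ ks) →
                All (_∈ R) (k ∷ ks) → ⊥
    close-box {e} {e'} {k} {ks} e∈ e'∈ p u a = acyc (cycle
      (pass {t = dn e} (there e'∈) (there e∈) (λ { refl → same p u a }) (λ ()) ∷ p)
      (Unique-∷ (λ m → box∉ (All.lookup a m)) u) (here refl ∷ All.map there a))
      where
        -- Passing the box needs two distinct ports. Leaving and returning along one edge would make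
        -- its only consumer both the first and the last link of a simple path, or a link entered
        -- and left by the same port.
        same : ∀ {e k ks} → Path (dn e) (k ∷ ks) (up e) → Unique (k ∷ ks) → All (_∈ R) (k ∷ ks) → ⊥
        same (x ∷ []) u a = Pass.differ x refl
        same (x ∷ q@(_ ∷ _)) (k∉ ∷ u) (m ∷ a) with Path-last q
        ... | k' , k'∈ , h = All.lookup k∉ k'∈ (consumer m (All.lookup a k'∈) (Pass.enter x) h)

    segment : ∀ {x y k ks c c'} → Path x (k ∷ ks) y → Unique (k ∷ ks) → All (_∈ R) (k ∷ ks) →
              c ∈ C → Ent c (rev x) → c' ∈ C → Ent c' y → ⊥
    segment {x} {y} p u a c∈ h c'∈ h' with Path-last p
    -- The content consumes only what it produces, so no edge leads from `R` down into it: the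
    -- segment leaves the content downwards and comes back upwards.
    segment {up e} {y} p u (m ∷ a) c∈ h c'∈ h' | _ = cross∅ c∈ m h (Path-first p)
    segment {dn e} {dn e'} p u a c∈ h c'∈ h' | k' , k'∈ , g = cross∅ c'∈ (All.lookup a k'∈) h' g
    segment {dn e} {up e'} p u a@(m ∷ _) c∈ h c'∈ h' | k' , k'∈ , g =
      close-box (crossΓ c∈ m h (Path-first p)) (crossΓ c'∈ (All.lookup a k'∈) h' g) p u a

    leaving : ∀ {s x c cs r zs} → Path s (c ∷ cs) x → All (_∈ C) (c ∷ cs) → Path x (r ∷ zs) s →
              Unique (r ∷ zs) → r ∈ R → All (_∈ C ++ R) zs → ⊥
    leaving p c∈ q u r∈ a with Path-last p | first-in {R} {C} (All.map (Permₚ.∈-resp-↭ (Permₚ.++-comm C R)) a)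
    ... | k , k∈ , h | inj₁ allR =
      segment q u (r∈ ∷ allR) (All.lookup c∈ k∈) h (All.head c∈) (Path-first p)
    ... | k , k∈ , h | inj₂ (bs , c' , as , refl , bs∈ , c'∈) with Path-++⁻ (_ ∷ bs) q | Unique-++⁻ (_ ∷ bs) u
    ...   | _ , q₁ , q₂ | u₁ , _ =
      segment q₁ u₁ (r∈ ∷ bs∈) (All.lookup c∈ k∈) h c'∈ (Path-first q₂)

    mixed : All (_∈ R) _ ⊎ (∃ λ bs → ∃ λ k → ∃ λ as → _ ≡ bs ++ k ∷ as × All (_∈ R) bs × k ∈ C) → ⊥
    mixed (inj₁ allR) = acyc (Cycle-mono there (cycle p u allR))
    -- Read from a link of `C`, the cycle either stays in `C` or has a first link in `R`; the
    -- segment sought runs from there to the next return to `C`.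
    mixed (inj₂ (bs , c , as , eq , _ , c∈C)) with rotate p u a (subst (c ∈_) (sym eq) (∈-++⁺ʳ bs (here refl)))
    ... | through x q c∉ u' a' with first-in {C} {R} a'
    ...   | inj₁ allC = acycC (cycle (x ∷ q) (Unique-∷ c∉ u') (c∈C ∷ allC))
    ...   | inj₂ (cs , r , zs , refl , cs∈ , r∈R) with Path-++⁻ cs q | Unique-++⁻ cs u' | Allₚ.++⁻ cs a'
    ...     | _ , q₁ , q₂ | _ , u₂ , _ | _ , _ ∷ a₂ = leaving (x ∷ q₁) (c∈C ∷ cs∈) q₂ u₂ r∈R a₂

-- The invariant

name : Edge → ℕ
name = proj₁

names : Link → List ℕ
names k = map name (prods k)

-- Names and consumed edges are counted at all depths, since opening a box brings its content to
-- depth 0. Acyclicity at depth 0 is stated with `Cycle`; box contents keep the given form of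
-- correctness until they are opened.
record Net (ls : List Link) : Set where
  field
    names-unique : Unique (concatMap names ls)
    cons-unique  : Unique (concatMap cons ls)
    level        : ∀ {e} → e ∈ premsL0 ls → e ∈ conclsL0 ls
    links-ok     : All LinkOK ls
    typed        : All Typed ls
    boxes        : All BoxCorrect ls
    acyclic      : ¬ Cycle ls
    closed       : Closed ls
open Net

prem0⊆cons : ∀ k {e} → e ∈ prem0 k → e ∈ cons k
prem0⊆cons (cutL a b) m = m
prem0⊆cons (tensL a b c) m = m
prem0⊆cons (parL a b c) m = m
prem0⊆cons (syncL ps) m = m

mutual
  concl0⊆prods : ∀ k {e} → LinkOK k → e ∈ concl0 k → e ∈ prods k
  concl0⊆prods (axL a b) ok m = m
  concl0⊆prods (tensL a b c) ok m = m
  concl0⊆prods (parL a b c) ok m = m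
  concl0⊆prods (oneL a) ok m = m
  concl0⊆prods (syncL ps) ok m = m
  concl0⊆prods (botL l Γ C) ok (here eq) = here eq
  concl0⊆prods (botL l Γ C) ((_ , okC) , _ , Γ⊆ , _) (there m) =
    there (conclsL0⊆prodsL C okC (proj₁ (Γ⊆ _ m)))

  conclsL0⊆prodsL : ∀ ls {e} → AllLinkOK ls → e ∈ conclsL0 ls → e ∈ prodsL ls
  conclsL0⊆prodsL (k ∷ ks) (ok , oks) m with ∈-++⁻ (concl0 k) m
  ... | inj₁ p = ∈-++⁺ˡ (concl0⊆prods k ok p)
  ... | inj₂ p = ∈-++⁺ʳ (prods k) (conclsL0⊆prodsL ks oks p)

prodsL≡ : ∀ ls → prodsL ls ≡ concatMap prods ls
prodsL≡ [] = refl
prodsL≡ (k ∷ ks) = cong (prods k ++_) (prodsL≡ ks)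

consL≡ : ∀ ls → consL ls ≡ concatMap cons ls
consL≡ [] = refl
consL≡ (k ∷ ks) = cong (cons k ++_) (consL≡ ks)

map-name-prodsL : ∀ ls → map name (prodsL ls) ≡ concatMap names ls
map-name-prodsL ls = trans (cong (map name) (prodsL≡ ls)) (Listₚ.map-concatMap name prods ls)

names⁺ : ∀ k {e} → LinkOK k → e ∈ concl0 k → name e ∈ names k
names⁺ k ok m = ∈-map⁺ name (concl0⊆prods k ok m)

linear-net : ∀ {ls} → Unique (concatMap names ls) → Unique (concatMap cons ls) → All LinkOK ls → Linear ls
linear-net {ls} u v oks = linear
  (λ i j p q → owner-unique names ls u i j (names⁺ (lookup ls i) (All.lookup oks (∈-lookup i)) p)
                                            (names⁺ (lookup ls j) (All.lookup oks (∈-lookup j)) q))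
  (λ i j p q → owner-unique cons ls v i j (prem0⊆cons (lookup ls i) p) (prem0⊆cons (lookup ls j) q))

module _ {ls : List Link} (N : Net ls) where

  ok-of : ∀ {k} → k ∈ ls → LinkOK k
  ok-of = All.lookup (links-ok N)

  ty-of : ∀ {k} → k ∈ ls → Typed k
  ty-of = All.lookup (typed N)

  producer-unique : ∀ {k k' e} → k ∈ ls → k' ∈ ls → e ∈ concl0 k → e ∈ concl0 k' → k ≡ k'
  producer-unique {k} {k'} m m' p q =
    owner-unique∈ names ls (names-unique N) m m' (names⁺ k (ok-of m) p) (names⁺ k' (ok-of m') q)

  consumer-unique : ∀ {k k' e} → k ∈ ls → k' ∈ ls → e ∈ prem0 k → e ∈ prem0 k' → k ≡ k'
  consumer-unique {k} {k'} m m' p q =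
    owner-unique∈ cons ls (cons-unique N) m m' (prem0⊆cons k p) (prem0⊆cons k' q)

  -- Renaming compares names only. A name is produced once in the whole net, so it determines the
  -- edge together with its type.
  same-name : ∀ {k k' e e'} → k ∈ ls → k' ∈ ls → e ∈ concl0 k → e' ∈ concl0 k' → name e ≡ name e' → e ≡ e'
  same-name {k} {k'} m m' p q =
    Unique-map-injective name (subst Unique (sym (Listₚ.map-concatMap name prods ls)) (names-unique N))
      (∈-concatMap⁺ prods m (concl0⊆prods k (ok-of m) p)) (∈-concatMap⁺ prods m' (concl0⊆prods k' (ok-of m') q))

  producer : ∀ {k e} → k ∈ ls → e ∈ prem0 k → ∃ λ k' → k' ∈ ls × e ∈ concl0 k'
  producer m p = ∈-concatMap⁻ concl0 ls (level N (∈-concatMap⁺ prem0 m p))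

Net-↭ : ∀ {ls ls'} → ls ↭ ls' → Net ls → Net ls'
Net-↭ p N = record
  { names-unique = Unique-resp-↭ (concatMap-↭ names p) (names-unique N)
  ; cons-unique = Unique-resp-↭ (concatMap-↭ cons p) (cons-unique N)
  ; level = λ m → Permₚ.∈-resp-↭ (concatMap-↭ concl0 p)
                    (level N (Permₚ.∈-resp-↭ (concatMap-↭ prem0 (↭-sym p)) m))
  ; links-ok = Permₚ.All-resp-↭ p (links-ok N)
  ; typed = Permₚ.All-resp-↭ p (typed N)
  ; boxes = Permₚ.All-resp-↭ p (boxes N)
  ; acyclic = λ c → acyclic N (Cycle-mono (Permₚ.∈-resp-↭ (↭-sym p)) c)
  ; closed = λ e (m , n) → closed N e ( Permₚ.∈-resp-↭ (concatMap-↭ concl0 (↭-sym p)) m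
                                      , λ q → n (Permₚ.∈-resp-↭ (concatMap-↭ prem0 p) q)) }

-- Replacing some links of a net by others

module _ {A R : List Link} (N : Net (A ++ R)) where

  private
    split-unique : ∀ {B : Set} (f : Link → List B) → Unique (concatMap f (A ++ R)) →
                   Unique (concatMap f A) × Unique (concatMap f R) × (∀ {x} → x ∈ concatMap f A → x ∉ concatMap f R)
    split-unique f u = Unique-++⁻ (concatMap f A) (subst Unique (Listₚ.concatMap-++ f A R) u)

  names-split = split-unique names (names-unique N)
  cons-split = split-unique cons (cons-unique N)

  concl-disjoint : ∀ {e} → e ∈ conclsL0 A → e ∉ conclsL0 R
  concl-disjoint p q with ∈-concatMap⁻ concl0 A p | ∈-concatMap⁻ concl0 R q
  ... | k , m , p' | k' , m' , q' = proj₂ (proj₂ names-split)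
    (∈-concatMap⁺ names m (names⁺ k (ok-of N (∈-++⁺ˡ m)) p'))
    (∈-concatMap⁺ names m' (names⁺ k' (ok-of N (∈-++⁺ʳ A m')) q'))

  prem-disjoint : ∀ {e} → e ∈ premsL0 A → e ∉ premsL0 R
  prem-disjoint p q with ∈-concatMap⁻ prem0 A p | ∈-concatMap⁻ prem0 R q
  ... | k , m , p' | k' , m' , q' = proj₂ (proj₂ cons-split)
    (∈-concatMap⁺ cons m (prem0⊆cons k p')) (∈-concatMap⁺ cons m' (prem0⊆cons k' q'))

  -- Every typed link produces a name or consumes an edge, and neither can occur twice. For sync
  -- links this rests on the arity being at least 1.
  links-disjoint : Disjoint A R
  links-disjoint {k} m n with has-port k (ty-of N (∈-++⁺ˡ m))
    where
      has-port : ∀ k → Typed k → (∃ λ x → x ∈ names k) ⊎ (∃ λ e → e ∈ cons k)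
      has-port (axL a b) t = inj₁ (_ , here refl)
      has-port (cutL a b) t = inj₂ (_ , here refl)
      has-port (tensL a b c) t = inj₁ (_ , here refl)
      has-port (parL a b c) t = inj₁ (_ , here refl)
      has-port (oneL a) t = inj₁ (_ , here refl)
      has-port (botL l Γ C) t = inj₁ (_ , here refl)
      has-port (syncL (q ∷ qs)) t = inj₁ (_ , here refl)
  ... | inj₁ (_ , p) = proj₂ (proj₂ names-split) (∈-concatMap⁺ names m p) (∈-concatMap⁺ names n p)
  ... | inj₂ (_ , p) = proj₂ (proj₂ cons-split) (∈-concatMap⁺ cons m p) (∈-concatMap⁺ cons n p)

-- Conditions on the names n, all consumed edges c, conclusions k and premisses p
-- of links A, A' and R under which A may be replaced by A' next to R.
record Ports (nA nA' nR : List ℕ) (cA cA' cR kA kA' pA pA' : List Edge) : Set where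
  field
    new-names-unique : Unique nA'
    new-names        : ∀ {x} → x ∈ nA' → x ∈ nA ⊎ x ∉ nR
    new-cons-unique  : Unique cA'
    new-cons         : ∀ {e} → e ∈ cA' → e ∈ cA ⊎ e ∉ cR
    concl-kept       : ∀ {e} → e ∈ kA → e ∈ kA' ⊎ e ∈ pA
    prem-new         : ∀ {e} → e ∈ pA' → e ∈ kA' ⊎ (e ∈ pA × (e ∈ kA → e ∈ kA'))
    concl-new        : ∀ {e} → e ∈ kA' → e ∉ pA' → e ∈ kA
    prem-kept        : ∀ {e} → e ∈ pA → e ∈ pA' ⊎ (e ∈ kA × e ∉ kA')

record Replace (A A' R : List Link) : Set where
  field
    ports : Ports (concatMap names A) (concatMap names A') (concatMap names R)
                  (concatMap cons A) (concatMap cons A') (concatMap cons R)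
                  (conclsL0 A) (conclsL0 A') (premsL0 A) (premsL0 A')
    new-links-ok     : All LinkOK A'
    new-typed        : All Typed A'
    new-boxes        : All BoxCorrect A'
    new-acyclic      : ¬ Cycle (A' ++ R)

-- By linearity an edge consumed in `R` is not consumed in `A`, and one produced in `R` is not
-- produced in `A`. So the alternatives of `concl-kept` and `prem-kept` that let an edge disappear
-- never affect an edge shared with `R`.
replace : ∀ {A A' R} → Net (A ++ R) → Replace A A' R → Net (A' ++ R)
replace {A} {A'} {R} N r = record
  { names-unique = join names (proj₁ (proj₂ (names-split {A} N))) new-names-unique
      (λ m n → case-⊎ (λ p → proj₂ (proj₂ (names-split {A} N)) p n) (λ p → p n) (new-names m))
  ; cons-unique = join cons (proj₁ (proj₂ (cons-split {A} N))) new-cons-unique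
      (λ m n → case-⊎ (λ p → proj₂ (proj₂ (cons-split {A} N)) p n) (λ p → p n) (new-cons m))
  ; level = λ m → new-level (to prem0 A' m)
  ; links-ok = Allₚ.++⁺ new-links-ok (Allₚ.++⁻ʳ A (links-ok N))
  ; typed = Allₚ.++⁺ new-typed (Allₚ.++⁻ʳ A (typed N))
  ; boxes = Allₚ.++⁺ new-boxes (Allₚ.++⁻ʳ A (boxes N))
  ; acyclic = new-acyclic
  ; closed = λ e (m , n) → new-closed e (to concl0 A' m) (λ p → n (inL prem0 A' p)) (λ p → n (inR prem0 A' p)) }
  where
    open Replace r
    open Ports ports

    case-⊎ : ∀ {X Y Z : Set} → (X → Z) → (Y → Z) → X ⊎ Y → Z
    case-⊎ f g (inj₁ x) = f x
    case-⊎ f g (inj₂ y) = g y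

    join : ∀ {B : Set} (f : Link → List B) → Unique (concatMap f R) → Unique (concatMap f A') →
           (∀ {x} → x ∈ concatMap f A' → x ∉ concatMap f R) → Unique (concatMap f (A' ++ R))
    join f u v d = subst Unique (sym (Listₚ.concatMap-++ f A' R)) (Unique-++⁺ v u d)

    to : ∀ {B : Set} (f : Link → List B) L {e} → e ∈ concatMap f (L ++ R) → e ∈ concatMap f L ⊎ e ∈ concatMap f R
    to f L {e} m = ∈-++⁻ (concatMap f L) (subst (e ∈_) (Listₚ.concatMap-++ f L R) m)

    inL : ∀ {B : Set} (f : Link → List B) L {e} → e ∈ concatMap f L → e ∈ concatMap f (L ++ R)
    inL f L {e} m = subst (e ∈_) (sym (Listₚ.concatMap-++ f L R)) (∈-++⁺ˡ m)

    inR : ∀ {B : Set} (f : Link → List B) L {e} → e ∈ concatMap f R → e ∈ concatMap f (L ++ R)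
    inR f L {e} m = subst (e ∈_) (sym (Listₚ.concatMap-++ f L R)) (∈-++⁺ʳ (concatMap f L) m)

    new-level : ∀ {e} → e ∈ premsL0 A' ⊎ e ∈ premsL0 R → e ∈ conclsL0 (A' ++ R)
    new-level (inj₁ m) with prem-new m
    ... | inj₁ p = inL concl0 A' p
    ... | inj₂ (p , f) with to concl0 A (level N (inL prem0 A p))
    ...   | inj₁ q = inL concl0 A' (f q)
    ...   | inj₂ q = inR concl0 A' q
    new-level (inj₂ m) with to concl0 A (level N (inR prem0 A m))
    ... | inj₂ q = inR concl0 A' q
    ... | inj₁ q with concl-kept q
    ...   | inj₁ p = inL concl0 A' p
    ...   | inj₂ p = ⊥-elim (prem-disjoint {A} N p m)

    new-closed : ∀ e → e ∈ conclsL0 A' ⊎ e ∈ conclsL0 R → e ∉ premsL0 A' → e ∉ premsL0 R → ⊥Free (ty e)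
    new-closed e (inj₁ m) n₁ n₂ = closed N e (inL concl0 A (concl-new m n₁) , λ p → old (to prem0 A p))
      where
        old : e ∈ premsL0 A ⊎ e ∈ premsL0 R → ⊥
        old (inj₂ p) = n₂ p
        old (inj₁ p) with prem-kept p
        ... | inj₁ q = n₁ q
        ... | inj₂ (_ , q) = q m
    new-closed e (inj₂ m) n₁ n₂ = closed N e (inR concl0 A m , λ p → old (to prem0 A p))
      where
        old : e ∈ premsL0 A ⊎ e ∈ premsL0 R → ⊥
        old (inj₂ p) = n₂ p
        old (inj₁ p) with prem-kept p
        ... | inj₁ q = n₁ q
        ... | inj₂ (q , _) = concl-disjoint {A} N q m

-- The rules leave open the orientation of axioms and cuts and the order of the pairs of a sync
-- link; this brings each redex into one fixed shape.
reorder : ∀ {k k' R} → names k ↭ names k' → cons k ↭ cons k' → concl0 k ↭ concl0 k' → prem0 k ↭ prem0 k' →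
          LinkOK k' → Typed k' → BoxCorrect k' → (∀ {s} → Excl k s → Excl k' s) →
          Net (k ∷ R) → Net (k' ∷ R)
reorder {k} {k'} {R} pn pc pk pp ok t bc ex N = replace {A = k ∷ []} N record
  { ports = record
      { new-names-unique = Unique-resp-↭ (sg pn) (proj₁ (names-split {k ∷ []} N))
      ; new-names = λ m → inj₁ (back pn m)
      ; new-cons-unique = Unique-resp-↭ (sg pc) (proj₁ (cons-split {k ∷ []} N))
      ; new-cons = λ m → inj₁ (back pc m)
      ; concl-kept = λ m → inj₁ (forth pk m)
      ; prem-new = λ m → inj₂ (back pp m , forth pk)
      ; concl-new = λ m _ → back pk m
      ; prem-kept = λ m → inj₁ (forth pp m)
      }
  ; new-links-ok = ok ∷ [] ; new-typed = t ∷ [] ; new-boxes = bc ∷ []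
  ; new-acyclic = acyclic-one-node k' (links-disjoint {k ∷ []} N)
      (λ x → bridge₁ (here refl) (pass (ent (Pass.enter x)) (ent (Pass.leave x)) (Pass.differ x)
                                    (λ p q → Pass.switch x (ex p) (ex q))))
      (acyclic N) }
  where
    sg : ∀ {B : Set} {xs ys : List B} → xs ↭ ys → xs ++ [] ↭ ys ++ []
    sg p = Permₚ.++⁺ʳ [] p

    forth : ∀ {B : Set} {xs ys : List B} → xs ↭ ys → ∀ {x} → x ∈ xs ++ [] → x ∈ ys ++ []
    forth p = Permₚ.∈-resp-↭ (sg p)

    back : ∀ {B : Set} {xs ys : List B} → xs ↭ ys → ∀ {x} → x ∈ ys ++ [] → x ∈ xs ++ []
    back p = Permₚ.∈-resp-↭ (↭-sym (sg p))

    ent : ∀ {s} → Ent k' s → Ent k s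
    ent {dn e} = Permₚ.∈-resp-↭ (↭-sym pp)
    ent {up e} = Permₚ.∈-resp-↭ (↭-sym pk)

ᗮ-involutive : ∀ A → (A ᗮ) ᗮ ≡ A
ᗮ-involutive 𝟏 = refl
ᗮ-involutive ⊥ᶠ = refl
ᗮ-involutive (at x) = refl
ᗮ-involutive (coat x) = refl
ᗮ-involutive (A ⊗ B) = cong₂ _⊗_ (ᗮ-involutive A) (ᗮ-involutive B)
ᗮ-involutive (A ⅋ B) = cong₂ _⅋_ (ᗮ-involutive A) (ᗮ-involutive B)

dual-sym : ∀ {A B} → B ≡ A ᗮ → A ≡ B ᗮ
dual-sym {A} refl = sym (ᗮ-involutive A)

orient-ax : ∀ {a b k R} → AxOf a b k → Net (k ∷ R) → Net (axL a b ∷ R)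
orient-ax (inj₁ refl) N = N
orient-ax {a} {b} (inj₂ refl) N =
  reorder (swap _ _ ↭-refl) ↭-refl (swap _ _ ↭-refl) ↭-refl tt (dual-sym (All.head (typed N))) tt (λ ()) N

orient-cut : ∀ {a b k R} → CutOf a b k → Net (k ∷ R) → Net (cutL a b ∷ R)
orient-cut (inj₁ refl) N = N
orient-cut (inj₂ refl) N =
  reorder ↭-refl (swap _ _ ↭-refl) ↭-refl (swap _ _ ↭-refl) tt (dual-sym (All.head (typed N))) tt (λ ()) N

Typed-sync : ∀ {ps qs q} → ps ↭ q ∷ qs → Typed (syncL ps) → All SyncPairOK (q ∷ qs)
Typed-sync {[]} p t with Permₚ.∈-resp-↭ (↭-sym p) (here refl)
... | ()
Typed-sync {_ ∷ _} p t = Permₚ.All-resp-↭ p t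

reorder-sync : ∀ {ps qs q R} → ps ↭ q ∷ qs → Net (syncL ps ∷ R) → Net (syncL (q ∷ qs) ∷ R)
reorder-sync {ps} p N = reorder (Permₚ.map⁺ name (Permₚ.map⁺ proj₂ p)) (Permₚ.map⁺ proj₁ p)
  (Permₚ.map⁺ proj₂ p) (Permₚ.map⁺ proj₁ p) tt (Typed-sync p (All.head (typed N))) tt
  (λ { {dn _} x → x ; {up _} x → x }) N

-- Preservation of the invariant

⅋-injective : ∀ {A B A' B'} → A ⅋ B ≡ A' ⅋ B' → A ≡ A' × B ≡ B'
⅋-injective refl = refl , refl

preserve-tens-par : ∀ {a b c a' b' c' R} → Net (tensL a b c ∷ parL a' b' c' ∷ cutL c c' ∷ R) →
                    Net (cutL a a' ∷ cutL b b' ∷ R)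
preserve-tens-par {a} {b} {c} {a'} {b'} {c'} {R} N
  with typed N | proj₁ (names-split {A₀} N) | proj₁ (cons-split {A₀} N)
  where A₀ = tensL a b c ∷ parL a' b' c' ∷ cutL c c' ∷ []
... | tT ∷ tP ∷ tC ∷ _ | (c≢c' ∷ _) ∷ _
    | (a≢b ∷ a≢a' ∷ a≢b' ∷ a≢c ∷ a≢d ∷ []) ∷ (b≢a' ∷ b≢b' ∷ b≢c ∷ b≢d ∷ [])
      ∷ (a'≢b' ∷ a'≢c ∷ a'≢d ∷ []) ∷ (b'≢c ∷ b'≢d ∷ []) ∷ _ =
  replace {A} {A'} N record
  { ports = record
      { new-names-unique = []
      ; new-names = λ ()
      ; new-cons-unique = (a≢a' ∷ a≢b ∷ a≢b' ∷ []) ∷ ((λ e → b≢a' (sym e)) ∷ a'≢b' ∷ []) ∷ (b≢b' ∷ []) ∷ [] ∷ []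
      ; new-cons = λ m → inj₁ (old-prem m)
      ; concl-kept = λ { (here refl) → inj₂ (there (there (there (there (here refl)))))
                       ; (there (here refl)) → inj₂ (there (there (there (there (there (here refl)))))) }
      ; prem-new = λ m → inj₂ (old-prem m , λ n → ⊥-elim (not-concl m n))
      ; concl-new = λ ()
      ; prem-kept = λ { (here refl) → inj₁ (here refl)
                      ; (there (here refl)) → inj₁ (there (there (here refl)))
                      ; (there (there (here refl))) → inj₁ (there (here refl))
                      ; (there (there (there (here refl)))) → inj₁ (there (there (there (here refl))))
                      ; (there (there (there (there (here refl))))) → inj₂ (here refl , λ ())
                      ; (there (there (there (there (there (here refl)))))) → inj₂ (there (here refl) , λ ()) }
      }
  ; new-links-ok = tt ∷ tt ∷ []
  ; new-typed = proj₁ types ∷ proj₂ types ∷ []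
  ; new-boxes = tt ∷ tt ∷ []
  ; new-acyclic = acyclic-tens-par (links-disjoint {A} N) a≢b (λ { refl → c≢c' refl }) (acyclic N) }
  where
    A = tensL a b c ∷ parL a' b' c' ∷ cutL c c' ∷ []
    A' = cutL a a' ∷ cutL b b' ∷ []

    types : ty a' ≡ ty a ᗮ × ty b' ≡ ty b ᗮ
    types = ⅋-injective (trans (sym tP) (trans tC (cong _ᗮ tT)))

    old-prem : ∀ {e} → e ∈ a ∷ a' ∷ b ∷ b' ∷ [] → e ∈ a ∷ b ∷ a' ∷ b' ∷ c ∷ c' ∷ []
    old-prem (here refl) = here refl
    old-prem (there (here refl)) = there (there (here refl))
    old-prem (there (there (here refl))) = there (here refl)
    old-prem (there (there (there (here refl)))) = there (there (there (here refl)))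

    not-concl : ∀ {e} → e ∈ a ∷ a' ∷ b ∷ b' ∷ [] → e ∉ c ∷ c' ∷ []
    not-concl (here refl) (here refl) = a≢c refl
    not-concl (here refl) (there (here refl)) = a≢d refl
    not-concl (there (here refl)) (here refl) = a'≢c refl
    not-concl (there (here refl)) (there (here refl)) = a'≢d refl
    not-concl (there (there (here refl))) (here refl) = b≢c refl
    not-concl (there (there (here refl))) (there (here refl)) = b≢d refl
    not-concl (there (there (there (here refl)))) (here refl) = b'≢c refl
    not-concl (there (there (there (here refl)))) (there (here refl)) = b'≢d refl

AllLinkOK⇒All : ∀ ls → AllLinkOK ls → All LinkOK ls
AllLinkOK⇒All [] _ = []
AllLinkOK⇒All (k ∷ ks) (p , ps) = p ∷ AllLinkOK⇒All ks ps

TypedL⇒All : ∀ ls → TypedL ls → All Typed ls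
TypedL⇒All [] _ = []
TypedL⇒All (k ∷ ks) (p , ps) = p ∷ TypedL⇒All ks ps

AllBoxesCorrect⇒All : ∀ ls → AllBoxesCorrect ls → All BoxCorrect ls
AllBoxesCorrect⇒All [] _ = []
AllBoxesCorrect⇒All (k ∷ ks) (p , ps) = p ∷ AllBoxesCorrect⇒All ks ps

preserve-box-open : ∀ {l Γ C x R} → Net (botL l Γ C ∷ oneL x ∷ cutL l x ∷ R) → Net (C ++ R)
preserve-box-open {l} {Γ} {C} {x} {R} N
  with links-ok N | typed N | boxes N
... | ((lvl , oks) , uΓ , Γ⊆ , ⊆Γ) ∷ _ | (_ , tC) ∷ _ | (noSC , bC) ∷ _ =
  replace {A} {C} N record
  { ports = record
      { new-names-unique = uN
      ; new-names = λ m → inj₁ (names-C m)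
      ; new-cons-unique = uC
      ; new-cons = λ m → inj₁ (cons-C m)
      ; concl-kept = λ { (here refl) → inj₂ (here refl) ; (there m) → kept (∈-++⁻ Γ m) }
      ; prem-new = λ m → inj₁ (lvl _ m)
      ; concl-new = λ m n → there (∈-++⁺ˡ (⊆Γ _ (m , n)))
      ; prem-kept = λ { (here refl) → inj₂ (here refl , λ m → All≢⇒∉ l∉ (∈-++⁺ˡ (name-C m)))
                      ; (there (here refl)) → inj₂ (there (∈-++⁺ʳ Γ (here refl)) , λ m → x∉ (name-C m) (here refl)) }
      }
  ; new-links-ok = okC
  ; new-typed = TypedL⇒All C tC
  ; new-boxes = AllBoxesCorrect⇒All C bC
  ; new-acyclic = acyclic-open (λ m → links-disjoint {A} N (here refl) m)
      (λ {k} {k'} m m' p q → ⊆Γ _ (∈-concatMap⁺ concl0 m p , λ r → cons-disj (prem-C r) (∈-concatMap⁺ cons m' (prem0⊆cons k' q))))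
      (λ {k} {k'} m m' p q → names-disj (∈-++⁺ˡ (name-C (lvl _ (∈-concatMap⁺ prem0 m p))))
         (∈-concatMap⁺ names m' (names⁺ k' (ok-of N (there (there (there m')))) q)))
      (λ m m' p q → consumer-unique N (there (there (there m))) (there (there (there m'))) p q)
      -- Correctness of the content is given for `SwitchingCycle`; the content inherits linearity
      -- from the uniqueness of names and consumers at all depths.
      (λ cy → noSC (Cycle⇒SwitchingCycle (linear-net uN uC okC) cy))
      (λ cy → acyclic N (Cycle-mono (λ { (here eq) → here eq ; (there m) → there (there (there m)) }) cy)) }
  where
    A = botL l Γ C ∷ oneL x ∷ cutL l x ∷ []
    okC = AllLinkOK⇒All C oks

    uNA : Unique (name l ∷ map name (prodsL C) ++ name x ∷ [])
    uNA = proj₁ (names-split {A} N)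

    l∉ : All (name l ≢_) (map name (prodsL C) ++ name x ∷ [])
    l∉ with uNA
    ... | p ∷ _ = p

    uRest : Unique (map name (prodsL C) ++ name x ∷ [])
    uRest with uNA
    ... | _ ∷ u = u

    x∉ : ∀ {n} → n ∈ map name (prodsL C) → n ∉ name x ∷ []
    x∉ = proj₂ (proj₂ (Unique-++⁻ (map name (prodsL C)) uRest))

    uN : Unique (concatMap names C)
    uN = subst Unique (map-name-prodsL C) (proj₁ (Unique-++⁻ (map name (prodsL C)) uRest))

    uC : Unique (concatMap cons C)
    uC = subst Unique (consL≡ C) (proj₁ (Unique-++⁻ (consL C) (proj₁ (cons-split {A} N))))

    names-C : ∀ {n} → n ∈ concatMap names C → n ∈ concatMap names A
    names-C m = there (∈-++⁺ˡ (subst (_ ∈_) (sym (map-name-prodsL C)) m))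

    cons-C : ∀ {e} → e ∈ concatMap cons C → e ∈ concatMap cons A
    cons-C m = ∈-++⁺ˡ (subst (_ ∈_) (sym (consL≡ C)) m)

    name-C : ∀ {e} → e ∈ conclsL0 C → name e ∈ map name (prodsL C)
    name-C m = ∈-map⁺ name (conclsL0⊆prodsL C oks m)

    prem-C : ∀ {e} → e ∈ premsL0 C → e ∈ consL C ++ l ∷ x ∷ []
    prem-C m with ∈-concatMap⁻ prem0 C m
    ... | k , k∈ , p = cons-C (∈-concatMap⁺ cons k∈ (prem0⊆cons k p))

    names-disj : ∀ {n} → n ∈ map name (prodsL C) ++ name x ∷ [] → n ∉ concatMap names R
    names-disj m = proj₂ (proj₂ (names-split {A} N)) (there m)

    cons-disj : ∀ {e} → e ∈ consL C ++ l ∷ x ∷ [] → e ∉ concatMap cons R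
    cons-disj = proj₂ (proj₂ (cons-split {A} N))

    kept : ∀ {e} → e ∈ Γ ⊎ e ∈ x ∷ [] → e ∈ conclsL0 C ⊎ e ∈ l ∷ x ∷ []
    kept (inj₁ m) = inj₁ (proj₁ (Γ⊆ _ m))
    kept (inj₂ (here refl)) = inj₂ (there (here refl))

-- Erasing a sync link against one links

ones : (Edge × Edge → Edge) → List (Edge × Edge) → List Link
ones g = map (λ q → oneL (g q))

names-ones : ∀ g ps → concatMap names (ones g ps) ≡ map name (map g ps)
names-ones g [] = refl
names-ones g (q ∷ ps) = cong (_ ∷_) (names-ones g ps)

cons-ones : ∀ g ps → concatMap cons (ones g ps) ≡ []
cons-ones g [] = refl
cons-ones g (q ∷ ps) = cons-ones g ps

concl-ones : ∀ g ps → conclsL0 (ones g ps) ≡ map g ps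
concl-ones g [] = refl
concl-ones g (q ∷ ps) = cong (_ ∷_) (concl-ones g ps)

prem-ones : ∀ g ps → premsL0 (ones g ps) ≡ []
prem-ones g [] = refl
prem-ones g (q ∷ ps) = prem-ones g ps

-- A link with a single port cannot be entered and left by different ports, so no cycle visits it.
one-dead : ∀ {a s t} → ¬ Pass (oneL a) s t
one-dead {s = up _} {dn _} (pass (here refl) (here refl) d _) = d refl

∈-ones⁻ : ∀ g ps {k} → k ∈ ones g ps → ∃ λ q → q ∈ ps × k ≡ oneL (g q)
∈-ones⁻ g ps = ∈-map⁻ (λ q → oneL (g q))

All-ones : ∀ {P : Link → Set} g {ps} → (∀ {q} → q ∈ ps → P (oneL (g q))) → All P (ones g ps)
All-ones g f = Allₚ.map⁺ (All.tabulate f)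

pairs-ok : ∀ {ps} → Typed (syncL ps) → All SyncPairOK ps
pairs-ok {[]} ()
pairs-ok {_ ∷ _} t = t

preserve-sync-one : ∀ {ps R} → Net (syncL ps ∷ ones proj₁ ps ++ R) → Net (ones proj₂ ps ++ R)
preserve-sync-one {ps} {R} N = replace {A} {ones proj₂ ps} N record
  { ports = record
      { new-names-unique = subst Unique (sym (names-ones proj₂ ps)) (proj₁ split-names)
      ; new-names = λ m → inj₁ (∈-++⁺ˡ (subst (_ ∈_) (names-ones proj₂ ps) m))
      ; new-cons-unique = subst Unique (sym (cons-ones proj₂ ps)) []
      ; new-cons = λ m → none (cons-ones proj₂ ps) m
      ; concl-kept = λ m → kept (∈-++⁻ (map proj₂ ps) m)
      ; prem-new = λ m → none (prem-ones proj₂ ps) m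
      ; concl-new = λ m _ → ∈-++⁺ˡ (subst (_ ∈_) (concl-ones proj₂ ps) m)
      ; prem-kept = λ m → inj₂ (internal (∈-++⁻ (map proj₁ ps) m))
      }
  ; new-links-ok = All-ones proj₂ (λ _ → tt)
  ; new-typed = All-ones proj₂ is-one
  ; new-boxes = All-ones proj₂ (λ _ → tt)
  ; new-acyclic = acyclic-dead-nodes (ones proj₂ ps) dead
      (λ cy → acyclic N (Cycle-mono (λ m → there (∈-++⁺ʳ (ones proj₁ ps) m)) cy)) }
  where
    A = syncL ps ∷ ones proj₁ ps

    split-names = Unique-++⁻ (map name (map proj₂ ps)) (proj₁ (names-split {A} N))

    none : ∀ {B X : Set} {xs : List B} {x : B} → xs ≡ [] → x ∈ xs → X
    none refl ()

    kept : ∀ {e} → e ∈ map proj₂ ps ⊎ e ∈ conclsL0 (ones proj₁ ps) → e ∈ conclsL0 (ones proj₂ ps) ⊎ e ∈ premsL0 A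
    kept (inj₁ m) = inj₁ (subst (_ ∈_) (sym (concl-ones proj₂ ps)) m)
    kept (inj₂ m) = inj₂ (∈-++⁺ˡ (subst (_ ∈_) (concl-ones proj₁ ps) m))

    internal : ∀ {e} → e ∈ map proj₁ ps ⊎ e ∈ premsL0 (ones proj₁ ps) → e ∈ conclsL0 A × e ∉ conclsL0 (ones proj₂ ps)
    internal (inj₂ m) = none (prem-ones proj₁ ps) m
    internal (inj₁ m) = ∈-++⁺ʳ (map proj₂ ps) (subst (_ ∈_) (sym (concl-ones proj₁ ps)) m)
      , λ n → proj₂ (proj₂ split-names) (∈-map⁺ name (subst (_ ∈_) (concl-ones proj₂ ps) n))
                (subst (_ ∈_) (sym (names-ones proj₁ ps)) (∈-map⁺ name m))

    is-one : ∀ {q} → q ∈ ps → ty (proj₂ q) ≡ 𝟏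
    is-one q∈ = trans (sym (proj₁ (All.lookup (pairs-ok {ps} (All.head (typed N))) q∈)))
      (ty-of N (there (∈-++⁺ˡ (∈-map⁺ (λ q → oneL (proj₁ q)) q∈))))

    dead : ∀ {k s t} → k ∈ ones proj₂ ps → ¬ Pass k s t
    dead k∈ with ∈-ones⁻ proj₂ ps k∈
    ... | _ , _ , refl = one-dead

-- Moving sync links

NotIn : List Link → ℕ → Set
NotIn ls i = (∀ {k x} → k ∈ ls → x ∈ names k → x ≢ i) × (∀ {k e} → k ∈ ls → e ∈ cons k → name e ≢ i)

Fresh⇒NotIn : ∀ {ls i} → Fresh ls i → NotIn ls i
Fresh⇒NotIn {ls} {i} fr = fresh-names , fresh-cons
  where
    fresh-names : ∀ {k x} → k ∈ ls → x ∈ names k → x ≢ i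
    fresh-names k∈ x∈ refl = fr (subst (i ∈_) (sym (Listₚ.map-++ name (prodsL ls) (consL ls)))
      (∈-++⁺ˡ (subst (i ∈_) (sym (map-name-prodsL ls)) (∈-concatMap⁺ names k∈ x∈))))

    fresh-cons : ∀ {k e} → k ∈ ls → e ∈ cons k → name e ≢ i
    fresh-cons {e = e} k∈ e∈ refl = fr (∈-map⁺ name (∈-++⁺ʳ (prodsL ls)
      (subst (e ∈_) (sym (consL≡ ls)) (∈-concatMap⁺ cons k∈ e∈))))

NotIn-mono : ∀ {ls ls' i} → (∀ {k} → k ∈ ls' → k ∈ ls) → NotIn ls i → NotIn ls' i
NotIn-mono f (p , q) = (λ m → p (f m)) , (λ m → q (f m))

NotIn-reorder : ∀ {k k' R i} → names k ↭ names k' → cons k ↭ cons k' → NotIn (k ∷ R) i → NotIn (k' ∷ R) i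
NotIn-reorder {k} {k'} {R} {i} pn pc (p , q) = p' , q'
  where
    p' : ∀ {k₁ x} → k₁ ∈ k' ∷ R → x ∈ names k₁ → x ≢ i
    p' (here refl) m = p (here refl) (Permₚ.∈-resp-↭ (↭-sym pn) m)
    p' (there n) m = p (there n) m
    q' : ∀ {k₁ e} → k₁ ∈ k' ∷ R → e ∈ cons k₁ → name e ≢ i
    q' (here refl) m = q (here refl) (Permₚ.∈-resp-↭ (↭-sym pc) m)
    q' (there n) m = q (there n) m

-- A rule states freshness for the list it is applied to. Bringing the redex into fixed shape
-- permutes links and ports, and freshness has to be carried along.
FreshNet : List ℕ → List Link → Set
FreshNet is ls = Net ls × All (NotIn ls) is

FreshNet-↭ : ∀ {is ls ls'} → ls ↭ ls' → FreshNet is ls → FreshNet is ls'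
FreshNet-↭ p (N , f) = Net-↭ p N , All.map (NotIn-mono (Permₚ.∈-resp-↭ (↭-sym p))) f

FreshNet-ax : ∀ {is a b k R} → AxOf a b k → FreshNet is (k ∷ R) → FreshNet is (axL a b ∷ R)
FreshNet-ax (inj₁ refl) (N , f) = N , f
FreshNet-ax {a = a} {b} h@(inj₂ refl) (N , f) = orient-ax h N , All.map (NotIn-reorder {axL b a} {axL a b} (swap _ _ ↭-refl) ↭-refl) f

FreshNet-cut : ∀ {is a b k R} → CutOf a b k → FreshNet is (k ∷ R) → FreshNet is (cutL a b ∷ R)
FreshNet-cut (inj₁ refl) (N , f) = N , f
FreshNet-cut {a = a} {b} h@(inj₂ refl) (N , f) = orient-cut h N , All.map (NotIn-reorder {cutL b a} {cutL a b} ↭-refl (swap _ _ ↭-refl)) f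

FreshNet-sync : ∀ {is ps q qs R} → ps ↭ q ∷ qs → FreshNet is (syncL ps ∷ R) → FreshNet is (syncL (q ∷ qs) ∷ R)
FreshNet-sync {ps = ps} {q} {qs} p (N , f) = reorder-sync p N ,
  All.map (NotIn-reorder {syncL ps} {syncL (q ∷ qs)} (Permₚ.map⁺ name (Permₚ.map⁺ proj₂ p)) (Permₚ.map⁺ proj₁ p)) f

NotIn-Ent : ∀ {ls i} → Net ls → NotIn ls i → ∀ {k s} → k ∈ ls → Ent k s → name (edge s) ≢ i
NotIn-Ent N f {k} {dn e} m h = proj₂ f m (prem0⊆cons k h)
NotIn-Ent N f {k} {up e} m h = proj₁ f m (names⁺ k (ok-of N m) h)

pos-neg : ∀ {A} → Positive A → ¬ Negative A
pos-neg pos-1 ()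
pos-neg (pos-⊗ _ _) ()

dual-pos : ∀ {A} → Positive A → Negative (A ᗮ)
dual-pos pos-1 = neg-⊥
dual-pos (pos-⊗ p q) = neg-⅋ (dual-pos p) (dual-pos q)

dual-neg : ∀ {A} → Negative A → Positive (A ᗮ)
dual-neg neg-⊥ = pos-1
dual-neg (neg-⅋ p q) = pos-⊗ (dual-neg p) (dual-neg q)

∈-snoc : ∀ {X : Set} (xs : List X) {ys x} → x ∈ xs ++ [] → x ∈ xs ++ ys
∈-snoc xs m with ∈-++⁻ xs m
... | inj₁ p = ∈-++⁺ˡ p

-- `D` and `P` are the conclusions and premisses of the remaining pairs of the sync link. The lists
-- have the shape to which `concatMap` evaluates on the two links, whence the final `++ []`.
sync-ax-ports : ∀ {a b d D P nR cR i} → let i' = (i , ty b) in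
  Unique (name a ∷ name b ∷ name d ∷ (map name D ++ [])) → Unique (a ∷ (P ++ [])) →
  i ∉ name a ∷ name b ∷ name d ∷ (map name D ++ []) → (∀ {e} → e ∈ a ∷ (P ++ []) → name e ≢ i) →
  i ∉ nR → (∀ {e} → e ∈ cR → name e ≢ i) →
  Ports (name a ∷ name b ∷ name d ∷ (map name D ++ [])) (name b ∷ (map name D ++ name d ∷ i ∷ [])) nR
        (a ∷ (P ++ [])) (i' ∷ (P ++ [])) cR
        (a ∷ b ∷ d ∷ (D ++ [])) (b ∷ (D ++ d ∷ i' ∷ [])) (a ∷ (P ++ [])) (i' ∷ (P ++ []))
sync-ax-ports {a} {b} {d} {D} {P} {nR} {cR} {i}
  ((a≢b ∷ a≢d ∷ a∉D) ∷ (b≢d ∷ b∉D) ∷ (d∉D ∷ uD)) (a∉P ∷ uP) i∉ iP iN iC = record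
  { new-names-unique = Unique-∷ b∉ (Unique-++⁺ (proj₁ (Unique-++⁻ ND uD))
      (((λ { refl → i∉ (there (there (here refl))) }) ∷ []) ∷ [] ∷ [])
      (λ { m (here refl) → All≢⇒∉ d∉D (∈-++⁺ˡ m)
         ; m (there (here refl)) → i∉ (there (there (there (∈-++⁺ˡ m)))) }))
  ; new-names = λ { (here refl) → inj₁ (there (here refl)) ; (there m) → nn (∈-++⁻ ND m) }
  ; new-cons-unique = Unique-∷ (λ m → iP (there m) refl) uP
  ; new-cons = λ { (here refl) → inj₂ (λ m → iC m refl) ; (there m) → inj₁ (there m) }
  ; concl-kept = λ { (here refl) → inj₂ (here refl)
                   ; (there (here refl)) → inj₁ (here refl)
                   ; (there (there (here refl))) → inj₁ (there (∈-++⁺ʳ D (here refl)))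
                   ; (there (there (there m))) → inj₁ (there (∈-snoc D m)) }
  ; prem-new = λ { (here refl) → inj₁ (there (∈-++⁺ʳ D (there (here refl))))
                 ; (there m) → inj₂ (there m , pn m) }
  ; concl-new = λ { (here refl) _ → there (here refl) ; (there m) n → kn (∈-++⁻ D m) n }
  ; prem-kept = λ { (here refl) → inj₂ (here refl , a∉) ; (there m) → inj₁ (there m) } }
  where
    ND = map name D
    i' = (i , ty b)

    b∉ : name b ∉ ND ++ name d ∷ i ∷ []
    b∉ m with ∈-++⁻ ND m
    ... | inj₁ p = All≢⇒∉ b∉D (∈-++⁺ˡ p)
    ... | inj₂ (here eq) = b≢d eq
    ... | inj₂ (there (here refl)) = i∉ (there (here refl))

    nn : ∀ {x} → x ∈ ND ⊎ x ∈ name d ∷ i ∷ [] → x ∈ name a ∷ name b ∷ name d ∷ (ND ++ []) ⊎ x ∉ nR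
    nn (inj₁ m) = inj₁ (there (there (there (∈-++⁺ˡ m))))
    nn (inj₂ (here refl)) = inj₁ (there (there (here refl)))
    nn (inj₂ (there (here refl))) = inj₂ iN

    pn : ∀ {e} → e ∈ P ++ [] → e ∈ a ∷ b ∷ d ∷ (D ++ []) → e ∈ b ∷ (D ++ d ∷ i' ∷ [])
    pn m (here refl) = ⊥-elim (All≢⇒∉ a∉P m)
    pn m (there (here refl)) = here refl
    pn m (there (there (here refl))) = there (∈-++⁺ʳ D (here refl))
    pn m (there (there (there n))) = there (∈-snoc D n)

    kn : ∀ {e} → e ∈ D ⊎ e ∈ d ∷ i' ∷ [] → e ∉ i' ∷ (P ++ []) → e ∈ a ∷ b ∷ d ∷ (D ++ [])
    kn (inj₁ m) n = there (there (there (∈-++⁺ˡ m)))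
    kn (inj₂ (here refl)) n = there (there (here refl))
    kn (inj₂ (there (here refl))) n = ⊥-elim (n (here refl))

    a∉ : a ∉ b ∷ (D ++ d ∷ i' ∷ [])
    a∉ (here refl) = a≢b refl
    a∉ (there m) with ∈-++⁻ D m
    ... | inj₁ p = All≢⇒∉ a∉D (∈-++⁺ˡ (∈-map⁺ name p))
    ... | inj₂ (here refl) = a≢d refl
    ... | inj₂ (there (here refl)) = i∉ (here refl)

sync-cut-ports : ∀ {p x y D P nR cR i} → let i' = (i , ty x) in
  Unique (name y ∷ (map name D ++ [])) → Unique (x ∷ y ∷ p ∷ (P ++ [])) →
  i ∉ name y ∷ (map name D ++ []) → (∀ {e} → e ∈ x ∷ y ∷ p ∷ (P ++ []) → name e ≢ i) →
  i ∉ nR → (∀ {e} → e ∈ cR → name e ≢ i) →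
  Ports (name y ∷ (map name D ++ [])) (i ∷ (map name D ++ [])) nR
        (x ∷ y ∷ p ∷ (P ++ [])) (x ∷ (P ++ i' ∷ p ∷ [])) cR
        (y ∷ (D ++ [])) (i' ∷ (D ++ [])) (x ∷ y ∷ p ∷ (P ++ [])) (x ∷ (P ++ i' ∷ p ∷ []))
sync-cut-ports {p} {x} {y} {D} {P} {nR} {cR} {i}
  (y∉D ∷ uD) ((x≢y ∷ x≢p ∷ x∉P) ∷ (y≢p ∷ y∉P) ∷ (p∉P ∷ uP)) i∉ iP iN iC = record
  { new-names-unique = Unique-∷ (λ m → i∉ (there m)) uD
  ; new-names = λ { (here refl) → inj₂ iN ; (there m) → inj₁ (there m) }
  ; new-cons-unique = Unique-∷ x∉ (Unique-++⁺ (proj₁ (Unique-++⁻ P uP))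
      (((λ eq → iP (there (there (here refl))) (cong name (sym eq))) ∷ []) ∷ [] ∷ [])
      (λ { m (here refl) → iP (there (there (there (∈-++⁺ˡ m)))) refl
         ; m (there (here refl)) → All≢⇒∉ p∉P (∈-++⁺ˡ m) }))
  ; new-cons = λ { (here refl) → inj₁ (here refl) ; (there m) → nc (∈-++⁻ P m) }
  ; concl-kept = λ { (here refl) → inj₂ (there (here refl)) ; (there m) → inj₁ (there m) }
  ; prem-new = λ { (here refl) → inj₂ (here refl , λ { (here refl) → ⊥-elim (x≢y refl) ; (there m) → there m })
                 ; (there m) → pn (∈-++⁻ P m) }
  ; concl-new = λ { (here refl) n → ⊥-elim (n (there (∈-++⁺ʳ P (here refl)))) ; (there m) _ → there m }
  ; prem-kept = λ { (here refl) → inj₁ (here refl)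
                  ; (there (here refl)) → inj₂ (here refl , y∉)
                  ; (there (there (here refl))) → inj₁ (there (∈-++⁺ʳ P (there (here refl))))
                  ; (there (there (there m))) → inj₁ (there (∈-snoc P m)) } }
  where
    i' = (i , ty x)

    x∉ : x ∉ P ++ i' ∷ p ∷ []
    x∉ m with ∈-++⁻ P m
    ... | inj₁ q = All≢⇒∉ x∉P (∈-++⁺ˡ q)
    ... | inj₂ (here eq) = iP (here refl) (cong name eq)
    ... | inj₂ (there (here eq)) = x≢p eq

    nc : ∀ {e} → e ∈ P ⊎ e ∈ i' ∷ p ∷ [] → e ∈ x ∷ y ∷ p ∷ (P ++ []) ⊎ e ∉ cR
    nc (inj₁ m) = inj₁ (there (there (there (∈-++⁺ˡ m))))
    nc (inj₂ (here refl)) = inj₂ (λ m → iC m refl)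
    nc (inj₂ (there (here refl))) = inj₁ (there (there (here refl)))

    pn : ∀ {e} → e ∈ P ⊎ e ∈ i' ∷ p ∷ [] →
         e ∈ i' ∷ (D ++ []) ⊎ (e ∈ x ∷ y ∷ p ∷ (P ++ []) × (e ∈ y ∷ (D ++ []) → e ∈ i' ∷ (D ++ [])))
    pn (inj₁ m) = inj₂ (there (there (there (∈-++⁺ˡ m))) ,
      λ { (here refl) → ⊥-elim (All≢⇒∉ y∉P (∈-++⁺ˡ m)) ; (there n) → there n })
    pn (inj₂ (here refl)) = inj₁ (here refl)
    pn (inj₂ (there (here refl))) = inj₂ (there (there (here refl)) ,
      λ { (here refl) → ⊥-elim (y≢p refl) ; (there n) → there n })

    y∉ : y ∉ i' ∷ (D ++ [])
    y∉ (here eq) = i∉ (here (cong name (sym eq)))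
    y∉ (there m) with ∈-++⁻ D m
    ... | inj₁ q = All≢⇒∉ y∉D (∈-++⁺ˡ (∈-map⁺ name q))

-- The connective is not mentioned, so that the same conditions serve the tensor and the par.
sync-push-ports : ∀ {a b c d D P nR cR i j} → let i' = (i , ty a) ; j' = (j , ty b) in
  Unique (name c ∷ name d ∷ (map name D ++ [])) → Unique (a ∷ b ∷ c ∷ (P ++ [])) → i ≢ j →
  (∀ {x} → x ∈ name c ∷ name d ∷ (map name D ++ []) → x ≢ i × x ≢ j) →
  (∀ {e} → e ∈ a ∷ b ∷ c ∷ (P ++ []) → name e ≢ i × name e ≢ j) →
  i ∉ nR × j ∉ nR → (∀ {e} → e ∈ cR → name e ≢ i × name e ≢ j) →
  Ports (name c ∷ name d ∷ (map name D ++ [])) (i ∷ j ∷ (map name D ++ name d ∷ [])) nR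
        (a ∷ b ∷ c ∷ (P ++ [])) (a ∷ b ∷ (P ++ i' ∷ j' ∷ [])) cR
        (c ∷ d ∷ (D ++ [])) (i' ∷ j' ∷ (D ++ d ∷ [])) (a ∷ b ∷ c ∷ (P ++ [])) (a ∷ b ∷ (P ++ i' ∷ j' ∷ []))
sync-push-ports {a} {b} {c} {d} {D} {P} {nR} {cR} {i} {j}
  ((c≢d ∷ c∉D) ∷ (d∉D ∷ uD)) ((a≢b ∷ a≢c ∷ a∉P) ∷ (b≢c ∷ b∉P) ∷ (c∉P ∷ uP)) i≢j fN fP (iN , jN) fC = record
  { new-names-unique = ((i≢j ∷ All.tabulate (λ m eq → proj₁ (fN (oldN m)) (sym eq)))
      ∷ All.tabulate (λ m eq → proj₂ (fN (oldN m)) (sym eq))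
      ∷ Unique-++⁺ (proj₁ (Unique-++⁻ ND uD)) ([] ∷ []) (λ { m (here refl) → All≢⇒∉ d∉D (∈-++⁺ˡ m) }))
  ; new-names = λ { (here refl) → inj₂ iN ; (there (here refl)) → inj₂ jN ; (there (there m)) → inj₁ (oldN m) }
  ; new-cons-unique = (a≢b ∷ ∉⇒All≢ a∉) ∷ ∉⇒All≢ b∉ ∷ Unique-++⁺ (proj₁ (Unique-++⁻ P uP))
      (((λ eq → i≢j (cong name eq)) ∷ []) ∷ [] ∷ [])
      (λ { m (here refl) → proj₁ (fP (there (there (there (∈-++⁺ˡ m))))) refl
         ; m (there (here refl)) → proj₂ (fP (there (there (there (∈-++⁺ˡ m))))) refl })
  ; new-cons = λ { (here refl) → inj₁ (here refl) ; (there (here refl)) → inj₁ (there (here refl))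
                 ; (there (there m)) → nc (∈-++⁻ P m) }
  ; concl-kept = λ { (here refl) → inj₂ (there (there (here refl)))
                   ; (there (here refl)) → inj₁ (there (there (∈-++⁺ʳ D (here refl))))
                   ; (there (there m)) → inj₁ (there (there (∈-snoc D m))) }
  ; prem-new = λ { (here refl) → inj₂ (here refl , λ n → kept a≢c n)
                 ; (there (here refl)) → inj₂ (there (here refl) , λ n → kept b≢c n)
                 ; (there (there m)) → pn (∈-++⁻ P m) }
  ; concl-new = λ { (here refl) n → ⊥-elim (n (there (there (∈-++⁺ʳ P (here refl)))))
                  ; (there (here refl)) n → ⊥-elim (n (there (there (∈-++⁺ʳ P (there (here refl))))))
                  ; (there (there m)) _ → kn (∈-++⁻ D m) }
  ; prem-kept = λ { (here refl) → inj₁ (here refl) ; (there (here refl)) → inj₁ (there (here refl))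
                  ; (there (there (here refl))) → inj₂ (here refl , c∉)
                  ; (there (there (there m))) → inj₁ (there (there (∈-snoc P m))) } }
  where
    ND = map name D
    i' = (i , ty a)
    j' = (j , ty b)

    oldN : ∀ {x} → x ∈ ND ++ name d ∷ [] → x ∈ name c ∷ name d ∷ (ND ++ [])
    oldN m with ∈-++⁻ ND m
    ... | inj₁ p = there (there (∈-++⁺ˡ p))
    ... | inj₂ (here refl) = there (here refl)

    a∉ : a ∉ P ++ i' ∷ j' ∷ []
    a∉ m with ∈-++⁻ P m
    ... | inj₁ q = All≢⇒∉ a∉P (∈-++⁺ˡ q)
    ... | inj₂ (here eq) = proj₁ (fP (here refl)) (cong name eq)
    ... | inj₂ (there (here eq)) = proj₂ (fP (here refl)) (cong name eq)

    b∉ : b ∉ P ++ i' ∷ j' ∷ []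
    b∉ m with ∈-++⁻ P m
    ... | inj₁ q = All≢⇒∉ b∉P (∈-++⁺ˡ q)
    ... | inj₂ (here eq) = proj₁ (fP (there (here refl))) (cong name eq)
    ... | inj₂ (there (here eq)) = proj₂ (fP (there (here refl))) (cong name eq)

    nc : ∀ {e} → e ∈ P ⊎ e ∈ i' ∷ j' ∷ [] → e ∈ a ∷ b ∷ c ∷ (P ++ []) ⊎ e ∉ cR
    nc (inj₁ m) = inj₁ (there (there (there (∈-++⁺ˡ m))))
    nc (inj₂ (here refl)) = inj₂ (λ m → proj₁ (fC m) refl)
    nc (inj₂ (there (here refl))) = inj₂ (λ m → proj₂ (fC m) refl)

    kept : ∀ {e} → e ≢ c → e ∈ c ∷ d ∷ (D ++ []) → e ∈ i' ∷ j' ∷ (D ++ d ∷ [])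
    kept ne (here eq) = ⊥-elim (ne eq)
    kept ne (there (here refl)) = there (there (∈-++⁺ʳ D (here refl)))
    kept ne (there (there n)) = there (there (∈-snoc D n))

    pn : ∀ {e} → e ∈ P ⊎ e ∈ i' ∷ j' ∷ [] →
         e ∈ i' ∷ j' ∷ (D ++ d ∷ []) ⊎
         (e ∈ a ∷ b ∷ c ∷ (P ++ []) × (e ∈ c ∷ d ∷ (D ++ []) → e ∈ i' ∷ j' ∷ (D ++ d ∷ [])))
    pn (inj₁ m) = inj₂ (there (there (there (∈-++⁺ˡ m))) , kept (λ { refl → All≢⇒∉ c∉P (∈-++⁺ˡ m) }))
    pn (inj₂ (here refl)) = inj₁ (here refl)
    pn (inj₂ (there (here refl))) = inj₁ (there (here refl))

    kn : ∀ {e} → e ∈ D ⊎ e ∈ d ∷ [] → e ∈ c ∷ d ∷ (D ++ [])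
    kn (inj₁ m) = there (there (∈-++⁺ˡ m))
    kn (inj₂ (here refl)) = there (here refl)

    c∉ : c ∉ i' ∷ j' ∷ (D ++ d ∷ [])
    c∉ (here eq) = proj₁ (fN (here refl)) (cong name eq)
    c∉ (there (here eq)) = proj₂ (fN (here refl)) (cong name eq)
    c∉ (there (there m)) with ∈-++⁻ D m
    ... | inj₁ q = All≢⇒∉ c∉D (∈-++⁺ˡ (∈-map⁺ name q))
    ... | inj₂ (here refl) = c≢d refl

module _ {A R : List Link} {i : ℕ} (f : NotIn (A ++ R) i) where

  fresh-names : ∀ {x} → x ∈ concatMap names A → x ≢ i
  fresh-names m with ∈-concatMap⁻ names A m
  ... | _ , k∈ , x∈ = proj₁ f (∈-++⁺ˡ k∈) x∈

  fresh-cons : ∀ {e} → e ∈ concatMap cons A → name e ≢ i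
  fresh-cons m with ∈-concatMap⁻ cons A m
  ... | _ , k∈ , e∈ = proj₂ f (∈-++⁺ˡ k∈) e∈

  fresh-names-rest : i ∉ concatMap names R
  fresh-names-rest m with ∈-concatMap⁻ names R m
  ... | _ , k∈ , x∈ = proj₁ f (∈-++⁺ʳ A k∈) x∈ refl

  fresh-cons-rest : ∀ {e} → e ∈ concatMap cons R → name e ≢ i
  fresh-cons-rest m with ∈-concatMap⁻ cons R m
  ... | _ , k∈ , e∈ = proj₂ f (∈-++⁺ʳ A k∈) e∈

sync-excl : ∀ {ps qs s} → Excl (syncL ps) s → Excl (syncL qs) s
sync-excl {s = dn _} x = x
sync-excl {s = up _} x = x

sync-weaken : ∀ {q qs s} → Ent (syncL qs) s → Ent (syncL (q ∷ qs)) s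
sync-weaken {s = dn _} = there
sync-weaken {s = up _} = there

-- The positive pair `(a , d)` becomes the negative pair `(i' , b)`: the out-edge `d` is replaced by
-- the out-edge `i'`, and the in-edge `a` by the in-edge `b`.
preserve-sync-ax : ∀ {a b d qs R i} → FreshNet (i ∷ []) (axL a b ∷ syncL ((a , d) ∷ qs) ∷ R) → Positive (ty a) →
                   Net (syncL (((i , ty b) , b) ∷ qs) ∷ axL d (i , ty b) ∷ R)
preserve-sync-ax {a} {b} {d} {qs} {R} {i} (N , f ∷ []) pos
  with typed N | proj₁ (names-split {axL a b ∷ syncL ((a , d) ∷ qs) ∷ []} N)
     | proj₁ (cons-split {axL a b ∷ syncL ((a , d) ∷ qs) ∷ []} N)
... | tA ∷ ((tad , _) ∷ tq) ∷ _ | uN@((a≢b ∷ a≢d ∷ a∉D) ∷ (b≢d ∷ b∉D) ∷ (d∉D ∷ _)) | uC@(a∉P ∷ _) = replace {A} N record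
  { ports = sync-ax-ports uN uC (λ m → fresh-names {A} {R} f m refl) (fresh-cons {A} {R} f)
                          (fresh-names-rest {A} {R} f) (fresh-cons-rest {A} {R} f)
  ; new-links-ok = tt ∷ tt ∷ []
  ; new-typed = ((refl , inj₂ neg) ∷ tq) ∷ trans tA (cong _ᗮ tad) ∷ []
  ; new-boxes = tt ∷ tt ∷ []
  ; new-acyclic = acyclic-slide slide (acyclic N) }
  where
    A = axL a b ∷ syncL ((a , d) ∷ qs) ∷ []
    i' = (i , ty b)

    neg : Negative (ty b)
    neg = subst Negative (sym tA) (dual-pos pos)

    slide : Slide (syncL ((a , d) ∷ qs)) (syncL ((i' , b) ∷ qs)) (axL a b) (axL d i') R
    slide = record
      { α = _≡ up b ; θ = Ent (syncL qs) ; ι = _≡ up i' ; β = dn a ; δ = up d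
      ; Internal = λ s → name (edge s) ≡ i
      ; S-ports' = λ { {dn _} (here refl) → inj₂ (inj₂ refl) ; {dn _} (there m) → inj₂ (inj₁ m)
                     ; {up _} (here refl) → inj₁ refl ; {up _} (there m) → inj₂ (inj₁ m) }
      ; K-ports' = λ { {up _} (here refl) → inj₂ refl ; {up _} (there (here refl)) → inj₁ refl }
      ; ι-internal = λ { refl → refl , refl }
      ; ι-anti = λ { refl () }
      ; ι-once = λ { refl refl x _ → Pass.differ x refl }
      ; external = λ {k} {s} m h → NotIn-Ent N f {k} {s} m h
      ; α-pass = λ { refl → pass (there (here refl)) (here refl) (λ { refl → a≢b refl }) (λ ()) }
      ; αα-pass = λ { {t = dn _} refl refl x → ⊥-elim (Pass.differ x refl) }
      ; β-port = here refl
      ; δ-port = here refl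
      ; θ-port = λ {s} → sync-weaken {s = s}
      ; β≢δ = λ ()
      ; θ≢β = λ { m refl → All≢⇒∉ a∉P (∈-++⁺ˡ m) }
      ; θ≢δ = λ { m refl → All≢⇒∉ d∉D (∈-++⁺ˡ (∈-map⁺ name m)) }
      ; βδ-excl = λ n _ → pos-neg pos n
      ; α-excl = λ _ n → ⊥-elim (pos-neg pos n)
      ; ι-excl = λ { refl _ → neg }
      ; θ-excl = λ {s} → sync-excl {s = s}
      ; K≢S = λ ()
      ; disjoint = links-disjoint {A} N }

-- Dually, the negative pair `(p , y)` becomes the positive pair `(x , i')`: the out-edge `p` is
-- replaced by the out-edge `i'`, and the in-edge `y` by the in-edge `x`.
preserve-sync-cut : ∀ {p x y qs R i} → FreshNet (i ∷ []) (cutL x y ∷ syncL ((p , y) ∷ qs) ∷ R) → Negative (ty y) →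
                    Net (syncL ((x , (i , ty x)) ∷ qs) ∷ cutL (i , ty x) p ∷ R)
preserve-sync-cut {p} {x} {y} {qs} {R} {i} (N , f ∷ []) neg
  with typed N | proj₁ (names-split {cutL x y ∷ syncL ((p , y) ∷ qs) ∷ []} N)
     | proj₁ (cons-split {cutL x y ∷ syncL ((p , y) ∷ qs) ∷ []} N)
... | tA ∷ ((tpy , _) ∷ tq) ∷ _ | uN@(y∉D ∷ _) | uC@((x≢y ∷ x≢p ∷ x∉P) ∷ (y≢p ∷ y∉P) ∷ (p∉P ∷ _)) = replace {A} N record
  { ports = sync-cut-ports uN uC (λ m → fresh-names {A} {R} f m refl) (fresh-cons {A} {R} f)
                           (fresh-names-rest {A} {R} f) (fresh-cons-rest {A} {R} f)
  ; new-links-ok = tt ∷ tt ∷ []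
  ; new-typed = ((refl , inj₁ pos) ∷ tq) ∷ trans tpy tA ∷ []
  ; new-boxes = tt ∷ tt ∷ []
  ; new-acyclic = acyclic-slide slide (acyclic N) }
  where
    A = cutL x y ∷ syncL ((p , y) ∷ qs) ∷ []
    i' = (i , ty x)

    pos : Positive (ty x)
    pos = subst Positive (sym (dual-sym tA)) (dual-neg neg)

    slide : Slide (syncL ((p , y) ∷ qs)) (syncL ((x , i') ∷ qs)) (cutL x y) (cutL i' p) R
    slide = record
      { α = _≡ dn x ; θ = Ent (syncL qs) ; ι = _≡ dn i' ; β = up y ; δ = dn p
      ; Internal = λ s → name (edge s) ≡ i
      ; S-ports' = λ { {dn _} (here refl) → inj₁ refl ; {dn _} (there m) → inj₂ (inj₁ m)
                     ; {up _} (here refl) → inj₂ (inj₂ refl) ; {up _} (there m) → inj₂ (inj₁ m) }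
      ; K-ports' = λ { {dn _} (here refl) → inj₁ refl ; {dn _} (there (here refl)) → inj₂ refl }
      ; ι-internal = λ { refl → refl , refl }
      ; ι-anti = λ { refl () }
      ; ι-once = λ { refl refl x _ → Pass.differ x refl }
      ; external = λ {k} {s} m h → NotIn-Ent N f {k} {s} m h
      ; α-pass = λ { refl → pass (here refl) (there (here refl)) (λ { refl → x≢y refl }) (λ ()) }
      ; αα-pass = λ { {t = up _} refl refl x → ⊥-elim (Pass.differ x refl) }
      ; β-port = here refl
      ; δ-port = here refl
      ; θ-port = λ {s} → sync-weaken {s = s}
      ; β≢δ = λ ()
      ; θ≢β = λ { m refl → All≢⇒∉ y∉D (∈-++⁺ˡ (∈-map⁺ name m)) }
      ; θ≢δ = λ { m refl → All≢⇒∉ p∉P (∈-++⁺ˡ m) }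
      ; βδ-excl = λ q _ → pos-neg q neg
      ; α-excl = λ _ q → ⊥-elim (pos-neg q neg)
      ; ι-excl = λ { refl _ → pos }
      ; θ-excl = λ {s} → sync-excl {s = s}
      ; K≢S = λ ()
      ; disjoint = links-disjoint {A} N }

bin-ent : ∀ {K a b c s} → BinLink K → Ent (K a b c) s → (s ≡ dn a ⊎ s ≡ dn b) ⊎ s ≡ up c
bin-ent {s = dn _} isTens (here refl) = inj₁ (inj₁ refl)
bin-ent {s = dn _} isTens (there (here refl)) = inj₁ (inj₂ refl)
bin-ent {s = up _} isTens (here refl) = inj₂ refl
bin-ent {s = dn _} isPar (here refl) = inj₁ (inj₁ refl)
bin-ent {s = dn _} isPar (there (here refl)) = inj₁ (inj₂ refl)
bin-ent {s = up _} isPar (here refl) = inj₂ refl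

bin-down : ∀ {K a b c s} → BinLink K → s ≡ dn a ⊎ s ≡ dn b → Pass (K a b c) s (dn c)
bin-down isTens (inj₁ refl) = pass (here refl) (here refl) (λ ()) (λ ())
bin-down isTens (inj₂ refl) = pass (there (here refl)) (here refl) (λ ()) (λ ())
bin-down isPar (inj₁ refl) = pass (here refl) (here refl) (λ ()) (λ _ ())
bin-down isPar (inj₂ refl) = pass (there (here refl)) (here refl) (λ ()) (λ _ ())

-- The connective decides the polarity of the sync pair below it, as no tensor is negative and no
-- par is positive. The components share this polarity, so both new pairs are legal.
data Polarity : (Edge → Edge → Edge → Link) → (a b c : Edge) → Set where
  tens-pos : ∀ {a b c} → Positive (ty a) → Positive (ty b) → Positive (ty c) → Polarity tensL a b c
  par-neg  : ∀ {a b c} → Negative (ty a) → Negative (ty b) → Negative (ty c) → Polarity parL a b c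

polarity : ∀ {K a b c} → BinLink K → Typed (K a b c) → Positive (ty c) ⊎ Negative (ty c) → Polarity K a b c
polarity {a = na , A} {nb , B} {nc , _} isTens refl (inj₁ (pos-⊗ p q)) = tens-pos p q (pos-⊗ p q)
polarity {a = na , A} {nb , B} {nc , _} isPar refl (inj₂ (neg-⅋ p q)) = par-neg p q (neg-⅋ p q)

-- Above a tensor the pair is positive: a passage of `S'` from `a` to `b` uses two in-edges and is
-- copied by the old tensor, while the two fresh edges are out-edges of `S'`, of which a switching
-- keeps one. Above a par the roles change: `a` and `b` are out-edges of `S'`, and the two fresh
-- edges are premisses of the new par.
slide-push : ∀ {K a b c d qs R i j} → BinLink K → Polarity K a b c → ty c ≡ ty d → NotIn (K a b c ∷ syncL ((c , d) ∷ qs) ∷ R) i →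
  NotIn (K a b c ∷ syncL ((c , d) ∷ qs) ∷ R) j → Net (K a b c ∷ syncL ((c , d) ∷ qs) ∷ R) →
  c ∉ map proj₁ qs → name d ∉ map name (map proj₂ qs) →
  Slide (syncL ((c , d) ∷ qs)) (syncL ((a , (i , ty a)) ∷ (b , (j , ty b)) ∷ qs)) (K a b c) (K (i , ty a) (j , ty b) d) R
slide-push {K} {a} {b} {c} {d} {qs} {R} {i} {j} bl pol tcd fi fj N c∉ d∉ = record
  { α = λ s → s ≡ dn a ⊎ s ≡ dn b ; θ = Ent (syncL qs) ; ι = λ s → s ≡ dn i' ⊎ s ≡ dn j' ; β = dn c ; δ = up d
  ; Internal = λ s → name (edge s) ≡ i ⊎ name (edge s) ≡ j
  ; S-ports' = λ { {dn _} (here refl) → inj₁ (inj₁ refl) ; {dn _} (there (here refl)) → inj₁ (inj₂ refl)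
                 ; {dn _} (there (there m)) → inj₂ (inj₁ m)
                 ; {up _} (here refl) → inj₂ (inj₂ (inj₁ refl)) ; {up _} (there (here refl)) → inj₂ (inj₂ (inj₂ refl))
                 ; {up _} (there (there m)) → inj₂ (inj₁ m) }
  ; K-ports' = bin-ent bl
  ; ι-internal = λ { (inj₁ refl) → inj₁ refl , inj₁ refl ; (inj₂ refl) → inj₂ refl , inj₂ refl }
  ; ι-anti = λ { (inj₁ refl) (inj₁ ()) ; (inj₁ refl) (inj₂ ()) ; (inj₂ refl) (inj₁ ()) ; (inj₂ refl) (inj₂ ()) }
  ; ι-once = once pol
  ; external = λ { {k} {s} m h (inj₁ eq) → NotIn-Ent N fi {k} {s} m h eq
                 ; {k} {s} m h (inj₂ eq) → NotIn-Ent N fj {k} {s} m h eq }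
  ; α-pass = bin-down bl
  ; αα-pass = across pol
  ; β-port = here refl
  ; δ-port = here refl
  ; θ-port = λ {s} → sync-weaken {s = s}
  ; β≢δ = λ ()
  ; θ≢β = λ { m refl → c∉ m }
  ; θ≢δ = λ { m refl → d∉ (∈-map⁺ name m) }
  ; βδ-excl = λ n p → pos-neg (subst Positive (sym tcd) p) n
  ; α-excl = α-ex pol
  ; ι-excl = λ h p → ι-ex pol h (subst Positive (sym tcd) p)
  ; θ-excl = λ {s} → sync-excl {s = s}
  ; K≢S = K≢S' bl
  ; disjoint = links-disjoint {K a b c ∷ syncL ((c , d) ∷ qs) ∷ []} N }
  where
    i' = (i , ty a)
    j' = (j , ty b)
    S' = syncL ((a , i') ∷ (b , j') ∷ qs)

    α-ex : ∀ {K s} → Polarity K a b c → s ≡ dn a ⊎ s ≡ dn b → Negative (ty c) → Excl S' s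
    α-ex (tens-pos _ _ p) _ n = ⊥-elim (pos-neg p n)
    α-ex (par-neg p q _) (inj₁ refl) _ = p
    α-ex (par-neg p q _) (inj₂ refl) _ = q

    ι-ex : ∀ {K s} → Polarity K a b c → s ≡ dn i' ⊎ s ≡ dn j' → Positive (ty c) → Excl S' (rev s)
    ι-ex (tens-pos p q _) (inj₁ refl) _ = p
    ι-ex (tens-pos p q _) (inj₂ refl) _ = q
    ι-ex (par-neg _ _ n) _ p = ⊥-elim (pos-neg p n)

    across : ∀ {K s t} → Polarity K a b c → s ≡ dn a ⊎ s ≡ dn b → rev t ≡ dn a ⊎ rev t ≡ dn b →
             Pass S' s t → Pass (K a b c) s t
    across (tens-pos _ _ _) h h' x = pass (prem h) (prem h') (Pass.differ x) (λ ())
      where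
        prem : ∀ {s} → s ≡ dn a ⊎ s ≡ dn b → Ent (tensL a b c) s
        prem (inj₁ refl) = here refl
        prem (inj₂ refl) = there (here refl)
    across pol@(par-neg _ _ n) h h' x = ⊥-elim (Pass.switch x (α-ex pol h n) (α-ex pol h' n))

    once : ∀ {K u v} → Polarity K a b c → u ≡ dn i' ⊎ u ≡ dn j' → v ≡ dn i' ⊎ v ≡ dn j' →
           Pass S' (rev v) u → ¬ Pass (K i' j' d) u (rev v)
    once pol@(tens-pos _ _ p) h h' x _ = Pass.switch x (ι-ex pol h' p) (ι-ex pol h p)
    once (par-neg _ _ _) h h' _ y = Pass.switch y (prem h) (subst (Excl (parL i' j' d)) (sym (rev-rev _)) (prem h'))
      where
        prem : ∀ {s} → s ≡ dn i' ⊎ s ≡ dn j' → Excl (parL i' j' d) s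
        prem (inj₁ refl) = tt
        prem (inj₂ refl) = tt

    K≢S' : ∀ {K} → BinLink K → K a b c ≢ syncL ((c , d) ∷ qs)
    K≢S' isTens ()
    K≢S' isPar ()

preserve-sync-push : ∀ {K a b c d qs R i j} → BinLink K → i ≢ j → FreshNet (i ∷ j ∷ []) (K a b c ∷ syncL ((c , d) ∷ qs) ∷ R) →
  Net (syncL ((a , (i , ty a)) ∷ (b , (j , ty b)) ∷ qs) ∷ K (i , ty a) (j , ty b) d ∷ R)
preserve-sync-push {K} {a} {b} {c} {d} {qs} {R} {i} {j} bl i≢j (N , fi ∷ fj ∷ []) with typed N
... | tK ∷ ((tcd , pn) ∷ tq) ∷ _ = replace {A} {A'} N record
  { ports = ports bl (proj₁ (names-split {A} N)) (proj₁ (cons-split {A} N))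
      (λ m → fresh-names {A} {R} fi m , fresh-names {A} {R} fj m)
      (λ m → fresh-cons {A} {R} fi m , fresh-cons {A} {R} fj m)
  ; new-links-ok = tt ∷ ok bl ∷ []
  ; new-typed = pair-types pol ∷ new-type bl tK ∷ []
  ; new-boxes = tt ∷ bc bl ∷ []
  ; new-acyclic = acyclic-slide
      (slide-push bl pol tcd fi fj N (c∉ bl (proj₁ (cons-split {A} N))) (d∉ bl (proj₁ (names-split {A} N)))) (acyclic N) }
  where
    A = K a b c ∷ syncL ((c , d) ∷ qs) ∷ []
    i' = (i , ty a)
    j' = (j , ty b)
    S' = syncL ((a , i') ∷ (b , j') ∷ qs)
    A' = S' ∷ K i' j' d ∷ []
    S = syncL ((c , d) ∷ qs)
    pol = polarity bl tK pn

    ports : ∀ {K} → BinLink K → let A = K a b c ∷ S ∷ [] ; A' = S' ∷ K i' j' d ∷ [] in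
      Unique (concatMap names A) → Unique (concatMap cons A) →
      (∀ {x} → x ∈ concatMap names A → x ≢ i × x ≢ j) → (∀ {e} → e ∈ concatMap cons A → name e ≢ i × name e ≢ j) →
      Ports (concatMap names A) (concatMap names A') (concatMap names R)
            (concatMap cons A) (concatMap cons A') (concatMap cons R)
            (conclsL0 A) (conclsL0 A') (premsL0 A) (premsL0 A')
    ports isTens u v f g = sync-push-ports u v i≢j f g (fresh-names-rest {A} {R} fi , fresh-names-rest {A} {R} fj)
      (λ m → fresh-cons-rest {A} {R} fi m , fresh-cons-rest {A} {R} fj m)
    ports isPar u v f g = sync-push-ports u v i≢j f g (fresh-names-rest {A} {R} fi , fresh-names-rest {A} {R} fj)
      (λ m → fresh-cons-rest {A} {R} fi m , fresh-cons-rest {A} {R} fj m)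

    ok : ∀ {K} → BinLink K → LinkOK (K i' j' d)
    ok isTens = tt
    ok isPar = tt

    bc : ∀ {K} → BinLink K → BoxCorrect (K i' j' d)
    bc isTens = tt
    bc isPar = tt

    new-type : ∀ {K} → BinLink K → Typed (K a b c) → Typed (K i' j' d)
    new-type isTens t = trans (sym tcd) t
    new-type isPar t = trans (sym tcd) t

    pair-types : ∀ {K} → Polarity K a b c → All SyncPairOK ((a , i') ∷ (b , j') ∷ qs)
    pair-types (tens-pos p q _) = (refl , inj₁ p) ∷ (refl , inj₁ q) ∷ tq
    pair-types (par-neg p q _) = (refl , inj₂ p) ∷ (refl , inj₂ q) ∷ tq

    c∉ : ∀ {K} → BinLink K → Unique (concatMap cons (K a b c ∷ S ∷ [])) → c ∉ map proj₁ qs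
    c∉ isTens (_ ∷ _ ∷ (p ∷ _)) m = All≢⇒∉ p (∈-++⁺ˡ m)
    c∉ isPar (_ ∷ _ ∷ (p ∷ _)) m = All≢⇒∉ p (∈-++⁺ˡ m)

    d∉ : ∀ {K} → BinLink K → Unique (concatMap names (K a b c ∷ S ∷ [])) → name d ∉ map name (map proj₂ qs)
    d∉ isTens (_ ∷ (p ∷ _)) m = All≢⇒∉ p (∈-++⁺ˡ m)
    d∉ isPar (_ ∷ (p ∷ _)) m = All≢⇒∉ p (∈-++⁺ˡ m)

-- Renaming and the axiom/cut rule

renE-other : ∀ a c {x} → name x ≢ name a → renE a c x ≡ x
renE-other a c {x} ne with name x ≡ᵇ name a in eq
... | false = refl
... | true = ⊥-elim (ne (ℕₚ.≡ᵇ⇒≡ (name x) (name a) (subst T (sym eq) tt)))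

renE-same : ∀ a c x → name x ≡ name a → renE a c x ≡ c
renE-same a c x e with name x ≡ᵇ name a in eq
... | true = refl
... | false = ⊥-elim (subst T eq (ℕₚ.≡⇒≡ᵇ (name x) (name a) e))

module _ {a c : Edge} where

  private
    r = renE a c

    Avoids : List Edge → Set
    Avoids es = ∀ {e} → e ∈ es → name e ≢ name a

    map-id : ∀ {es} → Avoids es → map r es ≡ es
    map-id {es} av = Listₚ.map-id-local (All.tabulate (λ m → renE-other a c (av m)))

    map-pairs : ∀ ps → Avoids (map proj₁ ps) → Avoids (map proj₂ ps) → map (λ q → r (proj₁ q) , r (proj₂ q)) ps ≡ ps
    map-pairs [] _ _ = refl
    map-pairs (q ∷ ps) f g = cong₂ _∷_ (cong₂ _,_ (renE-other a c (f (here refl))) (renE-other a c (g (here refl))))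
      (map-pairs ps (λ m → f (there m)) (λ m → g (there m)))

    cong₃ : ∀ {X Y : Set} (f : X → X → X → Y) {x x' y y' z z'} → x ≡ x' → y ≡ y' → z ≡ z' → f x y z ≡ f x' y' z'
    cong₃ f refl refl refl = refl

  mutual
    -- Renaming descends into boxes, but a content consumes at its own level only what it produces
    -- there. Below depth 0 it is therefore enough that no produced edge has the name of `a`.
    renLink-id : ∀ k → LinkOK k → Avoids (prods k) → Avoids (prem0 k) → renLink a c k ≡ k
    renLink-id (axL x y) ok f g = cong₂ axL (renE-other a c (f (here refl))) (renE-other a c (f (there (here refl))))
    renLink-id (cutL x y) ok f g = cong₂ cutL (renE-other a c (g (here refl))) (renE-other a c (g (there (here refl))))
    renLink-id (tensL x y z) ok f g =
      cong₃ tensL (renE-other a c (g (here refl))) (renE-other a c (g (there (here refl)))) (renE-other a c (f (here refl)))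
    renLink-id (parL x y z) ok f g =
      cong₃ parL (renE-other a c (g (here refl))) (renE-other a c (g (there (here refl)))) (renE-other a c (f (here refl)))
    renLink-id (oneL x) ok f g = cong oneL (renE-other a c (f (here refl)))
    renLink-id (syncL ps) ok f g = cong syncL (map-pairs ps g f)
    renLink-id (botL l Γ C) ((lvl , oks) , _ , Γ⊆ , _) f g =
      trans (cong₂ (λ l Γ → botL l Γ (renLinks a c C)) (renE-other a c (f (here refl)))
                   (map-id (λ m → f (there (conclsL0⊆prodsL C oks (proj₁ (Γ⊆ _ m)))))))
            (cong (botL l Γ) (renLinks-id C oks (λ m → f (there m))
              (λ m → f (there (conclsL0⊆prodsL C oks (lvl _ m))))))

    renLinks-id : ∀ ks → AllLinkOK ks → Avoids (prodsL ks) → Avoids (premsL0 ks) → renLinks a c ks ≡ ks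
    renLinks-id [] _ _ _ = refl
    renLinks-id (k ∷ ks) (ok , oks) f g =
      cong₂ _∷_ (renLink-id k ok (λ m → f (∈-++⁺ˡ m)) (λ m → g (∈-++⁺ˡ m)))
                (renLinks-id ks oks (λ m → f (∈-++⁺ʳ (prods k) m)) (λ m → g (∈-++⁺ʳ (prem0 k) m)))

  renLinks≡map : ∀ ks → renLinks a c ks ≡ map (renLink a c) ks
  renLinks≡map [] = refl
  renLinks≡map (k ∷ ks) = cong (_ ∷_) (renLinks≡map ks)

  map-renLink-id : ∀ {ks} → All LinkOK ks → (∀ {k} → k ∈ ks → name a ∉ names k) →
                   (∀ {k e} → k ∈ ks → e ∈ prem0 k → name e ≢ name a) → map (renLink a c) ks ≡ ks
  map-renLink-id oks f g = Listₚ.map-id-local (All.tabulate λ {k} m →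
    renLink-id k (All.lookup oks m) (λ {e} p eq → f m (subst (_∈ names k) eq (∈-map⁺ name p))) (g m))

  prem-ren : ∀ k → prem0 (renLink a c k) ≡ map r (prem0 k)
  prem-ren (axL x y) = refl
  prem-ren (cutL x y) = refl
  prem-ren (tensL x y z) = refl
  prem-ren (parL x y z) = refl
  prem-ren (oneL x) = refl
  prem-ren (botL l Γ C) = refl
  prem-ren (syncL ps) = trans (sym (Listₚ.map-∘ ps)) (Listₚ.map-∘ ps)

  concl-ren : ∀ k → Avoids (concl0 k) → concl0 (renLink a c k) ≡ concl0 k
  concl-ren k av = trans (step k) (map-id av)
    where
      step : ∀ k → concl0 (renLink a c k) ≡ map r (concl0 k)
      step (axL x y) = refl
      step (cutL x y) = refl
      step (tensL x y z) = refl
      step (parL x y z) = refl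
      step (oneL x) = refl
      step (botL l Γ C) = refl
      step (syncL ps) = trans (sym (Listₚ.map-∘ ps)) (Listₚ.map-∘ ps)

  Typed-ren : ∀ k {x} → x ∈ prem0 k → (∀ {e} → e ∈ prem0 k → ty (r e) ≡ ty e) → (∀ {e} → e ∈ concl0 k → ty (r e) ≡ ty e) →
              Typed k → Typed (renLink a c k)
  Typed-ren (cutL x y) _ f g t =
    trans (f (there (here refl))) (trans t (cong _ᗮ (sym (f (here refl)))))
  Typed-ren (tensL x y z) _ f g t =
    trans (g (here refl)) (trans t (cong₂ _⊗_ (sym (f (here refl))) (sym (f (there (here refl))))))
  Typed-ren (parL x y z) _ f g t =
    trans (g (here refl)) (trans t (cong₂ _⅋_ (sym (f (here refl))) (sym (f (there (here refl))))))
  Typed-ren (syncL (q ∷ qs)) _ f g t = pairs (q ∷ qs) f g t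
    where
      pairs : ∀ ps → (∀ {e} → e ∈ map proj₁ ps → ty (r e) ≡ ty e) → (∀ {e} → e ∈ map proj₂ ps → ty (r e) ≡ ty e) →
              All SyncPairOK ps → All SyncPairOK (map (λ q → r (proj₁ q) , r (proj₂ q)) ps)
      pairs [] f g [] = []
      pairs (q ∷ ps) f g ((eq , pol) ∷ t) =
        ( trans (f (here refl)) (trans eq (sym (g (here refl))))
        , subst (λ A → Positive A ⊎ Negative A) (sym (f (here refl))) pol )
        ∷ pairs ps (λ m → f (there m)) (λ m → g (there m)) t

  Excl-ren : ∀ k {s} → Excl k s → Excl (renLink a c k) s
  Excl-ren (parL x y z) {dn _} _ = tt
  Excl-ren (syncL ps) {dn _} x = x
  Excl-ren (syncL ps) {up _} x = x

Excl-ty : ∀ k {e e'} → ty e ≡ ty e' → Excl k (dn e) → Excl k (dn e')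
Excl-ty (parL x y z) eq _ = tt
Excl-ty (syncL ps) eq n = subst Negative eq n

record BoxFree (k : Link) : Set where
  constructor boxfree
  field
    cons≡  : cons k ≡ prem0 k
    prods≡ : prods k ≡ concl0 k
    ok     : LinkOK k
    correct : BoxCorrect k

-- A box has no premisses at depth 0, so the consumer of the renamed edge is never a box, and its
-- ports at depth 0 are all its ports.
prem⇒BoxFree : ∀ k {x} → x ∈ prem0 k → BoxFree k
prem⇒BoxFree (cutL _ _) _ = boxfree refl refl tt tt
prem⇒BoxFree (tensL _ _ _) _ = boxfree refl refl tt tt
prem⇒BoxFree (parL _ _ _) _ = boxfree refl refl tt tt
prem⇒BoxFree (syncL _) _ = boxfree refl refl tt tt

Unique-map-local : ∀ {X Y : Set} (f : X → Y) {xs} → (∀ {x y} → x ∈ xs → y ∈ xs → f x ≡ f y → x ≡ y) →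
                   Unique xs → Unique (map f xs)
Unique-map-local f inj [] = []
Unique-map-local f inj (p ∷ u) =
  Allₚ.map⁺ (All.tabulate (λ m eq → All.lookup p m (inj (here refl) (there m) eq)))
  ∷ Unique-map-local f (λ m n → inj (there m) (there n)) u

-- The consumer of `a` is an arbitrary link, so its port lists enter as variables tied by equations.
-- Replacing `a` by `c` is injective on its premisses because `c` is consumed by the cut and hence
-- not among them.
ax-cut-ports : ∀ {a b c P D N P' D' N' C C' nR cR} →
  C ≡ P → C' ≡ P' → P' ≡ map (renE a c) P → D' ≡ D → N' ≡ N →
  Unique (name a ∷ name b ∷ (N ++ [])) → Unique (b ∷ c ∷ (C ++ [])) → a ∈ P →
  (∀ {x} → x ∈ P → name x ≡ name a → x ≡ a) → a ∉ D → b ∉ D →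
  Ports (name a ∷ name b ∷ (N ++ [])) (N' ++ []) nR (b ∷ c ∷ (C ++ [])) (C' ++ []) cR
        (a ∷ b ∷ (D ++ [])) (D' ++ []) (b ∷ c ∷ (P ++ [])) (P' ++ [])
ax-cut-ports {a} {b} {c} {P} {D} {N} {nR = nR} {cR} refl refl refl refl refl (_ ∷ (_ ∷ uN)) ((b≢c ∷ b∉P) ∷ (c∉P ∷ uP)) a∈ same a∉D b∉D = record
  { new-names-unique = uN
  ; new-names = λ m → inj₁ (there (there m))
  ; new-cons-unique = subst Unique (sym (Listₚ.++-identityʳ _))
      (Unique-map-local r r-inj (proj₁ (Unique-++⁻ P uP)))
  ; new-cons = λ m → inj₁ (proj₁ (origin (∈-++⁻ (map r P) m)))
  ; concl-kept = λ { (here refl) → inj₂ (there (there (∈-++⁺ˡ a∈)))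
                   ; (there (here refl)) → inj₂ (here refl)
                   ; (there (there m)) → inj₁ m }
  ; prem-new = λ m → inj₂ (origin (∈-++⁻ (map r P) m))
  ; concl-new = λ m _ → there (there m)
  ; prem-kept = λ { (here refl) → inj₂ (there (here refl) , λ m → b∉D (strip m))
                  ; (there (here refl)) → inj₁ (∈-++⁺ˡ (subst (_∈ map r P) (renE-same a c a refl) (∈-map⁺ r a∈)))
                  ; (there (there m)) → pk (strip m) } }
  where
    r = renE a c

    strip : ∀ {xs : List Edge} {x} → x ∈ xs ++ [] → x ∈ xs
    strip {xs} m with ∈-++⁻ xs m
    ... | inj₁ p = p

    c∉ : c ∉ P
    c∉ m = All≢⇒∉ c∉P (∈-++⁺ˡ m)

    r-inj : ∀ {x y} → x ∈ P → y ∈ P → r x ≡ r y → x ≡ y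
    r-inj {x} {y} m n eq with name x ≟ name a | name y ≟ name a
    ... | yes p | yes q = trans (same m p) (sym (same n q))
    ... | yes p | no q = ⊥-elim (c∉ (subst (_∈ P) (trans (sym (renE-other a c q)) (trans (sym eq) (renE-same a c x p))) n))
    ... | no p | yes q = ⊥-elim (c∉ (subst (_∈ P) (trans (sym (renE-other a c p)) (trans eq (renE-same a c y q))) m))
    ... | no p | no q = trans (sym (renE-other a c p)) (trans eq (renE-other a c q))

    origin : ∀ {e} → e ∈ map r P ⊎ e ∈ [] → e ∈ b ∷ c ∷ (P ++ []) × (e ∈ a ∷ b ∷ (D ++ []) → e ∈ D ++ [])
    origin (inj₁ m) with ∈-map⁻ r m
    ... | x , x∈ , refl with name x ≟ name a
    ...   | yes p rewrite renE-same a c x p = there (here refl) ,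
      λ { (here refl) → ⊥-elim (c∉ a∈) ; (there (here refl)) → ⊥-elim (b≢c refl) ; (there (there n)) → n }
    ...   | no p rewrite renE-other a c {x} p = there (there (∈-++⁺ˡ x∈)) ,
      λ { (here refl) → ⊥-elim (p refl) ; (there (here refl)) → ⊥-elim (All≢⇒∉ b∉P (∈-++⁺ˡ x∈)) ; (there (there n)) → n }

    pk : ∀ {e} → e ∈ P → e ∈ map r P ++ [] ⊎ (e ∈ a ∷ b ∷ (D ++ []) × e ∉ D ++ [])
    pk {e} m with name e ≟ name a
    ... | yes p rewrite same m p = inj₂ (here refl , λ n → a∉D (strip n))
    ... | no p = inj₁ (∈-++⁺ˡ (subst (_∈ map r P) (renE-other a c p) (∈-map⁺ r m)))

-- A path entering the renamed link by `c` is simulated by crossing the cut from `c` to `b`, then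
-- the axiom from `b` to `a`, and entering the old link by `a`.
preserve-ax-cut-consumed : ∀ {a b c k R} → Net (axL a b ∷ cutL b c ∷ k ∷ R) → a ∈ prem0 k → Net (renLink a c k ∷ R)
preserve-ax-cut-consumed {a} {b} {c} {k} {R} N a∈ = replace {A} {k' ∷ []} N record
  { ports = ax-cut-ports (BoxFree.cons≡ bf) (BoxFree.cons≡ bf') (prem-ren k) same-concl
      (cong (map name) (trans (BoxFree.prods≡ bf') (trans same-concl (sym (BoxFree.prods≡ bf)))))
      uN uC a∈ same (λ m → avoid-a m refl) b∉
  ; new-links-ok = BoxFree.ok bf' ∷ []
  ; new-typed = Typed-ren k a∈ (λ m → ty-ren (same m)) (λ m → ty-ren (λ eq → ⊥-elim (avoid-a m eq))) (ty-of N k∈) ∷ []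
  ; new-boxes = BoxFree.correct bf' ∷ []
  ; new-acyclic = acyclic-one-node k' (links-disjoint {A} N) bridges (acyclic N) }
  where
    A = axL a b ∷ cutL b c ∷ k ∷ []
    k' = renLink a c k
    r = renE a c
    bf = prem⇒BoxFree k a∈

    k∈ : k ∈ axL a b ∷ cutL b c ∷ k ∷ R
    k∈ = there (there (here refl))

    c∈ : c ∈ prem0 k'
    c∈ = subst (c ∈_) (sym (prem-ren k)) (subst (_∈ map r (prem0 k)) (renE-same a c a refl) (∈-map⁺ r a∈))

    bf' = prem⇒BoxFree k' c∈

    uN : Unique (name a ∷ name b ∷ (names k ++ []))
    uN = proj₁ (names-split {A} N)

    uC : Unique (b ∷ c ∷ (cons k ++ []))
    uC = proj₁ (cons-split {A} N)

    a≢b : a ≢ b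
    a≢b refl with uN
    ... | (p ∷ _) ∷ _ = p refl

    b≢c : b ≢ c
    b≢c refl with uC
    ... | (p ∷ _) ∷ _ = p refl

    avoid-a : ∀ {e} → e ∈ concl0 k → name e ≢ name a
    avoid-a m eq with uN
    ... | (_ ∷ p) ∷ _ = All.lookup p (∈-++⁺ˡ (names⁺ k (ok-of N k∈) m)) (sym eq)

    b∉ : b ∉ concl0 k
    b∉ m with uN
    ... | _ ∷ (p ∷ _) = All.lookup p (∈-++⁺ˡ (names⁺ k (ok-of N k∈) m)) refl

    same-concl = concl-ren {a} {c} k avoid-a

    same : ∀ {x} → x ∈ prem0 k → name x ≡ name a → x ≡ a
    same m eq with producer N k∈ m
    ... | k₁ , k₁∈ , p = same-name N k₁∈ (here refl) p (here refl) eq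

    ty-ac : ty a ≡ ty c
    ty-ac with typed N
    ... | t ∷ t' ∷ _ = trans (dual-sym t) (sym t')

    ty-ren : ∀ {x} → (name x ≡ name a → x ≡ a) → ty (r x) ≡ ty x
    ty-ren {x} f with name x ≟ name a
    ... | yes p rewrite renE-same a c x p = trans (sym ty-ac) (cong ty (sym (f p)))
    ... | no p = cong ty (renE-other a c p)

    -- ports of k' are those of k, except that dn c stands for dn a
    old-port : ∀ {s} → Ent k' s → (s ≡ dn c × Ent k (dn a)) ⊎ (Ent k s × s ≢ dn a)
    old-port {up e} h = inj₂ (subst (e ∈_) same-concl h , λ ())
    old-port {dn e} h with ∈-map⁻ r (subst (e ∈_) (prem-ren k) h)
    ... | x , x∈ , refl with name x ≟ name a
    ...   | yes p = inj₁ (cong dn (renE-same a c x p) , a∈)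
    ...   | no p rewrite renE-other a c {x} p = inj₂ (x∈ , λ { refl → p refl })

    via : ∀ {t} → Pass k (dn a) t → Bridge A (dn c) t
    via x = bridge-∷ (pass {t = up b} (there (here refl)) (here refl) (λ { refl → b≢c refl }) (λ ()))
      (bridge₂ (here refl) (there (there (here refl))) ax≢
        (pass (there (here refl)) (here refl) (λ { refl → a≢b refl }) (λ ())) x)
      (λ { (there (here eq)) → cut≢ eq }) (there (here refl))
      where
        ax≢ : axL a b ≢ k
        ax≢ eq with subst (λ k → a ∈ prem0 k) (sym eq) a∈
        ... | ()
        cut≢ : cutL b c ≢ k
        cut≢ refl with uC
        ... | (_ ∷ p ∷ _) ∷ _ = p refl

    bridges : ∀ {s t} → Pass k' s t → Bridge A s t
    bridges {s} {t} x with old-port (Pass.enter x) | old-port (Pass.leave x)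
    ... | inj₁ (p , _) | inj₁ (q , _) = ⊥-elim (Pass.differ x (trans p (sym q)))
    ... | inj₂ (p , _) | inj₂ (q , _) =
      bridge₁ (there (there (here refl))) (pass p q (Pass.differ x)
        (λ e f → Pass.switch x (Excl-ren k e) (Excl-ren k f)))
    ... | inj₁ (refl , p) | inj₂ (q , ne) = via (pass p q (λ eq → ne (sym eq))
        (λ e f → Pass.switch x (Excl-ren k (Excl-ty k ty-ac e)) (Excl-ren k f)))
    bridges {s} {up _} x | inj₂ (q , ne) | inj₁ (refl , p) = subst (λ s → Bridge A s (up c)) (rev-rev s)
      (Bridge-rev (via (Pass-rev (pass {t = up a} q p ne
        (λ e f → Pass.switch x (Excl-ren k e) (Excl-ren k (Excl-ty k ty-ac f)))))))

preserve-ax-cut-conclusion : ∀ {a b c R} → Net (axL a b ∷ cutL b c ∷ R) →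
  (∀ {e} → e ∈ premsL0 R → name e ≢ name a) → Net R
preserve-ax-cut-conclusion {a} {b} {c} {R} N a∉ = record
  { names-unique = proj₁ (proj₂ (names-split {A} N))
  ; cons-unique = proj₁ (proj₂ (cons-split {A} N))
  ; level = λ m → lvl m (level N (there (there m)))
  ; links-ok = All.tail (All.tail (links-ok N))
  ; typed = All.tail (All.tail (typed N))
  ; boxes = All.tail (All.tail (boxes N))
  ; acyclic = λ cy → acyclic N (Cycle-mono (λ m → there (there m)) cy)
  ; closed = λ e (m , n) → closed-by e m n }
  where
    A = axL a b ∷ cutL b c ∷ []

    b∉ : b ∉ premsL0 R
    b∉ = prem-disjoint {A} N (here refl)

    a≢b : a ≢ b
    a≢b refl with proj₁ (names-split {A} N)
    ... | (p ∷ _) ∷ _ = p refl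

    lvl : ∀ {e} → e ∈ premsL0 R → e ∈ a ∷ b ∷ conclsL0 R → e ∈ conclsL0 R
    lvl m (here refl) = ⊥-elim (a∉ m refl)
    lvl m (there (here refl)) = ⊥-elim (b∉ m)
    lvl m (there (there n)) = n

    ty-ac : ty a ≡ ty c
    ty-ac with typed N
    ... | t ∷ t' ∷ _ = trans (dual-sym t) (sym t')

    -- An axiom whose two conclusions are cut against each other is a cycle of two links.
    a≢c : a ≢ c
    a≢c refl = acyclic N (cycle
      (pass {k = axL a b} {up a} {dn b} (here refl) (there (here refl)) (λ { refl → a≢b refl }) (λ ())
       ∷ pass {k = cutL b a} {dn b} {up a} (here refl) (there (here refl)) (λ { refl → a≢b refl }) (λ ()) ∷ [])
      (((λ ()) ∷ []) ∷ [] ∷ []) (here refl ∷ there (here refl) ∷ []))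

    -- the conclusion a of the old net is now carried by c
    closed-by : ∀ e → e ∈ conclsL0 R → e ∉ premsL0 R → ⊥Free (ty e)
    closed-by e m n with name e ≟ name c
    ... | no e≢c = closed N e (there (there m) , λ
      { (here refl) → concl-disjoint {A} N (there (here refl)) m
      ; (there (here refl)) → e≢c refl
      ; (there (there q)) → n q })
    ... | yes eq = subst ⊥Free (trans ty-ac (cong ty c≡e)) (closed N a (here refl , λ
      { (here eq') → a≢b eq' ; (there (here eq')) → a≢c eq' ; (there (there q)) → a∉ q refl }))
      where
        c≡e : c ≡ e
        c≡e with ∈-concatMap⁻ concl0 R m | producer N (there (here refl)) (there (here refl))
        ... | k , k∈ , p | k' , k'∈ , p' = same-name N k'∈ (there (there k∈)) p' p (sym eq)

preserve-ax-cut : ∀ {a b c R} → Net (axL a b ∷ cutL b c ∷ R) → Net (renLinks a c R)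
-- Membership is decided on names. If the name of `a` is consumed in `R`, `same-name` identifies the
-- premiss found with `a`; otherwise `a` is a conclusion of the net and renaming leaves `R` as it
-- is.
preserve-ax-cut {a} {b} {c} {R} N with name a ∈? map name (premsL0 R)
... | no a∉ = subst Net (sym (trans (renLinks≡map R) (map-renLink-id (All.tail (All.tail (links-ok N)))
      (λ m n → proj₂ (proj₂ (names-split {axL a b ∷ cutL b c ∷ []} N)) (here refl) (∈-concatMap⁺ names m n))
      (λ m n eq → a∉ (subst (_∈ map name (premsL0 R)) eq (∈-map⁺ name (∈-concatMap⁺ prem0 m n)))))))
    (preserve-ax-cut-conclusion N (λ m eq → a∉ (subst (_∈ map name (premsL0 R)) eq (∈-map⁺ name m))))
... | yes a∈ with ∈-map⁻ name a∈
...   | e , e∈ , eq with ∈-concatMap⁻ prem0 R e∈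
...     | k , k∈ , p with extract k∈ | producer N (there (there k∈)) p
...       | R' , R↭ | k₁ , k₁∈ , q with same-name N k₁∈ (here refl) q (here refl) (sym eq)
...         | refl = Net-↭ (↭-sym perm) (preserve-ax-cut-consumed N' p)
  where
    N' : Net (axL a b ∷ cutL b c ∷ k ∷ R')
    N' = Net-↭ (prep _ (prep _ R↭)) N

    A = axL a b ∷ cutL b c ∷ k ∷ []

    untouched : map (renLink a c) R' ≡ R'
    untouched = map-renLink-id (All.tail (All.tail (All.tail (links-ok N'))))
      (λ m n → proj₂ (proj₂ (names-split {A} N')) (here refl) (∈-concatMap⁺ names m n))
      other
      where
        other : ∀ {k₂ e₂} → k₂ ∈ R' → e₂ ∈ prem0 k₂ → name e₂ ≢ name a
        other m n eq₂ with producer N' (there (there (there m))) n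
        ... | _ , m' , n' with same-name N' m' (here refl) n' (here refl) eq₂
        ...   | refl = prem-disjoint {A} N' (there (there (∈-++⁺ˡ p))) (∈-concatMap⁺ prem0 m n)

    perm : renLinks a c R ↭ renLink a c k ∷ R'
    perm = ↭-trans (↭-reflexive (renLinks≡map R))
      (↭-trans (Permₚ.map⁺ (renLink a c) R↭) (prep _ (↭-reflexive untouched)))

rotate₃ : ∀ {x y z : Link} {R} → x ∷ y ∷ z ∷ R ↭ z ∷ x ∷ y ∷ R
rotate₃ = ↭-trans (prep _ (swap _ _ ↭-refl)) (swap _ _ ↭-refl)

preserve : ∀ {ls ls'} → Net ls → ls ⟶ ls' → Net ls'
preserve N (ax-cut p ha hc) =
  preserve-ax-cut (Net-↭ (swap _ _ ↭-refl) (orient-cut hc (Net-↭ (swap _ _ ↭-refl) (orient-ax ha (Net-↭ p N)))))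
preserve N (tens-par p hc) =
  preserve-tens-par (Net-↭ (↭-sym rotate₃) (orient-cut hc (Net-↭ rotate₃ (Net-↭ p N))))
preserve N (box-open p hc) =
  preserve-box-open (Net-↭ (↭-sym rotate₃) (orient-cut hc (Net-↭ rotate₃ (Net-↭ p N))))
preserve N (sync-one {ps = ps} p) = preserve-sync-one {ps} (Net-↭ p N)
preserve N (sync-push bl p q fi fj i≢j) =
  preserve-sync-push bl i≢j (FreshNet-↭ (swap _ _ ↭-refl) (FreshNet-sync q (FreshNet-↭ (swap _ _ ↭-refl)
    (FreshNet-↭ p (N , Fresh⇒NotIn fi ∷ Fresh⇒NotIn fj ∷ [])))))
preserve N (sync-ax p ha pos q fi) =
  Net-↭ (swap _ _ ↭-refl) (preserve-sync-ax (FreshNet-↭ (swap _ _ ↭-refl) (FreshNet-sync q (FreshNet-↭ (swap _ _ ↭-refl)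
    (FreshNet-ax ha (FreshNet-↭ p (N , Fresh⇒NotIn fi ∷ [])))))) pos)
preserve N (sync-cut p q hc neg fi) =
  preserve-sync-cut (FreshNet-cut hc (FreshNet-↭ (swap _ _ ↭-refl) (FreshNet-sync q
    (FreshNet-↭ p (N , Fresh⇒NotIn fi ∷ []))))) neg

-- Normal nets

unused : ∀ (xs : List ℕ) → ∃ λ i → i ∉ xs
unused xs with bound xs
  where
    bound : ∀ xs → ∃ λ n → All (_< n) xs
    bound [] = 0 , []
    bound (x ∷ xs) with bound xs
    ... | n , a = suc x ⊔ n , ℕₚ.m≤m⊔n (suc x) n ∷ All.map (λ p → ℕₚ.≤-trans p (ℕₚ.m≤n⊔m (suc x) n)) a
... | n , a = n , λ m → ℕₚ.<-irrefl refl (All.lookup a m)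

Unique-member : ∀ {X Y : Set} (f : X → List Y) {xs k} → Unique (concatMap f xs) → k ∈ xs → Unique (f k)
Unique-member f {x ∷ _} u (here refl) = proj₁ (Unique-++⁻ (f x) u)
Unique-member f {x ∷ _} u (there m) = Unique-member f (proj₁ (proj₂ (Unique-++⁻ (f x) u))) m

Ax-sym : ∀ {a b k} → AxOf a b k → AxOf b a k
Ax-sym (inj₁ eq) = inj₂ eq
Ax-sym (inj₂ eq) = inj₁ eq

Cut-sym : ∀ {a b k} → CutOf a b k → CutOf b a k
Cut-sym (inj₁ eq) = inj₂ eq
Cut-sym (inj₂ eq) = inj₁ eq

Cut-type : ∀ {e f k} → CutOf e f k → Typed k → ty f ≡ ty e ᗮ
Cut-type (inj₁ refl) t = t
Cut-type (inj₂ refl) t = dual-sym t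

pos-⊥Free : ∀ {A} → Positive A → ⊥Free A
pos-⊥Free pos-1 = bf-1
pos-⊥Free (pos-⊗ p q) = bf-⊗ (pos-⊥Free p) (pos-⊥Free q)

neg-¬⊥Free : ∀ {A} → Negative A → ¬ ⊥Free A
neg-¬⊥Free (neg-⅋ p q) (bf-⅋ x y) = neg-¬⊥Free p x

module Progress {ls : List Link} (N : Net ls) (nf : Normal ls) where

  no-ax-cut : ∀ {a b c k k'} → k ∈ ls → k' ∈ ls → AxOf a b k → CutOf b c k' → ⊥
  no-ax-cut {k = k} {k'} m m' ha hc with extract-all ((distinct ha hc ∷ []) ∷ [] ∷ []) (m ∷ m' ∷ [])
    where
      distinct : ∀ {a b c} → AxOf a b k → CutOf b c k' → k ≢ k'
      distinct (inj₁ refl) (inj₁ refl) ()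
      distinct (inj₁ refl) (inj₂ refl) ()
      distinct (inj₂ refl) (inj₁ refl) ()
      distinct (inj₂ refl) (inj₂ refl) ()
  ... | _ , p = nf _ (ax-cut p ha hc)

  no-tens-par : ∀ {a b c a' b' c' k} → tensL a b c ∈ ls → parL a' b' c' ∈ ls → k ∈ ls → CutOf c c' k → ⊥
  no-tens-par {a} {b} {c} {a'} {b'} {c'} {k} m m' m'' hc
    with extract-all (((λ ()) ∷ proj₁ (distinct hc) ∷ []) ∷ (proj₂ (distinct hc) ∷ []) ∷ [] ∷ []) (m ∷ m' ∷ m'' ∷ [])
    where
      distinct : CutOf c c' k → tensL a b c ≢ k × parL a' b' c' ≢ k
      distinct (inj₁ refl) = (λ ()) , (λ ())
      distinct (inj₂ refl) = (λ ()) , (λ ())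
  ... | _ , p = nf _ (tens-par p hc)

  no-box-open : ∀ {l Γ C x k} → botL l Γ C ∈ ls → oneL x ∈ ls → k ∈ ls → CutOf l x k → ⊥
  no-box-open {l} {Γ} {C} {x} {k} m m' m'' hc
    with extract-all (((λ ()) ∷ proj₁ (distinct hc) ∷ []) ∷ (proj₂ (distinct hc) ∷ []) ∷ [] ∷ []) (m ∷ m' ∷ m'' ∷ [])
    where
      distinct : CutOf l x k → botL l Γ C ≢ k × oneL x ≢ k
      distinct (inj₁ refl) = (λ ()) , (λ ())
      distinct (inj₂ refl) = (λ ()) , (λ ())
  ... | _ , p = nf _ (box-open p hc)

  no-sync-push : ∀ {K a b c d ps} → BinLink K → K a b c ∈ ls → syncL ps ∈ ls → (c , d) ∈ ps → ⊥
  no-sync-push {K} {a} {b} {c} {d} {ps} bl m m' q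
    with extract-all ((distinct bl ∷ []) ∷ [] ∷ []) (m ∷ m' ∷ []) | extract q | unused (map name (edgesL ls))
    where
      distinct : ∀ {K} → BinLink K → K a b c ≢ syncL ps
      distinct isTens ()
      distinct isPar ()
  ... | _ , p | _ , p' | i , i∉ with unused (i ∷ map name (edgesL ls))
  ...   | j , j∉ = nf _ (sync-push bl p p' i∉ (λ m → j∉ (there m)) (λ { refl → j∉ (here refl) }))

  no-sync-ax : ∀ {a b d k ps} → k ∈ ls → AxOf a b k → Positive (ty a) → syncL ps ∈ ls → (a , d) ∈ ps → ⊥
  no-sync-ax {a} {b} {d} {k} {ps} m ha pos m' q
    with extract-all ((distinct ha ∷ []) ∷ [] ∷ []) (m ∷ m' ∷ []) | extract q | unused (map name (edgesL ls))
    where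
      distinct : AxOf a b k → k ≢ syncL ps
      distinct (inj₁ refl) ()
      distinct (inj₂ refl) ()
  ... | _ , p | _ , p' | i , i∉ = nf _ (sync-ax p ha pos p' i∉)

  no-sync-cut : ∀ {p x y k ps} → syncL ps ∈ ls → (p , y) ∈ ps → k ∈ ls → CutOf x y k → Negative (ty y) → ⊥
  no-sync-cut {p₀} {x} {y} {k} {ps} m q m' hc neg
    with extract-all ((distinct hc ∷ []) ∷ [] ∷ []) (m ∷ m' ∷ []) | extract q | unused (map name (edgesL ls))
    where
      distinct : CutOf x y k → syncL ps ≢ k
      distinct (inj₁ refl) ()
      distinct (inj₂ refl) ()
  ... | _ , p | _ , p' | i , i∉ = nf _ (sync-cut p p' hc neg i∉)

  no-sync-one : ∀ {ps} → syncL ps ∈ ls → (∀ {q} → q ∈ ps → oneL (proj₁ q) ∈ ls) → ⊥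
  no-sync-one {ps} m f
    with extract-all {ks = syncL ps ∷ ones proj₁ ps}
      (Unique-∷ not-one (distinct ps (Unique-member cons (cons-unique N) m))) (m ∷ All-ones proj₁ f)
    where
      not-one : syncL ps ∉ ones proj₁ ps
      not-one n with ∈-ones⁻ proj₁ ps n
      ... | _ , _ , ()
      distinct : ∀ ps → Unique (map proj₁ ps) → Unique (ones proj₁ ps)
      distinct [] [] = []
      distinct (q ∷ ps) (p ∷ u) = Unique-∷ (λ n → fresh (∈-ones⁻ proj₁ ps n)) (distinct ps u)
        where
          fresh : (∃ λ q' → q' ∈ ps × oneL (proj₁ q) ≡ oneL (proj₁ q')) → ⊥
          fresh ((.(proj₁ q) , _) , q'∈ , refl) = All≢⇒∉ p (∈-map⁺ proj₁ q'∈)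
  ... | _ , p = nf _ (sync-one p)

  data Source (e : Edge) : Set where
    ax   : ∀ {x k} → k ∈ ls → AxOf e x k → Source e
    tens : ∀ {a b} → tensL a b e ∈ ls → Source e
    par  : ∀ {a b} → parL a b e ∈ ls → Source e
    one  : oneL e ∈ ls → Source e
    lock : ∀ {Γ C} → botL e Γ C ∈ ls → Source e
    aux  : ∀ {l Γ C} → botL l Γ C ∈ ls → e ∈ Γ → Source e
    sync : ∀ {p ps} → syncL ps ∈ ls → (p , e) ∈ ps → Source e

  source : ∀ {k e} → k ∈ ls → e ∈ prem0 k → Source e
  source k∈ e∈ with producer N k∈ e∈
  ... | axL a b , m , here refl = ax m (inj₁ refl)
  ... | axL a b , m , there (here refl) = ax m (inj₂ refl)
  ... | tensL a b c , m , here refl = tens m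
  ... | parL a b c , m , here refl = par m
  ... | oneL a , m , here refl = one m
  ... | botL l Γ C , m , here refl = lock m
  ... | botL l Γ C , m , there p = aux m p
  ... | syncL ps , m , p with ∈-map⁻ proj₂ p
  ...   | _ , q , refl = sync m q

  pair-ok : ∀ {ps q} → syncL ps ∈ ls → q ∈ ps → SyncPairOK q
  pair-ok {ps} m q∈ = All.lookup (pairs-ok {ps} (ty-of N m)) q∈

  -- The states of the walk: an edge carrying ⊥ is followed downwards until it is cut;
  -- the dual edge is followed upwards to the sync link or the box producing it.

  data Down (e : Edge) : Set where
    lock : ∀ {Γ C} → botL e Γ C ∈ ls → Down e
    tens : ∀ {a b} → tensL a b e ∈ ls → ¬ ⊥Free (ty e) → Down e
    par  : ∀ {a b} → parL a b e ∈ ls → ¬ ⊥Free (ty e) → Down e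
    sync : ∀ {p ps} → syncL ps ∈ ls → (p , e) ∈ ps → Negative (ty e) → Down e

  data Up (e : Edge) : Set where
    aux  : ∀ {l Γ C} → botL l Γ C ∈ ls → e ∈ Γ → Up e
    sync : ∀ {p ps} → syncL ps ∈ ls → (p , e) ∈ ps → Positive (ty e) → Up e

  Good : State → Set
  Good (dn e) = Down e
  Good (up e) = Up e

  Down-¬⊥Free : ∀ {e} → Down e → ¬ ⊥Free (ty e)
  Down-¬⊥Free (lock m) f with subst ⊥Free (proj₁ (ty-of N m)) f
  ... | ()
  Down-¬⊥Free (tens _ h) = h
  Down-¬⊥Free (par _ h) = h
  Down-¬⊥Free (sync _ _ n) = neg-¬⊥Free n

  Down-producer : ∀ {e} → Down e → ∃ λ k → k ∈ ls × e ∈ concl0 k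
  Down-producer (lock m) = _ , m , here refl
  Down-producer (tens m _) = _ , m , here refl
  Down-producer (par m _) = _ , m , here refl
  Down-producer (sync m q _) = _ , m , ∈-map⁺ proj₂ q

  lock∉ : ∀ {l Γ C} → botL l Γ C ∈ ls → l ∉ Γ
  lock∉ {l} {Γ} {C} m l∈ with Unique-member names (names-unique N) m | ok-of N m
  ... | p ∷ _ | (_ , oks) , _ , Γ⊆ , _ = All≢⇒∉ p (∈-map⁺ name (conclsL0⊆prodsL C oks (proj₁ (Γ⊆ _ l∈))))

  Up-source : ∀ {e k} → Up e → k ∈ ls → e ∈ concl0 k →
              (∃ λ l → ∃ λ Γ → ∃ λ C → k ≡ botL l Γ C × e ∈ Γ) ⊎ (∃ λ ps → k ≡ syncL ps × Positive (ty e))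
  Up-source (aux m e∈) k∈ p = inj₁ (_ , _ , _ , producer-unique N k∈ m p (there e∈) , e∈)
  Up-source (sync m q pos) k∈ p = inj₂ (_ , producer-unique N k∈ m p (∈-map⁺ proj₂ q) , pos)

  -- The two kinds of state have different producers, and a producer is unique. Wherever the walk
  -- changes direction, this shows that it leaves by another port than the one it came in by.
  Down-Up : ∀ {e} → Down e → ¬ Up e
  Down-Up (lock m) u with Up-source u m (here refl)
  ... | inj₁ (_ , _ , _ , refl , e∈) = lock∉ m e∈
  ... | inj₂ (_ , () , _)
  Down-Up (tens m _) u with Up-source u m (here refl)
  ... | inj₁ (_ , _ , _ , () , _)
  ... | inj₂ (_ , () , _)
  Down-Up (par m _) u with Up-source u m (here refl)
  ... | inj₁ (_ , _ , _ , () , _)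
  ... | inj₂ (_ , () , _)
  Down-Up (sync m q n) u with Up-source u m (∈-map⁺ proj₂ q)
  ... | inj₁ (_ , _ , _ , () , _)
  ... | inj₂ (_ , _ , pos) = pos-neg pos n

  Out : Link → State → Set
  Out (tensL a b c) t = t ≡ dn c
  Out (parL a b c) t = t ≡ dn c
  Out (cutL x y) t = ∃ λ f → t ≡ up f × f ∈ x ∷ y ∷ []
  Out (botL l Γ C) t = t ≡ dn l
  Out (syncL ps) (dn e) = e ∈ map proj₂ ps × Negative (ty e)
  Out (syncL ps) (up e) = e ∈ map proj₁ ps × Positive (ty e)
  Out _ _ = ⊥

  -- Sync links are always entered through an out-edge and left through an in-edge, so
  -- any entry of the walk may be combined with any of its exits.
  walk-pass : ∀ k {s t} → k ∈ ls → Good s → Ent k s → Good t → Out k t → Pass k s t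
  walk-pass (tensL a b c) {dn _} k∈ g h g' refl = pass h (here refl) (λ ()) (λ ())
  walk-pass (tensL a b c) {up _} k∈ g (here refl) g' refl = ⊥-elim (Down-Up g' g)
  walk-pass (parL a b c) {dn _} k∈ g h g' refl = pass h (here refl) (λ ()) (λ _ ())
  walk-pass (parL a b c) {up _} k∈ g (here refl) g' refl = ⊥-elim (Down-Up g' g)
  walk-pass (cutL x y) {dn _} k∈ g h g' (f , refl , f∈) = pass h f∈ (λ { refl → Down-Up g g' }) (λ ())
  walk-pass (botL l Γ C) {up _} k∈ g h g' refl = pass h (here refl) (λ { refl → Down-Up g' g }) (λ ())
  walk-pass (syncL ps) {dn e} {dn e'} k∈ g h g' (m , n) = pass h m (λ ()) (λ _ p → pos-neg p n)
  walk-pass (syncL ps) {dn e} {up e'} k∈ g h g' (m , p) =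
    pass h m (λ { refl → Down-¬⊥Free g (pos-⊥Free p) }) (λ _ n → pos-neg p n)
  walk-pass (syncL ps) {up e} {up e'} k∈ g h g' (m , p) = pass h m (λ ()) (λ _ n → pos-neg p n)
  walk-pass (syncL ps) {up e} {dn e'} k∈ g h g' (m , n) =
    pass h m (λ { refl → Down-Up g' g }) (λ _ p → pos-neg p n)

  -- Doubly negated, because a continuation is found by contradiction: were there none, a conclusion
  -- of the net would carry ⊥ or a rule would apply.
  Step : State → Set
  Step s = (∀ k t → k ∈ ls → Ent k s → Good t → Out k t → ⊥) → ⊥

  -- Any other source of `f` yields a redex or a clash of types. In particular a lock above `f`
  -- would give `e` the type `𝟏`, although `e` carries ⊥.
  cut-up : ∀ {e f k} → k ∈ ls → CutOf e f k → f ∈ prem0 k → Down e → Up f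
  cut-up {e} {f} m hc f∈ d with source m f∈ | Cut-type hc (ty-of N m)
  ... | ax m' ha | _ = ⊥-elim (no-ax-cut m' m (Ax-sym ha) (Cut-sym hc))
  ... | aux m' p | _ = aux m' p
  ... | lock m' | t = ⊥-elim (Down-¬⊥Free d (subst ⊥Free (sym (trans (dual-sym t) (cong _ᗮ (proj₁ (ty-of N m'))))) bf-1))
  ... | sync m' q | _ with pair-ok m' q
  ...   | eq , inj₁ pos = sync m' q (subst Positive eq pos)
  ...   | eq , inj₂ neg = ⊥-elim (no-sync-cut m' q m hc (subst Negative eq neg))
  cut-up m hc f∈ (lock m'') | one m' | _ = ⊥-elim (no-box-open m'' m' m hc)
  cut-up m hc f∈ (tens m'' _) | one m' | t with trans (sym (ty-of N m')) (trans t (cong _ᗮ (ty-of N m'')))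
  ... | ()
  cut-up m hc f∈ (par m'' _) | one m' | t with trans (sym (ty-of N m')) (trans t (cong _ᗮ (ty-of N m'')))
  ... | ()
  cut-up m hc f∈ (sync m'' q n) | _ | _ = ⊥-elim (no-sync-cut m'' q m (Cut-sym hc) n)
  cut-up m hc f∈ (lock m'') | tens m' | t with trans (sym (ty-of N m')) (trans t (cong _ᗮ (proj₁ (ty-of N m''))))
  ... | ()
  cut-up m hc f∈ (tens m'' _) | tens m' | t with trans (sym (ty-of N m')) (trans t (cong _ᗮ (ty-of N m'')))
  ... | ()
  cut-up m hc f∈ (par m'' _) | tens m' | t = ⊥-elim (no-tens-par m' m'' m (Cut-sym hc))
  cut-up m hc f∈ (lock m'') | par m' | t with trans (sym (ty-of N m')) (trans t (cong _ᗮ (proj₁ (ty-of N m''))))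
  ... | ()
  cut-up m hc f∈ (par m'' _) | par m' | t with trans (sym (ty-of N m')) (trans t (cong _ᗮ (ty-of N m'')))
  ... | ()
  cut-up m hc f∈ (tens m'' _) | par m' | t = ⊥-elim (no-tens-par m'' m' m hc)

  ⊗-⊥Free : ∀ {A B} → ⊥Free (A ⊗ B) → ⊥Free A × ⊥Free B
  ⊗-⊥Free (bf-⊗ p q) = p , q

  ⅋-⊥Free : ∀ {A B} → ⊥Free (A ⅋ B) → ⊥Free A × ⊥Free B
  ⅋-⊥Free (bf-⅋ p q) = p , q

  step-down : ∀ {e} → Down e → Step (dn e)
  step-down {e} d go with Down-producer d
  ... | k₀ , k₀∈ , p₀ = Down-¬⊥Free d (closed N e (∈-concatMap⁺ concl0 k₀∈ p₀ , λ m → consumed (∈-concatMap⁻ prem0 ls m)))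
    where
      bad = Down-¬⊥Free d
      consumed : (∃ λ k → k ∈ ls × e ∈ prem0 k) → ⊥
      consumed (cutL x y , m , h@(here refl)) =
        go _ _ m h (cut-up m (inj₁ refl) (there (here refl)) d) (_ , refl , there (here refl))
      consumed (cutL x y , m , h@(there (here refl))) =
        go _ _ m h (cut-up m (inj₂ refl) (here refl) d) (_ , refl , here refl)
      consumed (tensL a b c , m , h@(here refl)) =
        go _ _ m h (tens m (λ f → bad (proj₁ (⊗-⊥Free (subst ⊥Free (ty-of N m) f))))) refl
      consumed (tensL a b c , m , h@(there (here refl))) =
        go _ _ m h (tens m (λ f → bad (proj₂ (⊗-⊥Free (subst ⊥Free (ty-of N m) f))))) refl
      consumed (parL a b c , m , h@(here refl)) =
        go _ _ m h (par m (λ f → bad (proj₁ (⅋-⊥Free (subst ⊥Free (ty-of N m) f))))) refl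
      consumed (parL a b c , m , h@(there (here refl))) =
        go _ _ m h (par m (λ f → bad (proj₂ (⅋-⊥Free (subst ⊥Free (ty-of N m) f))))) refl
      consumed (syncL ps , m , h) with ∈-map⁻ proj₁ h
      ... | (_ , d') , q , refl with pair-ok m q
      -- A positive type contains no ⊥, so going downwards the walk meets a sync link only at a
      -- negative premiss, which is an out-edge.
      ...   | eq , inj₁ pos = bad (pos-⊥Free pos)
      ...   | eq , inj₂ neg = go _ (dn d') m h (sync m q (subst Negative eq neg)) (∈-map⁺ proj₂ q , subst Negative eq neg)

  step-up : ∀ {e} → Up e → Step (up e)
  step-up (aux m e∈) go = go _ _ m (there e∈) (lock m) refl
  -- If no pair lets the walk continue, every premiss comes from a one link and the sync link can be
  -- erased.
  step-up {e} (sync {ps = ps} m q₀ pos₀) go = no-sync-one m each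
    where
      each : ∀ {q} → q ∈ ps → oneL (proj₁ q) ∈ ls
      each {p , d} q with pair-ok m q
      ... | eq , inj₂ neg = ⊥-elim (go _ (dn d) m (∈-map⁺ proj₂ q₀) (sync m q (subst Negative eq neg))
                                     (∈-map⁺ proj₂ q , subst Negative eq neg))
      ... | eq , inj₁ pos with source m (∈-map⁺ proj₁ q)
      ...   | ax m' ha = ⊥-elim (no-sync-ax m' ha pos m q)
      ...   | tens m' = ⊥-elim (no-sync-push isTens m' m q)
      ...   | par m' = ⊥-elim (no-sync-push isPar m' m q)
      ...   | one m' = m'
      ...   | lock m' = ⊥-elim (pos-neg pos (subst Negative (sym (proj₁ (ty-of N m'))) neg-⊥))
      ...   | aux m' p∈ = ⊥-elim (go _ (up p) m (∈-map⁺ proj₂ q₀) (aux m' p∈) (∈-map⁺ proj₁ q , pos))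
      ...   | sync m' q' = ⊥-elim (go _ (up p) m (∈-map⁺ proj₂ q₀) (sync m' q' pos) (∈-map⁺ proj₁ q , pos))

  step : ∀ s → Good s → Step s
  step (dn e) = step-down
  step (up e) = step-up

  -- The last link visited comes first. Entries and exits are stored separately instead of as a
  -- `Pass`, because at a revisit the new entry is combined with the exit taken at the earlier
  -- visit.
  data Walk : List Link → State → Set where
    start : ∀ {s} → Good s → Walk [] s
    extend : ∀ {ks k s t} → Walk ks s → k ∈ ls → Ent k s → Good t → Out k t → Walk (k ∷ ks) t

  Walk-good : ∀ {ks s} → Walk ks s → Good s
  Walk-good (start g) = g
  Walk-good (extend _ _ _ g _) = g

  Walk-inside : ∀ {ks s} → Walk ks s → All (_∈ ls) ks
  Walk-inside (start _) = []
  Walk-inside (extend w m _ _ _) = m ∷ Walk-inside w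

  record Since (k : Link) (ks : List Link) (s : State) : Set where
    constructor since
    field
      {exit₀} : State
      {nodes} : List Link
      good    : Good exit₀
      out     : Out k exit₀
      path    : Path exit₀ nodes s
      simple  : Unique (k ∷ nodes)
      among   : ∀ {k'} → k' ∈ nodes → k' ∈ ks

  since-visit : ∀ {ks s k} → Walk ks s → Unique ks → k ∈ ks → Since k ks s
  since-visit (extend w m h g o) u (here refl) = since g o [] ([] ∷ []) (λ ())
  since-visit (extend {k = k₁} w m h g o) (k₁∉ ∷ u) (there k∈) with since-visit w u k∈
  ... | since {nodes = ns} g₀ o₀ p v am =
    since g₀ o₀ (Path-++ p (walk-pass k₁ m (Walk-good w) h g o ∷ []))
      (Unique-++⁺ v ([] ∷ []) λ { (here refl) (here refl) → All≢⇒∉ k₁∉ k∈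
                                ; (there n) (here refl) → All≢⇒∉ k₁∉ (am n) })
      (λ n → [ (λ n → there (am n)) , (λ { (here refl) → here refl }) ] (∈-++⁻ ns n))

  -- `n` is fuel for the extensions still to be made. A walk without repetition has at most
  -- `length ls` links, and an extension creates no repetition since a revisit would close a cycle.
  walk-stuck : ∀ n {ks s} → Walk ks s → Unique ks → length ls < n + length ks → ⊥
  walk-stuck zero {ks} w u lt with extract-all u (Walk-inside w)
  ... | rest , p = ℕₚ.<⇒≱ lt (subst (length ks ≤_)
    (sym (trans (Permₚ.↭-length p) (Listₚ.length-++ ks))) (ℕₚ.m≤m+n (length ks) (length rest)))
  walk-stuck (suc n) {ks} {s} w u lt = step s (Walk-good w) λ k t k∈ h g o →
    walk-stuck n (extend w k∈ h g o) (Unique-∷ (revisit k∈ h) u)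
      (subst (length ls <_) (sym (ℕₚ.+-suc n (length ks))) lt)
    where
      revisit : ∀ {k} → k ∈ ls → Ent k s → k ∉ ks
      revisit {k} k∈ h k∈ks with since-visit w u k∈ks
      ... | since g₀ o₀ p v am = acyclic N (cycle (walk-pass k k∈ (Walk-good w) h g₀ o₀ ∷ p) v
              (k∈ ∷ All.tabulate (λ m → All.lookup (Walk-inside w) (am m))))

  no-good : ∀ s → ¬ Good s
  no-good s g = walk-stuck (suc (length ls)) (start g) [] (subst (length ls <_) (sym (ℕₚ.+-identityʳ _)) ℕₚ.≤-refl)

  -- Normal nets are plain

  no-box : ∀ {l Γ C} → botL l Γ C ∉ ls
  no-box m = no-good (dn _) (lock m)

  no-pair : ∀ {ps q} → syncL ps ∈ ls → q ∉ ps
  no-pair m q with pair-ok m q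
  ... | eq , inj₁ pos = no-good (up _) (sync m q (subst Positive eq pos))
  ... | eq , inj₂ neg = no-good (dn _) (sync m q (subst Negative eq neg))

  no-sync : ∀ {ps} → syncL ps ∉ ls
  no-sync {[]} m = ty-of N m
  no-sync {_ ∷ _} m = no-pair m (here refl)

  -- Once boxes and sync links are excluded, an axiom above the cut makes it a redex, and among
  -- tensors, pars and ones the only dual types are those of a tensor and a par, again a redex.
  no-cut : ∀ {x y} → cutL x y ∉ ls
  no-cut m with source m (here refl) | source m (there (here refl)) | ty-of N m
  ... | ax m' ha | _ | _ = no-ax-cut m' m (Ax-sym ha) (inj₁ refl)
  ... | lock m' | _ | _ = no-box m'
  ... | aux m' _ | _ | _ = no-box m'
  ... | sync m' _ | _ | _ = no-sync m'
  ... | _ | ax m' ha | _ = no-ax-cut m' m (Ax-sym ha) (inj₂ refl)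
  ... | _ | lock m' | _ = no-box m'
  ... | _ | aux m' _ | _ = no-box m'
  ... | _ | sync m' _ | _ = no-sync m'
  ... | tens p | par q | _ = no-tens-par p q m (inj₁ refl)
  ... | par p | tens q | _ = no-tens-par q p m (inj₂ refl)
  ... | tens p | tens q | t with trans (sym (ty-of N q)) (trans t (cong _ᗮ (ty-of N p)))
  ...   | ()
  no-cut m | tens p | one q | t with trans (sym (ty-of N q)) (trans t (cong _ᗮ (ty-of N p)))
  ...   | ()
  no-cut m | par p | par q | t with trans (sym (ty-of N q)) (trans t (cong _ᗮ (ty-of N p)))
  ...   | ()
  no-cut m | par p | one q | t with trans (sym (ty-of N q)) (trans t (cong _ᗮ (ty-of N p)))
  ...   | ()
  no-cut m | one p | tens q | t with trans (sym (ty-of N q)) (trans t (cong _ᗮ (ty-of N p)))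
  ...   | ()
  no-cut m | one p | par q | t with trans (sym (ty-of N q)) (trans t (cong _ᗮ (ty-of N p)))
  ...   | ()
  no-cut m | one p | one q | t with trans (sym (ty-of N q)) (trans t (cong _ᗮ (ty-of N p)))
  ...   | ()

  plain : ∀ {k} → k ∈ ls → PlainLink k
  plain {axL a b} m = p-ax
  plain {cutL a b} m = ⊥-elim (no-cut m)
  plain {tensL a b c} m = p-tens
  plain {parL a b c} m = p-par
  plain {oneL a} m = p-one
  plain {botL l Γ C} m = ⊥-elim (no-box m)
  plain {syncL ps} m = ⊥-elim (no-sync m)

-- From a closed SMLL net to its normal form

SMLLNet⇒Net : ∀ {ls} → SMLLNet ls → Closed ls → Net ls
SMLLNet⇒Net {ls} ((uN , uC , lvl , oks) , t , acyc , bc) cl = record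
  { names-unique = uN' ; cons-unique = uC'
  ; level = λ {e} → lvl e
  ; links-ok = oks'
  ; typed = TypedL⇒All ls t
  ; boxes = AllBoxesCorrect⇒All ls bc
  ; acyclic = λ cy → acyc (Cycle⇒SwitchingCycle (linear-net uN' uC' oks') cy)
  ; closed = cl }
  where
    uN' = subst Unique (map-name-prodsL ls) uN
    uC' = subst Unique (consL≡ ls) uC
    oks' = AllLinkOK⇒All ls oks

preserve* : ∀ {ls ls'} → Net ls → ls ⟶* ls' → Net ls'
preserve* N ε = N
preserve* N (r ◅ rs) = preserve* (preserve N r) rs

mainTheorem8 : ∀ (R R' : List Link) → SMLLNet R → Closed R
    → R ⟶* R' → Normal R' → All PlainLink R'
mainTheorem8 R R' net cl rs nf =
  All.tabulate (Progress.plain (preserve* (SMLLNet⇒Net net cl) rs) nf)
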